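{- Let $q$ be a power of a prime $p$ and let $\beta\in\mathbb{F}_q((1/z))$ be a formal Laurent series of positive degree. Then the following statements are equivalent: (i) $\beta$ is algebraic over $\mathbb{F}_q(1/z)$; (ii) $d_\beta(1)$ is $p$-automatic; (iii) for any $x\in\mathbb{F}_q[[1/z]]$, $d_\beta(x)$ is $p$-automatic if and only if $x$ is algebraic over $\mathbb{F}_q(1/z)$.
   Context: $\mathbb{F}_q((1/z))$ is the field of formal Laurent series $x=\sum_{n\ge -m}c_nz^{ -n}$ with $c_n\in\mathbb{F}_q$, $m\in\mathbb{Z}$; if $c_{ -m}\ne0$ then $m$ is called the degree of $x$. $\mathbb{F}_q[[1/z]]$ is the set of series of degree at most $0$ (including $0$). The integer part of $x$ is $[x]=\sum_{ -m\le n\le0}c_nz^{ -n}\in\mathbb{F}_q[z]$. For $\beta$ of positive degree define $T:\mathbb{F}_q[[1/z]]\to\mathbb{F}_q[[1/z]]$ by $T(x)=\beta x-[\beta x]$, let $T^n$ be its $n$-th iterate and $T^0(x)=x$. For $x\in\mathbb{F}_q[[1/z]]$ put $a_n=[\beta T^{n-1}(x)]\in\mathbb{F}_q[z]$ for $n\ge1$; then $x=\sum_{n\ge1}a_n\beta^{ -n}$. The $\beta$-expansion of $x$ is the sequence $d_\beta(x)=\{a_n\}_{n\ge1}$. A sequence $\{a_n\}_{n\ge1}$ is $p$-automatic if its $p$-kernel, i.e. the set of sequences $\{a_{np^i+j+1}\}_{n\ge0}$ with $i\ge0$ and $0\le j<p^i$, is finite. -}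

module Defs where

open import Algebra.Bundles using (CommutativeRing)
import Algebra.Properties.CommutativeMonoid.Sum as Sum
open import Data.Bool.Base using (if_then_else_)
open import Data.Fin.Base using (Fin; toℕ)
open import Data.Integer.Base as ℤ using (ℤ; +_; -[1+_]; _⊖_)
open import Data.List.Base using (List; []; _∷_; map)
open import Data.List.Relation.Unary.All using (All)
open import Data.List.Relation.Unary.Any using (Any)
import Data.List.Relation.Unary.Enumerates.Setoid as Enumerates
open import Data.Nat.Base as ℕ using (ℕ; zero; suc; _∸_; _≤ᵇ_; _^_)
open import Data.Nat.GeneralisedArithmetic using (fold)
open import Data.Product.Base using (Σ-syntax; ∃-syntax; _×_; _,_)
import Function.Indexed.Relation.Binary.Equality as FunctionEquality
open import Function.Bundles using (Inverse)
open import Level using (Level; 0ℓ; _⊔_) renaming (suc to lsuc)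
open import Relation.Binary.Bundles using (Setoid)
import Relation.Binary.Construct.On as On
import Relation.Binary.Indexed.Heterogeneous.Construct.Trivial as Trivial
import Relation.Binary.PropositionalEquality.Properties as ≡
open import Relation.Nullary.Negation.Core using (¬_)

private
  variable
    a ℓ : Level

record FiniteField c ℓ (q : ℕ) : Set (lsuc (c ⊔ ℓ)) where
  field
    commutativeRing : CommutativeRing c ℓ

  open CommutativeRing commutativeRing public

  field
    1≉0     : ¬ (1# ≈ 0#)
    inverse : ∀ x → ¬ (x ≈ 0#) → ∃[ y ] x * y ≈ 1#
    card    : Inverse setoid (≡.setoid (Fin q))

IsFinite : Setoid a ℓ → Set (a ⊔ ℓ)
IsFinite S = ∃[ xs ] Enumerates.IsEnumeration S xs

-- A sequence {aₙ}ₙ≥₁ is represented by the function s with s n = aₙ₊₁, so that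
-- a_{n pⁱ + j + 1} is s (n pⁱ + j).
module _ (S : Setoid a ℓ) (p : ℕ) (s : ℕ → Setoid.Carrier S) where

  KernelIndex : Set
  KernelIndex = Σ[ i ∈ ℕ ] Fin (p ^ i)

  kernelSequence : KernelIndex → ℕ → Setoid.Carrier S
  kernelSequence (i , j) n = s (n ℕ.* p ^ i ℕ.+ toℕ j)

  -- The p-kernel, as the image of kernelSequence: indices are identified when
  -- they give the same sequence.
  kernel : Setoid 0ℓ ℓ
  kernel = On.setoid
    (FunctionEquality.≡-setoid ℕ (Trivial.indexedSetoid S)) kernelSequence

  IsAutomatic : Set ℓ
  IsAutomatic = IsFinite kernel

module LaurentSeries {c ℓ} {q : ℕ} (F : FiniteField c ℓ q) where
  private
    module F = FiniteField F

  open Sum F.+-commutativeMonoid using (sum⁺-syntax)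

  -- ⟨ m , u ⟩ is the series Σ_{k ≥ 0} u k z^{m - k}.  The leading coefficient
  -- u 0 may vanish, so m is only an upper bound for the degree; such a bound
  -- can always be chosen in ℕ.
  record Laurent : Set c where
    constructor ⟨_,_⟩
    field
      bound : ℕ
      coefs : ℕ → F.Carrier

  open Laurent public

  extend : (ℕ → F.Carrier) → ℤ → F.Carrier
  extend u (+ k)    = u k
  extend u -[1+ _ ] = F.0#

  -- coeff x n is the coefficient of z⁻ⁿ.
  coeff : Laurent → ℤ → F.Carrier
  coeff x n = extend (coefs x) (n ℤ.+ + bound x)

  infix 4 _≈_
  _≈_ : Laurent → Laurent → Set ℓ
  x ≈ y = ∀ n → coeff x n F.≈ coeff y n

  laurentSetoid : Setoid c ℓ
  laurentSetoid = record
    { Carrier       = Laurent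
    ; _≈_           = _≈_
    ; isEquivalence = record
      { refl  = λ _ → F.refl
      ; sym   = λ e n → F.sym (e n)
      ; trans = λ e f n → F.trans (e n) (f n)
      }
    }

  constant : F.Carrier → Laurent
  constant a = ⟨ 0 , (λ { zero → a ; (suc _) → F.0# }) ⟩

  0L 1L z⁻¹ : Laurent
  0L  = constant F.0#
  1L  = constant F.1#
  z⁻¹ = ⟨ 0 , (λ { 1 → F.1# ; _ → F.0# }) ⟩

  infixl 6 _+_ _-_
  infixl 7 _*_

  _+_ : Laurent → Laurent → Laurent
  x + y = ⟨ m , (λ k → coeff x (k ⊖ m) F.+ coeff y (k ⊖ m)) ⟩
    where m = bound x ℕ.⊔ bound y

  -_ : Laurent → Laurent
  - x = ⟨ bound x , (λ k → F.- coefs x k) ⟩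

  _-_ : Laurent → Laurent → Laurent
  x - y = x + (- y)

  _*_ : Laurent → Laurent → Laurent
  x * y = ⟨ bound x ℕ.+ bound y
          , (λ k → ∑[ i ≤ k ] (coefs x (toℕ i) F.* coefs y (k ∸ toℕ i))) ⟩

  HasDegree : Laurent → ℤ → Set ℓ
  HasDegree x d = ¬ (coeff x (ℤ.- d) F.≈ F.0#)
                × (∀ n → n ℤ.< ℤ.- d → coeff x n F.≈ F.0#)

  -- Membership of 𝔽_q[[1/z]].
  IsIntegral : Laurent → Set ℓ
  IsIntegral x = ∀ n → n ℤ.< ℤ.0ℤ → coeff x n F.≈ F.0#

  -- The k-th coefficient of x belongs to z^{bound x - k}.  The result is a
  -- polynomial in z, regarded as a Laurent series.
  integerPart : Laurent → Laurent
  integerPart x =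
    ⟨ bound x , (λ k → if k ≤ᵇ bound x then coefs x k else F.0#) ⟩

  -- Evaluation at y of the polynomial with coefficients as, constant term first.
  eval : List Laurent → Laurent → Laurent
  eval []       y = 0L
  eval (a ∷ as) y = a + y * eval as y

  atZ⁻¹ : List F.Carrier → Laurent
  atZ⁻¹ as = eval (map constant as) z⁻¹

  -- Membership of the subfield 𝔽_q(1/z): x = f(1/z) / g(1/z).
  IsRational : Laurent → Set (c ⊔ ℓ)
  IsRational x = ∃[ f ] ∃[ g ] (¬ (atZ⁻¹ g ≈ 0L)) × (atZ⁻¹ g * x ≈ atZ⁻¹ f)

  -- Algebraic over 𝔽_q(1/z).
  IsAlgebraic : Laurent → Set (c ⊔ ℓ)
  IsAlgebraic x = ∃[ as ] All IsRational as
                        × Any (λ a → ¬ (a ≈ 0L)) as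
                        × eval as x ≈ 0L

  -- On all of 𝔽_q((1/z)); its values lie in 𝔽_q[[1/z]].
  T : Laurent → Laurent → Laurent
  T β x = β * x - integerPart (β * x)

  -- The β-expansion, shifted as in IsAutomatic: expansion β x n = aₙ₊₁.
  expansion : Laurent → Laurent → ℕ → Laurent
  expansion β x n = integerPart (β * fold x (T β) n)

  IsAutomaticExpansion : ℕ → Laurent → Laurent → Set ℓ
  IsAutomaticExpansion p β x = IsAutomatic laurentSetoid p (expansion β x)

{-# OPTIONS --safe #-}
module Submission where

-- Put t = 1/z and w = 1/β, and let Q be a power of p with a^Q = a on 𝔽_q, so that
-- every series splits as u = Σ_{r<Q} X^r u_r(X)^Q with u_r the sections of u.
--
-- Automatic ⇒ algebraic: taking sections maps the finite p-kernel of a digit sequence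
-- into itself, so its span over the rational functions lies in the span of its Q-th
-- powers. Hence f, f^Q, f^{Q²}, … are linearly dependent and the digit series f is
-- algebraic; substituting w for X makes x algebraic over 𝔽_q(w, z). For x = 1 only the
-- leading digit has full degree in z, so the expansion is a nontrivial equation for z
-- over 𝔽_q(w)-algebraic elements; thus z is algebraic over 𝔽_q(w), and w over 𝔽_q(z).
--
-- Algebraic ⇒ automatic: let Λ send a Laurent series in t to its section of index 0,
-- so Λ(x^Q y) = x Λ(y). Inside a finite ring extension of 𝔽_q(t) containing β and y,
-- the maps y ↦ Λ(β^r y) with r < Q preserve a finite set of combinations with
-- coefficients of bounded degree, so n ↦ (coefficient of z⁰ in β^n y) is automatic.
-- The digits of x are recovered from such moment sequences through a Hankel matrix
-- that is anti-triangular modulo t and has algebraic entries.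

open import Defs
open import Algebra.Bundles using (CommutativeRing)
import Algebra.Properties.AbelianGroup as AbelianGroupProperties
import Algebra.Properties.CommutativeMonoid.Sum as Sum
import Algebra.Properties.CommutativeSemiring.Binomial as Binomial
import Algebra.Properties.CommutativeSemiring.Exp as Exp
import Algebra.Properties.Ring as RingProperties
import Algebra.Properties.Semiring.Mult as Mult×
import Algebra.Properties.Semiring.Mult.TCOptimised as Mult
import Algebra.Solver.Ring as Solver
open import Algebra.Solver.Ring.AlmostCommutativeRing using (_-Raw-AlmostCommutative⟶_; fromCommutativeRing)
open import Algebra.Structures using (IsCommutativeRing)
import Data.Bool.Base as Bool
open import Data.Bool.Base using (Bool; true; false; if_then_else_)
open import Data.Fin.Base as Fin using (Fin; toℕ; fromℕ<; inject₁; fromℕ)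
import Data.Fin.Permutation as Permutation
import Data.Fin.Properties as Fin
open import Data.Integer.Base as ℤ using (ℤ; +_; -[1+_]; _⊖_; 0ℤ; -<+; +<+)
import Data.Integer.Properties as ℤ
open import Data.Integer.Tactic.RingSolver using () renaming (solve-∀ to solve-∀ᶻ)
open import Data.List.Base using (List; []; _∷_; _++_; length; map; lookup; applyUpTo; allFin; cartesianProductWith)
import Data.List.Base as List
import Data.List.Membership.Propositional.Properties as Membership≡
import Data.List.Membership.Setoid as Membership
import Data.List.Membership.Setoid.Properties as Membershipₚ
import Data.List.Properties as List
open import Data.List.Relation.Unary.All as All using (All; []; _∷_)
import Data.List.Relation.Unary.All.Properties as All
open import Data.List.Relation.Unary.Any as Any using (Any; here; there)
import Data.List.Relation.Unary.Any.Properties as Any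
open import Data.Maybe.Base using (Maybe; just; nothing)
open import Data.Nat.Base as ℕ using (ℕ; zero; suc; _≤_; _<_; _^_; _∸_; _/_; _%_; _≤ᵇ_; z≤n; s≤s; _!; NonZero)
open import Data.Nat.Combinatorics using (_C_; nCk+nC[k+1]≡[n+1]C[k+1]; nC1≡n; nCn≡1; k>n⇒nCk≡0)
open import Data.Nat.DivMod using (m≡m%n+[m/n]*n; m%n<n; m<n*o⇒m/o<n)
open import Data.Nat.Divisibility as ∣ using (_∣_; divides; m≤n⇒m!∣n!)
open import Data.Nat.GeneralisedArithmetic using (fold)
open import Data.Nat.Induction using (<-wellFounded; Acc; acc)
open import Data.Nat.Primality using (Prime; prime⇒nonZero; prime⇒nonTrivial; euclidsLemma)
import Data.Nat.Properties as ℕ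
open import Data.Nat.Tactic.RingSolver using (solve-∀)
open import Data.Product.Base using (Σ-syntax; ∃-syntax; _×_; _,_; proj₁; proj₂)
open import Data.Sum.Base using (_⊎_; inj₁; inj₂; [_,_]′)
open import Function.Base using (_∘_; id)
open import Function.Bundles using (Inverse; Equivalence; _⇔_; mk⇔)
open import Level using (Level; _⊔_)
open import Relation.Binary.Bundles using (Setoid)
open import Relation.Binary.PropositionalEquality.Core as ≡ using (_≡_)
import Relation.Binary.PropositionalEquality.Properties as ≡
import Relation.Binary.Reasoning.Setoid as ≈-Reasoning
open import Relation.Nullary.Decidable.Core using (Dec; yes; no)
open import Relation.Nullary.Negation.Core using (¬_; contradiction)

-- Zero can be recognised among polynomials, which suffices for the exchange argument; division by
-- other series is cancellation of a regular element inside a finite-dimensional span that it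
-- preserves. Algebraic elements are handled through finite-dimensional algebras, given by
-- generators, and not through minimal polynomials. One development serves three coefficient rings:
-- 𝔽_q[X] inside power series, 𝔽_q[1/z] and 𝔽_q[w] inside Laurent series; the last occurs because
-- the digit series are evaluated at w.
--
-- Moments are forced by the recursion: T^n(x) is β^n x corrected by all earlier digits, so its
-- integer part is not read off from β^n y for a fixed y. Moments turn the corrections into a
-- convolution of the digit series with a known matrix. Once the digit series are known to be
-- algebraic over 𝔽_q(t), a second passage from algebraic to automatic, with z in the role of β,
-- returns to the digits.

module RingSolver {a ℓ} (R : CommutativeRing a ℓ) where
  open CommutativeRing R
  open RingProperties ring using (-‿distribˡ-*)
  open AbelianGroupProperties +-abelianGroup using (⁻¹-∙-comm; ⁻¹-involutive; ε⁻¹≈ε)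
  open Mult semiring using (×-homo-+; ×1-homo-*; 1+×) renaming (_×_ to _·_)
  open ≈-Reasoning setoid

  private
    -- With the optimised multiples, `con (+ 0)` and `con (+ 1)` evaluate to `0#` and `1#`
    -- themselves.
    ⟦_⟧ᶻ : ℤ → Carrier
    ⟦ + n ⟧ᶻ      = n · 1#
    ⟦ -[1+ n ] ⟧ᶻ = - (suc n · 1#)

    ⊖-homo : ∀ m n → ⟦ m ⊖ n ⟧ᶻ ≈ m · 1# - n · 1#
    ⊖-homo zero    zero    = sym (-‿inverseʳ 0#)
    ⊖-homo (suc m) zero    = sym (trans (+-congˡ ε⁻¹≈ε) (+-identityʳ _))
    ⊖-homo zero    (suc n) = sym (+-identityˡ _)
    ⊖-homo (suc m) (suc n) = begin
      ⟦ suc m ⊖ suc n ⟧ᶻ                 ≡⟨ ≡.cong ⟦_⟧ᶻ (ℤ.[1+m]⊖[1+n]≡m⊖n m n) ⟩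
      ⟦ m ⊖ n ⟧ᶻ ≈⟨ ⊖-homo m n ⟩
      x - y ≈⟨ +-congˡ (+-identityˡ (- y)) ⟨
      x + (0# - y) ≈⟨ +-congˡ (+-congʳ (-‿inverseʳ 1#)) ⟨
      x + ((1# - 1#) - y) ≈⟨ +-congˡ (+-assoc 1# (- 1#) (- y)) ⟩
      x + (1# + (- 1# - y)) ≈⟨ +-assoc x 1# _ ⟨
      (x + 1#) + (- 1# - y) ≈⟨ +-cong (+-comm x 1#) (⁻¹-∙-comm 1# y) ⟩
      (1# + x) - (1# + y) ≈⟨ +-cong (1+× m 1#) (-‿cong (1+× n 1#)) ⟨
      suc m · 1# - suc n · 1#            ∎
      where x = m · 1# ; y = n · 1#

    neg-homo : ∀ i → ⟦ ℤ.- i ⟧ᶻ ≈ - ⟦ i ⟧ᶻ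
    neg-homo (+ zero)  = sym ε⁻¹≈ε
    neg-homo (+ suc n) = refl
    neg-homo -[1+ n ]  = sym (⁻¹-involutive _)

    +-homo : ∀ i j → ⟦ i ℤ.+ j ⟧ᶻ ≈ ⟦ i ⟧ᶻ + ⟦ j ⟧ᶻ
    +-homo (+ m)    (+ n)    = ×-homo-+ 1# m n
    +-homo (+ m)    -[1+ n ] = ⊖-homo m (suc n)
    +-homo -[1+ m ] (+ n)    = trans (⊖-homo n (suc m)) (+-comm _ _)
    +-homo -[1+ m ] -[1+ n ] = begin
      - (suc (suc (m ℕ.+ n)) · 1#)         ≡⟨ ≡.cong (λ k → - (k · 1#)) (ℕ.+-suc (suc m) n) ⟨
      - ((suc m ℕ.+ suc n) · 1#) ≈⟨ -‿cong (×-homo-+ 1# (suc m) (suc n)) ⟩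
      - (suc m · 1# + suc n · 1#) ≈⟨ ⁻¹-∙-comm _ _ ⟨
      - (suc m · 1#) - (suc n · 1#)        ∎

    +*-homo : ∀ m j → ⟦ + m ℤ.* j ⟧ᶻ ≈ ⟦ + m ⟧ᶻ * ⟦ j ⟧ᶻ
    +*-homo m (+ n) = begin
      ⟦ + m ℤ.* + n ⟧ᶻ    ≡⟨ ≡.cong ⟦_⟧ᶻ (ℤ.pos-* m n) ⟨
      (m ℕ.* n) · 1# ≈⟨ ×1-homo-* m n ⟩
      m · 1# * (n · 1#)   ∎
    +*-homo m -[1+ n ] = begin
      ⟦ + m ℤ.* -[1+ n ] ⟧ᶻ        ≡⟨ ≡.cong ⟦_⟧ᶻ (ℤ.neg-distribʳ-* (+ m) (+ suc n)) ⟨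
      ⟦ ℤ.- (+ m ℤ.* + suc n) ⟧ᶻ ≈⟨ neg-homo (+ m ℤ.* + suc n) ⟩
      - ⟦ + m ℤ.* + suc n ⟧ᶻ ≈⟨ -‿cong (+*-homo m (+ suc n)) ⟩
      - (m · 1# * (suc n · 1#)) ≈⟨ RingProperties.-‿distribʳ-* ring _ _ ⟩
      m · 1# * - (suc n · 1#)      ∎

    *-homo : ∀ i j → ⟦ i ℤ.* j ⟧ᶻ ≈ ⟦ i ⟧ᶻ * ⟦ j ⟧ᶻ
    *-homo (+ m)    j = +*-homo m j
    *-homo -[1+ m ] j = begin
      ⟦ -[1+ m ] ℤ.* j ⟧ᶻ          ≡⟨ ≡.cong ⟦_⟧ᶻ (ℤ.neg-distribˡ-* (+ suc m) j) ⟨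
      ⟦ ℤ.- (+ suc m ℤ.* j) ⟧ᶻ ≈⟨ neg-homo (+ suc m ℤ.* j) ⟩
      - ⟦ + suc m ℤ.* j ⟧ᶻ ≈⟨ -‿cong (+*-homo (suc m) j) ⟩
      - (suc m · 1# * ⟦ j ⟧ᶻ) ≈⟨ -‿distribˡ-* _ _ ⟩
      - (suc m · 1#) * ⟦ j ⟧ᶻ      ∎

    homomorphism : CommutativeRing.rawRing ℤ.+-*-commutativeRing
                   -Raw-AlmostCommutative⟶ fromCommutativeRing R
    homomorphism = record
      { ⟦_⟧    = ⟦_⟧ᶻ
      ; +-homo = +-homo
      ; *-homo = *-homo
      ; -‿homo = neg-homo
      ; 0-homo = refl
      ; 1-homo = refl
      }

    -- Comparing integers is enough: the ring itself need not have decidable equality.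
    coefficient≟ : ∀ i j → Maybe (⟦ i ⟧ᶻ ≈ ⟦ j ⟧ᶻ)
    coefficient≟ i j with i ℤ.≟ j
    ... | yes ≡.refl = just refl
    ... | no  _      = nothing

  open Solver _ _ homomorphism coefficient≟ public
    using (solve; _:=_; _:+_; _:*_; _:-_; :-_; con)

module FiniteSum {a ℓ} (R : CommutativeRing a ℓ) where
  open CommutativeRing R hiding (zero)
  open RingSolver R

  sumTo : ℕ → (ℕ → Carrier) → Carrier
  sumTo zero    f = 0#
  sumTo (suc n) f = sumTo n f + f n

  sumTo-cong : ∀ n {f g : ℕ → Carrier} → (∀ i → i < n → f i ≈ g i) → sumTo n f ≈ sumTo n g
  sumTo-cong zero    e = refl
  sumTo-cong (suc n) e = +-cong (sumTo-cong n (λ i i<n → e i (ℕ.m≤n⇒m≤1+n i<n))) (e n ℕ.≤-refl)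

  sumTo-+ : ∀ n (f g : ℕ → Carrier) → sumTo n (λ i → f i + g i) ≈ sumTo n f + sumTo n g
  sumTo-+ zero    f g = sym (+-identityˡ 0#)
  sumTo-+ (suc n) f g = trans (+-congʳ (sumTo-+ n f g))
    (solve 4 (λ a b x y → (a :+ b) :+ (x :+ y) := (a :+ x) :+ (b :+ y)) refl (sumTo n f) (sumTo n g) (f n) (g n))

  sumTo-* : ∀ n a (f : ℕ → Carrier) → sumTo n (λ i → a * f i) ≈ a * sumTo n f
  sumTo-* zero    a f = sym (zeroʳ a)
  sumTo-* (suc n) a f = trans (+-congʳ (sumTo-* n a f)) (sym (distribˡ a _ _))

-- Non-zero-divisors and coefficient rings

Regular : ∀ {a ℓ} (K : CommutativeRing a ℓ) → CommutativeRing.Carrier K → Set (a ⊔ ℓ)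
Regular K x = ∀ y → x * y ≈ 0# → y ≈ 0#
  where
  open CommutativeRing K

module RegularProperties {a ℓ} (K : CommutativeRing a ℓ) where
  open CommutativeRing K
  open RingSolver K
  open ≈-Reasoning setoid

  regular-resp : ∀ {x y} → x ≈ y → Regular K x → Regular K y
  regular-resp x≈y r z yz≈0 = r z (trans (*-congʳ x≈y) yz≈0)

  regular-1 : Regular K 1#
  regular-1 z 1z≈0 = trans (sym (*-identityˡ z)) 1z≈0

  regular-* : ∀ {x y} → Regular K x → Regular K y → Regular K (x * y)
  regular-* r s z xyz≈0 = s z (r _ (trans (sym (*-assoc _ _ z)) xyz≈0))

  regular-factor : ∀ {x y} → Regular K (x * y) → Regular K x
  regular-factor {x} {y} r z xz≈0 = r z (begin
    (x * y) * z ≈⟨ solve 3 (λ x y z → (x :* y) :* z := y :* (x :* z)) refl x y z ⟩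
    y * (x * z) ≈⟨ *-congˡ xz≈0 ⟩
    y * 0# ≈⟨ zeroʳ y ⟩
    0#           ∎)

  regular-unit : ∀ {x y} → x * y ≈ 1# → Regular K x
  regular-unit xy≈1 = regular-factor (regular-resp (sym xy≈1) regular-1)

  regular-cancel : ∀ {r x y} → Regular K r → r * x ≈ r * y → x ≈ y
  regular-cancel {r} {x} {y} reg rx≈ry = begin
    x ≈⟨ solve 2 (λ x y → x := y :+ (x :- y)) refl x y ⟩
    y + (x - y)  ≈⟨ +-congˡ (reg (x - y) (begin
      r * (x - y) ≈⟨ solve 3 (λ r x y → r :* (x :- y) := r :* x :- r :* y) refl r x y ⟩
      r * x - r * y ≈⟨ +-congʳ rx≈ry ⟩
      r * y - r * y ≈⟨ -‿inverseʳ _ ⟩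
      0#             ∎)) ⟩
    y + 0# ≈⟨ +-identityʳ y ⟩
    y            ∎

-- `zero?` is the only test of a ring element for zero on which the linear algebra relies.
-- Polynomials admit it and arbitrary series do not, which is why coefficients are confined to a
-- subring.
record IsCoefficientRing {a ℓ r} (K : CommutativeRing a ℓ)
                         (𝓡 : CommutativeRing.Carrier K → Set r) : Set (a ⊔ ℓ ⊔ r) where
  open CommutativeRing K
  field
    𝓡-resp         : ∀ {x y} → x ≈ y → 𝓡 x → 𝓡 y
    𝓡-0            : 𝓡 0#
    𝓡-1            : 𝓡 1#
    𝓡-+            : ∀ {x y} → 𝓡 x → 𝓡 y → 𝓡 (x + y)
    𝓡-*            : ∀ {x y} → 𝓡 x → 𝓡 y → 𝓡 (x * y)
    𝓡-neg          : ∀ {x} → 𝓡 x → 𝓡 (- x)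
    zero?          : ∀ {x} → 𝓡 x → x ≈ 0# ⊎ Regular K x

module Products {a ℓ} (K : CommutativeRing a ℓ) where
  open CommutativeRing K
  open Membership setoid using (_∈_)
  open Exp commutativeSemiring using () renaming (_^_ to _^′_)

  infixl 7 _⊗_
  _⊗_ : List Carrier → List Carrier → List Carrier
  _⊗_ = cartesianProductWith _*_

  -- Listed from the top to suit `Dependent`: an entry that depends on the later ones is then a
  -- power that depends on lower powers.
  powers : Carrier → ℕ → List Carrier
  powers y zero    = 1# ∷ []
  powers y (suc n) = y ^′ suc n ∷ powers y n

  ^∈powers : ∀ y {i n} → i ≤ n → y ^′ i ∈ powers y n
  ^∈powers y {zero}  {zero}  z≤n = here refl
  ^∈powers y {i}     {suc n} i≤ with ℕ.m≤n⇒m<n∨m≡n i≤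
  ... | inj₁ (s≤s i≤n) = there (^∈powers y i≤n)
  ... | inj₂ ≡.refl    = here refl

  ∈powers⇒^ : ∀ y {n x} → x ∈ powers y n → ∃[ i ] i ≤ n × x ≈ y ^′ i
  ∈powers⇒^ y {zero}  (here e)  = 0 , z≤n , e
  ∈powers⇒^ y {suc n} (here e)  = suc n , ℕ.≤-refl , e
  ∈powers⇒^ y {suc n} (there p) with ∈powers⇒^ y p
  ... | i , i≤n , e = i , ℕ.m≤n⇒m≤1+n i≤n , e

  powers-length : ∀ y n → length (powers y n) ≡ suc n
  powers-length y zero    = ≡.refl
  powers-length y (suc n) = ≡.cong suc (powers-length y n)

-- Linear algebra over the fractions of a coefficient ring

module LinearAlgebra {a ℓ r} (K : CommutativeRing a ℓ) (𝓡 : CommutativeRing.Carrier K → Set r) (coefficients : IsCoefficientRing K 𝓡) where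
  open CommutativeRing K
  open IsCoefficientRing coefficients
  open Products K public
  open Membership setoid using (_∈_)
  open RegularProperties K
  open RingSolver K
  open Exp commutativeSemiring using () renaming (_^_ to _^′_)
  open ≈-Reasoning setoid

  nonzero⇒regular : ∀ {x} → 𝓡 x → ¬ (x ≈ 0#) → Regular K x
  nonzero⇒regular 𝓡x x≉0 = [ (λ x≈0 → contradiction x≈0 x≉0) , (λ reg → reg) ]′ (zero? 𝓡x)

  record IsSubspace {s} (N : Carrier → Set s) : Set (a ⊔ ℓ ⊔ r ⊔ s) where
    field
      resp     : ∀ {x y} → x ≈ y → N x → N y
      null     : N 0#
      add      : ∀ {x y} → N x → N y → N (x + y)
      scale    : ∀ {c x} → 𝓡 c → N x → N (c * x)
      saturate : ∀ {g x} → 𝓡 g → Regular K g → N (g * x) → N x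

    negate : ∀ {x} → N x → N (- x)
    negate {x} n = resp (solve 1 (λ x → (:- con (+ 1)) :* x := :- x) refl x)
                        (scale (𝓡-neg 𝓡-1) n)

    subtract : ∀ {x y} → N x → N y → N (x - y)
    subtract m n = add m (negate n)

  -- The subspace generated by vs over the field of fractions of 𝓡; since the
  -- inverses of elements of 𝓡 need not lie in K, it is the saturation of the 𝓡-span.
  data Span (vs : List Carrier) : Carrier → Set (a ⊔ ℓ ⊔ r) where
    generator : ∀ {v} → v ∈ vs → Span vs v
    resp      : ∀ {x y} → x ≈ y → Span vs x → Span vs y
    null      : Span vs 0#
    add       : ∀ {x y} → Span vs x → Span vs y → Span vs (x + y)
    scale     : ∀ {c x} → 𝓡 c → Span vs x → Span vs (c * x)
    saturate  : ∀ {g x} → 𝓡 g → Regular K g → Span vs (g * x) → Span vs x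

  span-isSubspace : ∀ vs → IsSubspace (Span vs)
  span-isSubspace vs = record
    { resp = resp ; null = null ; add = add ; scale = scale ; saturate = saturate }

  module _ {vs : List Carrier} where
    open IsSubspace (span-isSubspace vs) public using () renaming (negate to span-negate; subtract to span-subtract)

  span-elim : ∀ {s} {N : Carrier → Set s} {vs} → IsSubspace N →
              (∀ {v} → v ∈ vs → N v) → ∀ {x} → Span vs x → N x
  span-elim sub gens = go
    where
    module N = IsSubspace sub
    go : ∀ {x} → Span _ x → _
    go (generator v∈)   = gens v∈
    go (resp e s)       = N.resp e (go s)
    go null             = N.null
    go (add s t)        = N.add (go s) (go t)
    go (scale c s)      = N.scale c (go s)
    go (saturate g r s) = N.saturate g r (go s)

  span-⊆ : ∀ {vs ws} → (∀ {v} → v ∈ vs → v ∈ ws) → ∀ {x} → Span vs x → Span ws x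
  span-⊆ f = span-elim (span-isSubspace _) (λ v∈ → generator (f v∈))

  -- The coefficient of `v` is the fraction c / g, which need not exist in `K`; hence the
  -- denominator on the left.
  record Split (v : Carrier) (vs : List Carrier) (x : Carrier) : Set (a ⊔ ℓ ⊔ r) where
    constructor split
    field
      {g c u} : Carrier
      𝓡g      : 𝓡 g
      regular : Regular K g
      𝓡c      : 𝓡 c
      rest    : Span vs u
      eq      : g * x ≈ c * v + u

  split-isSubspace : ∀ v vs → IsSubspace (Split v vs)
  split-isSubspace v vs = record
    { resp = λ { e (split g r c u eq) → split g r c u (trans (*-congˡ (sym e)) eq) }
    ; null = split 𝓡-1 regular-1 𝓡-0 null
        (solve 1 (λ v → con (+ 1) :* con (+ 0) := con (+ 0) :* v :+ con (+ 0)) refl v)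
    ; add = λ { {x} {y} (split {g} {c} {u} 𝓡g r 𝓡c s eq) (split {g'} {c'} {u'} 𝓡g' r' 𝓡c' s' eq') →
        split (𝓡-* 𝓡g 𝓡g') (regular-* r r') (𝓡-+ (𝓡-* 𝓡g' 𝓡c) (𝓡-* 𝓡g 𝓡c'))
              (add (scale 𝓡g' s) (scale 𝓡g s')) (begin
          g * g' * (x + y) ≈⟨ solve 4 (λ g g' x y → g :* g' :* (x :+ y) := g' :* (g :* x) :+ g :* (g' :* y)) refl g g' x y ⟩
          g' * (g * x) + g * (g' * y) ≈⟨ +-cong (*-congˡ eq) (*-congˡ eq') ⟩
          g' * (c * v + u) + g * (c' * v + u') ≈⟨ solve 7 (λ g g' c c' u u' v → g' :* (c :* v :+ u) :+ g :* (c' :* v :+ u') := (g' :* c :+ g :* c') :* v :+ (g' :* u :+ g :* u')) refl g g' c c' u u' v ⟩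
          (g' * c + g * c') * v + (g' * u + g * u') ∎) }
    ; scale = λ { {d} {x} 𝓡d (split {g} {c} {u} 𝓡g r 𝓡c s eq) →
        split 𝓡g r (𝓡-* 𝓡d 𝓡c) (scale 𝓡d s) (begin
          g * (d * x) ≈⟨ solve 3 (λ g d x → g :* (d :* x) := d :* (g :* x)) refl g d x ⟩
          d * (g * x) ≈⟨ *-congˡ eq ⟩
          d * (c * v + u) ≈⟨ solve 4 (λ d c v u → d :* (c :* v :+ u) := d :* c :* v :+ d :* u) refl d c v u ⟩
          d * c * v + d * u  ∎) }
    ; saturate = λ { {h} {x} 𝓡h s (split {g} 𝓡g r 𝓡c u eq) →
        split (𝓡-* 𝓡g 𝓡h) (regular-* r s) 𝓡c u (trans (*-assoc g h x) eq) }
    }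

  span-split : ∀ {v vs x} → Span (v ∷ vs) x → Split v vs x
  span-split {v} {vs} = span-elim (split-isSubspace v vs) λ
    { {x} (here x≈v) → split 𝓡-1 regular-1 𝓡-1 null
        (trans (*-congˡ x≈v) (sym (+-identityʳ _)))
    ; {x} (there x∈) → split 𝓡-1 regular-1 𝓡-0 (generator x∈)
        (solve 2 (λ x v → con (+ 1) :* x := con (+ 0) :* v :+ x) refl x v)
    }

  span-[] : ∀ {x} → Span [] x → x ≈ 0#
  span-[] = span-elim {N = _≈ 0#} (record
    { resp     = λ x≈y x≈0 → trans (sym x≈y) x≈0
    ; null     = refl
    ; add      = λ x≈0 y≈0 → trans (+-cong x≈0 y≈0) (+-identityˡ 0#)
    ; scale    = λ _ x≈0 → trans (*-congˡ x≈0) (zeroʳ _)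
    ; saturate = λ _ reg → reg _
    }) λ ()

  private
    shift : ∀ {x} v ws vs → x ∈ ws ++ v ∷ vs → x ∈ v ∷ ws ++ vs
    shift v ws vs x∈ with Any.++⁻ ws x∈
    ... | inj₁ p         = there (Any.++⁺ˡ p)
    ... | inj₂ (here e)  = here e
    ... | inj₂ (there p) = there (Any.++⁺ʳ ws p)

    unshift : ∀ {x} v ws vs → x ∈ v ∷ ws ++ vs → x ∈ ws ++ v ∷ vs
    unshift v ws vs (here e)   = Any.++⁺ʳ ws (here e)
    unshift v ws vs (there x∈) with Any.++⁻ ws x∈
    ... | inj₁ p = Any.++⁺ˡ p
    ... | inj₂ p = Any.++⁺ʳ ws (there p)

    swap : ∀ {x y z zs} → x ∈ y ∷ z ∷ zs → x ∈ z ∷ y ∷ zs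
    swap (here e)          = there (here e)
    swap (there (here e))  = here e
    swap (there (there p)) = there (there p)

  -- The Steinitz exchange step. Entries of `vs` are moved over to `ws` one at a time. Once `y`
  -- depends on `v ∷ ws`, the coefficient of `v` is either zero, and `y` depends on `ws` alone, or
  -- regular, and `v` can be recovered from `y`.
  exchange : ∀ ws vs {y} → Span (ws ++ vs) y →
    Span ws y ⊎
    (∃[ vs' ] length vs ≡ suc (length vs') × (∀ {x} → Span (ws ++ vs) x → Span (y ∷ ws ++ vs') x))
  exchange ws [] y∈ = inj₁ (span-⊆ unit y∈)
    where
    unit : ∀ {x} → x ∈ ws ++ [] → x ∈ ws
    unit p with Any.++⁻ ws p
    ... | inj₁ q = q
  exchange ws (v ∷ vs) {y} y∈ with exchange (v ∷ ws) vs (span-⊆ (shift v ws vs) y∈)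
  ... | inj₂ (vs' , len , sub) =
    inj₂ (v ∷ vs' , ≡.cong suc len , λ x∈ →
      span-⊆ (λ p → unshift v (y ∷ ws) vs' (swap p)) (sub (span-⊆ (shift v ws vs) x∈)))
  ... | inj₁ y∈ws with span-split y∈ws
  ... | split {g} {c} {u} 𝓡g reg 𝓡c rest eq with zero? 𝓡c
  ... | inj₁ c≈0 = inj₁ (saturate 𝓡g reg (resp (sym (begin
          g * y ≈⟨ eq ⟩
          c * v + u ≈⟨ +-congʳ (*-congʳ c≈0) ⟩
          0# * v + u ≈⟨ solve 2 (λ v u → con (+ 0) :* v :+ u := u) refl v u ⟩
          u           ∎)) rest))
  ... | inj₂ c-reg = inj₂ (vs , ≡.refl , span-elim (span-isSubspace _) λ x∈ → gens (shift v ws vs x∈))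
    where
    v∈ : Span (y ∷ ws ++ vs) v
    v∈ = saturate 𝓡c c-reg (resp (begin
      g * y - u ≈⟨ +-congʳ eq ⟩
      (c * v + u) - u ≈⟨ solve 2 (λ x u → (x :+ u) :- u := x) refl (c * v) u ⟩
      c * v            ∎)
      (span-subtract (scale 𝓡g (generator (here refl)))
                     (span-⊆ (λ p → there (Any.++⁺ˡ p)) rest)))
    gens : ∀ {x} → x ∈ v ∷ ws ++ vs → Span (y ∷ ws ++ vs) x
    gens (here e)  = resp (sym e) v∈
    gens (there p) = generator (there p)

  data Dependent : List Carrier → Set (a ⊔ ℓ ⊔ r) where
    here  : ∀ {y ys} → Span ys y → Dependent (y ∷ ys)
    there : ∀ {y ys} → Dependent ys → Dependent (y ∷ ys)

  private
    steinitz : ∀ {vs} ys → All (Span vs) ys → Dependent ys ⊎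
      (∃[ vs' ] length vs ≡ length ys ℕ.+ length vs' × (∀ {x} → Span vs x → Span (ys ++ vs') x))
    steinitz {vs} []       []        = inj₂ (vs , ≡.refl , λ x∈ → x∈)
    steinitz {vs} (y ∷ ys) (p ∷ ps) with steinitz ys ps
    ... | inj₁ d                = inj₁ (there d)
    ... | inj₂ (vs' , len , sub) with exchange ys vs' (sub p)
    ... | inj₁ y∈                  = inj₁ (here y∈)
    ... | inj₂ (vs″ , len' , sub') = inj₂ (vs″ , ≡.trans len (≡.trans (≡.cong (length ys ℕ.+_) len') (ℕ.+-suc (length ys) (length vs″))) , λ x∈ → sub' (sub x∈))

  -- `steinitz` either meets a dependency or exchanges all of `ys` into the generators, and in the
  -- latter case `ys` cannot be longer than `vs`.
  dependent : ∀ {vs ys} → All (Span vs) ys → length vs < length ys → Dependent ys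
  dependent {vs} {ys} all lt with steinitz ys all
  ... | inj₁ d             = d
  ... | inj₂ (vs' , e , _) = contradiction (ℕ.m≤m+n (length ys) (length vs')) (ℕ.<⇒≱ (≡.subst (_< length ys) e lt))

  private
    -- This is r · Span A up to denominators. A dependency between multiples of r thus remains a
    -- multiple of r, and r can be cancelled.
    multiples-isSubspace : ∀ A r → IsSubspace (λ x → ∃[ g ] ∃[ v ] 𝓡 g × Regular K g × Span A v × g * x ≈ r * v)
    multiples-isSubspace A r = record
      { resp = λ { e (g , v , 𝓡g , reg , v∈ , eq) → g , v , 𝓡g , reg , v∈ , trans (*-congˡ (sym e)) eq }
      ; null = 1# , 0# , 𝓡-1 , regular-1 , null , trans (zeroʳ _) (sym (zeroʳ _))
      ; add = λ { {x} {y} (g , v , 𝓡g , reg , v∈ , eq) (g' , v' , 𝓡g' , reg' , v∈' , eq') →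
          g * g' , g' * v + g * v' , 𝓡-* 𝓡g 𝓡g' , regular-* reg reg' , add (scale 𝓡g' v∈) (scale 𝓡g v∈') , (begin
            g * g' * (x + y) ≈⟨ solve 4 (λ g g' x y → g :* g' :* (x :+ y) := g' :* (g :* x) :+ g :* (g' :* y)) refl g g' x y ⟩
            g' * (g * x) + g * (g' * y) ≈⟨ +-cong (*-congˡ eq) (*-congˡ eq') ⟩
            g' * (r * v) + g * (r * v') ≈⟨ solve 5 (λ g g' r v v' → g' :* (r :* v) :+ g :* (r :* v') := r :* (g' :* v :+ g :* v')) refl g g' r v v' ⟩
            r * (g' * v + g * v')        ∎) }
      ; scale = λ { {d} {x} 𝓡d (g , v , 𝓡g , reg , v∈ , eq) →
          g , d * v , 𝓡g , reg , scale 𝓡d v∈ , (begin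
            g * (d * x) ≈⟨ solve 3 (λ g d x → g :* (d :* x) := d :* (g :* x)) refl g d x ⟩
            d * (g * x) ≈⟨ *-congˡ eq ⟩
            d * (r * v) ≈⟨ solve 3 (λ g d x → g :* (d :* x) := d :* (g :* x)) refl d r v ⟩
            r * (d * v)  ∎) }
      ; saturate = λ { {h} {x} 𝓡h s (g , v , 𝓡g , reg , v∈ , eq) →
          g * h , v , 𝓡-* 𝓡g 𝓡h , regular-* reg s , v∈ , trans (*-assoc g h x) eq }
      }

  module _ {A : List Carrier} {c f : Carrier} (stable : ∀ {x} → Span A x → Span A (c * x)) (regular : Regular K c) where
    private
      orbit : ℕ → Carrier → List Carrier
      orbit zero    e = []
      orbit (suc n) e = e ∷ orbit n (c * e)

      orbit-length : ∀ n e → length (orbit n e) ≡ n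
      orbit-length zero    e = ≡.refl
      orbit-length (suc n) e = ≡.cong suc (orbit-length n (c * e))

      orbit-span : ∀ n {e} → Span A e → All (Span A) (orbit n e)
      orbit-span zero    e∈ = []
      orbit-span (suc n) e∈ = e∈ ∷ orbit-span n (stable e∈)

      orbit-multiple : ∀ n {e v s x} → e ≈ s * v → Span A v → x ∈ orbit n e →
                       ∃[ g ] ∃[ v' ] 𝓡 g × Regular K g × Span A v' × g * x ≈ s * v'
      orbit-multiple (suc n) {v = v} e≈ v∈ (here x≈) = 1# , v , 𝓡-1 , regular-1 , v∈ ,
        trans (*-identityˡ _) (trans x≈ e≈)
      orbit-multiple (suc n) {e} {v} {s} e≈ v∈ (there x∈) = orbit-multiple n
        (trans (*-congˡ e≈) (solve 3 (λ c s v → c :* (s :* v) := s :* (c :* v)) refl c s v))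
        (stable v∈) x∈

      -- Here `s` stands for a power of `c`, with e = s f. The entries after `e` are s times
      -- elements of `Span A`, beginning with c e = s (c f), so if `e` depends on them, cancelling
      -- `s` puts `f` into `Span A`.
      orbit-dependent : ∀ n {e s} → e ≈ s * f → Regular K s → Span A (c * f) → Dependent (orbit n e) → Span A f
      orbit-dependent (suc n) {e} {s} e≈ reg cf∈ (there d) = orbit-dependent n
        (trans (*-congˡ e≈) (sym (*-assoc c s f))) (regular-* regular reg) cf∈ d
      orbit-dependent (suc n) {e} {s} e≈ reg cf∈ (here e∈) = conclude (span-elim (multiples-isSubspace A s)
          (orbit-multiple n (trans (*-congˡ e≈) (solve 3 (λ c s v → c :* (s :* v) := s :* (c :* v)) refl c s f)) cf∈) e∈)
        where
        conclude : (∃[ g ] ∃[ v ] 𝓡 g × Regular K g × Span A v × g * e ≈ s * v) → Span A f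
        conclude (g , v , 𝓡g , g-reg , v∈ , eq) = saturate 𝓡g g-reg (resp (regular-cancel reg (begin
          s * v ≈⟨ eq ⟨
          g * e ≈⟨ *-congˡ e≈ ⟩
          g * (s * f) ≈⟨ solve 3 (λ g s f → g :* (s :* f) := s :* (g :* f)) refl g s f ⟩
          s * (g * f)  ∎)) v∈)

    -- Among c f, c² f, … some element lies in the span of the later ones, because
    -- Span A is finite dimensional; then cancel powers of c.
    division : Span A (c * f) → Span A f
    division cf∈ = orbit-dependent (suc (length A)) refl regular cf∈
      (dependent (orbit-span (suc (length A)) cf∈)
                 (ℕ.≤-reflexive (≡.sym (orbit-length (suc (length A)) (c * f)))))

  Algebraic : Carrier → Set (a ⊔ ℓ ⊔ r)
  Algebraic y = ∃[ n ] Span (powers y n) (y ^′ suc n)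

  ⊗-elim : ∀ {s} {N : Carrier → Set s} {A B} → IsSubspace N →
           (∀ {u v} → u ∈ A → v ∈ B → N (u * v)) → ∀ {x} → Span (A ⊗ B) x → N x
  ⊗-elim {A = A} {B} sub gens = span-elim sub λ x∈ →
    let (u , v , u∈ , v∈ , x≈uv) = Membershipₚ.∈-cartesianProductWith⁻ setoid setoid setoid _*_ A B x∈
    in IsSubspace.resp sub (sym x≈uv) (gens u∈ v∈)

  preimage-isSubspace : ∀ {s} {N : Carrier → Set s} → IsSubspace N → ∀ v → IsSubspace (λ u → N (u * v))
  preimage-isSubspace sub v = record
    { resp     = λ e → N.resp (*-congʳ e)
    ; null     = N.resp (sym (zeroˡ v)) N.null
    ; add      = λ m n → N.resp (sym (distribʳ v _ _)) (N.add m n)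
    ; scale    = λ c n → N.resp (sym (*-assoc _ _ v)) (N.scale c n)
    ; saturate = λ g r n → N.saturate g r (N.resp (*-assoc _ _ v) n)
    }
    where module N = IsSubspace sub

  bilinear-elim : ∀ {s} {N : Carrier → Set s} {A B} → IsSubspace N →
                  (∀ {u v} → u ∈ A → v ∈ B → N (u * v)) →
                  ∀ {u v} → Span A u → Span B v → N (u * v)
  bilinear-elim sub gens {u} {v} u∈ v∈ =
    span-elim (preimage-isSubspace sub v) (λ {u'} u'∈ →
      IsSubspace.resp sub (*-comm v u')
        (span-elim (preimage-isSubspace sub u')
           (λ {v'} v'∈ → IsSubspace.resp sub (*-comm u' v') (gens u'∈ v'∈)) v∈)) u∈

  ⊗-span : ∀ {A B u v} → Span A u → Span B v → Span (A ⊗ B) (u * v)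
  ⊗-span = bilinear-elim (span-isSubspace _)
    (λ u∈ v∈ → generator (Membershipₚ.∈-cartesianProductWith⁺ setoid setoid setoid *-cong u∈ v∈))

  -- A finite-dimensional algebra over the fractions of `𝓡`. Sums, products and, by finite
  -- dimension, quotients by regular elements stay inside it, so no minimal polynomial of such a
  -- combination is ever computed.
  record IsRing (A : List Carrier) : Set (a ⊔ ℓ ⊔ r) where
    field
      one : Span A 1#
      mul : ∀ {u v} → Span A u → Span A v → Span A (u * v)

    pow : ∀ {u} n → Span A u → Span A (u ^′ n)
    pow zero    u∈ = one
    pow (suc n) u∈ = mul u∈ (pow n u∈)

    coefficient : ∀ {c} → 𝓡 c → Span A c
    coefficient c = resp (*-identityʳ _) (scale c one)

    divide : ∀ {c f} → Span A c → Regular K c → Span A (c * f) → Span A f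
    divide c∈ = division (mul c∈)

  unitRing : IsRing (1# ∷ [])
  unitRing = record
    { one = generator (here refl)
    ; mul = bilinear-elim (span-isSubspace _) λ
        { (here u≈) (here v≈) → generator (here (trans (*-cong u≈ v≈) (*-identityˡ 1#))) }
    }

  module _ {A : List Carrier} (ring : IsRing A) where
    open IsRing ring

    ring⇒algebraic : ∀ {y} → Span A y → Algebraic y
    ring⇒algebraic {y} y∈ = go (length A) (dependent (powers-span (length A))
        (ℕ.≤-reflexive (≡.sym (powers-length y (length A)))))
      where
      powers-span : ∀ n → All (Span A) (powers y n)
      powers-span zero    = one ∷ []
      powers-span (suc n) = pow (suc n) y∈ ∷ powers-span n
      go : ∀ n → Dependent (powers y n) → Algebraic y
      go (suc n) (here p)  = n , p
      go (suc n) (there d) = go n d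
      -- A dependency in the list `1# ∷ []` says that 1 = 0, so every element vanishes.
      go zero    (here p)  = 0 , resp (begin
        0# ≈⟨ zeroʳ y ⟨
        y * 0# ≈⟨ *-congˡ (span-[] p) ⟨
        y * 1#  ∎) null

    -- The leading coefficient `c` lies in the algebra but need not be invertible in `K`.
    -- Multiplication by it preserves the span E of the products, so `division` strips it from c
    -- y^(n+1); then y acts on E, and so do all its powers.
    adjoin : ∀ {c y n} → Span A c → Regular K c → Span (A ⊗ powers y n) (c * y ^′ suc n) →
             IsRing (A ⊗ powers y n)
    adjoin {c} {y} {n} c∈ c-reg cy∈ = record
      { one = resp (*-identityˡ 1#) (⊗-span one (generator (^∈powers y {0} z≤n)))
      ; mul = λ {u} {v} u∈ v∈ → ⊗-elim (preimage-isSubspace (span-isSubspace _) v)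
          (λ {b} {p} b∈ p∈ → let (i , _ , p≈) = ∈powers⇒^ y p∈ in
            resp (trans (*-congˡ (*-congʳ (sym p≈))) (sym (*-assoc b p v))) (left (generator b∈) (pow-left i v∈))) u∈
      }
      where
      E : List Carrier
      E = A ⊗ powers y n
      left : ∀ {b x} → Span A b → Span E x → Span E (b * x)
      left {b} b∈ = λ x∈ → resp (*-comm _ b) (⊗-elim (preimage-isSubspace (span-isSubspace _) b)
        (λ {u} {v} u∈ v∈ → resp (solve 3 (λ b u v → b :* u :* v := u :* v :* b) refl b u v)
                             (⊗-span (mul b∈ (generator u∈)) (generator v∈))) x∈)
      top : Span E (y ^′ suc n)
      top = division (left c∈) c-reg cy∈
      step : ∀ {x} → Span E x → Span E (y * x)
      step x∈ = resp (*-comm _ y) (⊗-elim (preimage-isSubspace (span-isSubspace _) y) gens x∈)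
        where
        gens : ∀ {b p} → b ∈ A → p ∈ powers y n → Span E (b * p * y)
        gens {b} {p} b∈ p∈ with ∈powers⇒^ y p∈
        ... | i , i≤n , p≈ with ℕ.m≤n⇒m<n∨m≡n i≤n
        ... | inj₁ i<n    = resp (trans (solve 3 (λ b q y → b :* (y :* q) := b :* q :* y) refl b (y ^′ i) y) (*-congʳ (*-congˡ (sym p≈))))
                                 (⊗-span (generator b∈) (generator (^∈powers y i<n)))
        ... | inj₂ ≡.refl = resp (trans (solve 3 (λ b q y → b :* (y :* q) := b :* q :* y) refl b (y ^′ i) y) (*-congʳ (*-congˡ (sym p≈))))
                                 (left (generator b∈) top)
      pow-left : ∀ i {x} → Span E x → Span E (y ^′ i * x)
      pow-left zero    x∈ = resp (sym (*-identityˡ _)) x∈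
      pow-left (suc i) x∈ = resp (sym (*-assoc y (y ^′ i) _)) (step (pow-left i x∈))

    adjoin-⊆ : ∀ {y n x} → Span A x → Span (A ⊗ powers y n) x
    adjoin-⊆ {y} x∈ = resp (*-identityʳ _) (⊗-span x∈ (generator (^∈powers y {0} z≤n)))

  -- With n = 0 the element y itself is not among the generators.
  adjoin-∋ : ∀ {A y n} → IsRing (A ⊗ powers y n) → ∀ {c} → IsRing A → Span A c → Regular K c →
             Span (A ⊗ powers y n) (c * y ^′ suc n) → Span (A ⊗ powers y n) y
  adjoin-∋ {A} {y} {suc n} ring isRing c∈ c-reg cy∈ =
    resp (trans (*-identityˡ _) (*-identityʳ y)) (⊗-span (IsRing.one isRing) (generator (^∈powers y {1} (s≤s z≤n))))
  adjoin-∋ {A} {y} {zero} ring isRing c∈ c-reg cy∈ =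
    resp (*-identityʳ y) (IsRing.divide ring (adjoin-⊆ isRing {y} {0} c∈) c-reg cy∈)

  Extension : List Carrier → Carrier → Set (a ⊔ ℓ ⊔ r)
  Extension A y = ∃[ E ] IsRing E × (∀ {x} → Span A x → Span E x) × Span E y

  extension : ∀ {A c y n} → IsRing A → Span A c → Regular K c → Span (A ⊗ powers y n) (c * y ^′ suc n) → Extension A y
  extension {A} {y = y} {n} ring c∈ c-reg cy∈ =
    let ring' = adjoin ring c∈ c-reg cy∈ in
    A ⊗ powers y n , ring' , adjoin-⊆ ring , adjoin-∋ ring' ring c∈ c-reg cy∈

  algebraic-extension : ∀ {A y} → IsRing A → Algebraic y → Extension A y
  algebraic-extension {A} {y} ring (n , y∈) = extension {A} {1#} {y} {n} ring (IsRing.one ring) regular-1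
    (⊗-span (IsRing.one ring) y∈)

  ring-containing : ∀ ys → All Algebraic ys → ∃[ A ] IsRing A × All (Span A) ys
  ring-containing []       []           = 1# ∷ [] , unitRing , []
  ring-containing (y ∷ ys) (alg ∷ algs) =
    let (A , ring , ys∈)         = ring-containing ys algs
        (E , ring' , sub , y∈)   = algebraic-extension ring alg
    in E , ring' , y∈ ∷ All.map sub ys∈

-- Binomial coefficients at a prime and additivity of the Frobenius map

absorption : ∀ n k → suc k ℕ.* (suc n C suc k) ≡ suc n ℕ.* (n C k)
absorption zero    zero    = ≡.refl
absorption zero    (suc k) = ≡.trans (≡.cong (suc (suc k) ℕ.*_) (k>n⇒nCk≡0 {1} {suc (suc k)} (s≤s (s≤s z≤n))))
                                     (ℕ.*-zeroʳ (suc (suc k)))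
absorption (suc n) zero    = ≡.trans (ℕ.*-identityˡ _) (≡.trans (nC1≡n (suc (suc n))) (≡.sym (ℕ.*-identityʳ _)))
absorption (suc n) (suc k) = begin
  suc (suc k) ℕ.* (suc (suc n) C suc (suc k))                    ≡⟨ ≡.cong (suc (suc k) ℕ.*_) (nCk+nC[k+1]≡[n+1]C[k+1] (suc n) (suc k)) ⟨
  suc (suc k) ℕ.* (x ℕ.+ y)                                      ≡⟨ expand k x y ⟩
  x ℕ.+ suc k ℕ.* x ℕ.+ suc (suc k) ℕ.* y                        ≡⟨ ≡.cong₂ (λ u v → x ℕ.+ u ℕ.+ v) (absorption n k) (absorption n (suc k)) ⟩
  x ℕ.+ suc n ℕ.* (n C k) ℕ.+ suc n ℕ.* (n C suc k)              ≡⟨ collect n x (n C k) (n C suc k) ⟩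
  x ℕ.+ suc n ℕ.* (n C k ℕ.+ n C suc k)                          ≡⟨ ≡.cong (λ u → x ℕ.+ suc n ℕ.* u) (nCk+nC[k+1]≡[n+1]C[k+1] n k) ⟩
  suc (suc n) ℕ.* (suc n C suc k)                                ∎
  where
  open ≡.≡-Reasoning
  x = suc n C suc k
  y = suc n C suc (suc k)
  expand : ∀ k x y → suc (suc k) ℕ.* (x ℕ.+ y) ≡ x ℕ.+ suc k ℕ.* x ℕ.+ suc (suc k) ℕ.* y
  expand = solve-∀
  collect : ∀ n x a b → x ℕ.+ suc n ℕ.* a ℕ.+ suc n ℕ.* b ≡ x ℕ.+ suc n ℕ.* (a ℕ.+ b)
  collect = solve-∀

-- By `absorption` the prime divides k + 1 times the binomial coefficient, and k + 1 is too small to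
-- be divisible by it.
prime∣binomial : ∀ {n k} → Prime (suc n) → k < n → suc n ∣ suc n C suc k
prime∣binomial {n} {k} pr k<n with euclidsLemma (suc k) (suc n C suc k) pr (divides (n C k) (≡.trans (absorption n k) (ℕ.*-comm (suc n) (n C k))))
... | inj₁ d = contradiction (∣.∣⇒≤ d) (ℕ.<⇒≱ (s≤s k<n))
... | inj₂ d = d

HasCharacteristic : ∀ {a ℓ} → CommutativeRing a ℓ → ℕ → Set ℓ
HasCharacteristic K p = p · 1# ≈ 0#
  where
  open CommutativeRing K
  open Mult× semiring renaming (_×_ to _·_)

IsAdditivePower : ∀ {a ℓ} → CommutativeRing a ℓ → ℕ → Set (a ⊔ ℓ)
IsAdditivePower K n = ∀ x y → (x + y) ^′ n ≈ x ^′ n + y ^′ n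
  where
  open CommutativeRing K
  open Exp commutativeSemiring renaming (_^_ to _^′_)

module Frobenius {a ℓ} (K : CommutativeRing a ℓ) {p} (pr : Prime p) (char : HasCharacteristic K p) where
  open CommutativeRing K hiding (zero)
  open Exp commutativeSemiring using (^-congˡ; ^-assocʳ) renaming (_^_ to _^′_)
  open Mult× semiring using (×-assoc-*; ×-congʳ; ×-assocˡ; ×-homo-1; ×-congˡ) renaming (_×_ to _·_)
  open Binomial commutativeSemiring using (theorem; binomialTerm)
  open Sum +-commutativeMonoid using (sum; sum-init-last; sum-cong-≋; sum-replicate-zero)
  open ≈-Reasoning setoid

  private
    char-∣ : ∀ {n} x → p ∣ n → n · x ≈ 0#
    char-∣ x (divides m ≡.refl) = begin
      (m ℕ.* p) · x ≈⟨ ×-assocˡ x m p ⟨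
      m · (p · x) ≈⟨ ×-congʳ m (×-congʳ p (*-identityˡ x)) ⟨
      m · (p · (1# * x)) ≈⟨ ×-congʳ m (×-assoc-* p 1# x) ⟨
      m · ((p · 1#) * x) ≈⟨ ×-congʳ m (*-congʳ char) ⟩
      m · (0# * x) ≈⟨ ×-congʳ m (zeroˡ x) ⟩
      m · 0# ≈⟨ ×-zero m ⟩
      0#                   ∎
      where
      ×-zero : ∀ m → m · 0# ≈ 0#
      ×-zero zero    = refl
      ×-zero (suc m) = trans (+-identityˡ _) (×-zero m)

    expansion-p : ∀ {n} → p ≡ suc n → ∀ x y → (x + y) ^′ suc n ≈ x ^′ suc n + y ^′ suc n
    expansion-p {n} ≡.refl x y = begin
      (x + y) ^′ suc n ≈⟨ theorem (suc n) x y ⟩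
      t Fin.zero + sum (t ∘ Fin.suc) ≈⟨ +-congˡ (sum-init-last (t ∘ Fin.suc)) ⟩
      t Fin.zero + (sum (λ i → t (Fin.suc (inject₁ i))) + t (Fin.suc (fromℕ n)))
        ≈⟨ +-cong first (+-cong middle last) ⟩
      y ^′ suc n + (0# + x ^′ suc n) ≈⟨ +-congˡ (+-identityˡ _) ⟩
      y ^′ suc n + x ^′ suc n ≈⟨ +-comm _ _ ⟩
      x ^′ suc n + y ^′ suc n                    ∎
      where
      t = binomialTerm x y (suc n)
      first : t Fin.zero ≈ y ^′ suc n
      first = trans (×-homo-1 _) (*-identityˡ _)
      middle : sum (λ i → t (Fin.suc (inject₁ i))) ≈ 0#
      middle = trans (sum-cong-≋ {n} (λ i → char-∣ _ (≡.subst (λ j → suc n ∣ suc n C suc j) (≡.sym (Fin.toℕ-inject₁ i))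
                 (prime∣binomial pr (Fin.toℕ<n i))))) (sum-replicate-zero n)
      last : t (Fin.suc (fromℕ n)) ≈ x ^′ suc n
      last = begin
        t (Fin.suc (fromℕ n))                       ≡⟨ ≡.cong (λ j → (suc n C suc j) · ((x ^′ suc j) * (y ^′ (n ∸ j)))) (Fin.toℕ-fromℕ n) ⟩
        (suc n C suc n) · ((x ^′ suc n) * (y ^′ (n ∸ n))) ≈⟨ ×-congˡ (nCn≡1 (suc n)) ⟩
        1 · ((x ^′ suc n) * (y ^′ (n ∸ n))) ≈⟨ ×-homo-1 _ ⟩
        (x ^′ suc n) * (y ^′ (n ∸ n))                 ≡⟨ ≡.cong (λ j → (x ^′ suc n) * (y ^′ j)) (ℕ.n∸n≡0 n) ⟩
        (x ^′ suc n) * 1# ≈⟨ *-identityʳ _ ⟩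
        x ^′ suc n                                    ∎

    frobenius-p : ∀ x y → (x + y) ^′ p ≈ x ^′ p + y ^′ p
    frobenius-p x y = ≡.subst (λ n → (x + y) ^′ n ≈ x ^′ n + y ^′ n) (≡.sym p≡) (expansion-p p≡ x y)
      where
      p≡ : p ≡ suc (ℕ.pred p)
      p≡ = ≡.sym (ℕ.suc-pred p {{prime⇒nonZero pr}})

  frobenius-+ : ∀ m → IsAdditivePower K (p ^ m)
  frobenius-+ zero    x y = trans (*-identityʳ _) (sym (+-cong (*-identityʳ x) (*-identityʳ y)))
  frobenius-+ (suc m) x y = begin
    (x + y) ^′ (p ℕ.* p ^ m) ≈⟨ ^-assocʳ (x + y) p (p ^ m) ⟨
    ((x + y) ^′ p) ^′ (p ^ m) ≈⟨ ^-congˡ (p ^ m) (frobenius-p x y) ⟩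
    (x ^′ p + y ^′ p) ^′ (p ^ m) ≈⟨ frobenius-+ m (x ^′ p) (y ^′ p) ⟩
    (x ^′ p) ^′ (p ^ m) + (y ^′ p) ^′ (p ^ m) ≈⟨ +-cong (^-assocʳ x p (p ^ m)) (^-assocʳ y p (p ^ m)) ⟩
    x ^′ (p ℕ.* p ^ m) + y ^′ (p ℕ.* p ^ m)    ∎

-- Characteristic and Frobenius periods of a finite field

module FiniteFieldProperties {c ℓ} {p q k : ℕ} (pr : Prime p) (q≡pᵏ : q ≡ p ^ k) (F : FiniteField c ℓ q) where
  open FiniteField F hiding (zero)
  open Inverse card using (to; from; to-cong; strictlyInverseˡ; strictlyInverseʳ)
  open Exp commutativeSemiring using (^-congˡ; ^-assocʳ; ^-homo-*; ^-congʳ) renaming (_^_ to _^′_)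
  open Mult× semiring using (×1-homo-*; ×-congˡ) renaming (_×_ to _·_)
  open Sum +-commutativeMonoid using (sum; sum-permute; ∑-distrib-+; sum-replicate; sum-cong-≋)
  open RingSolver commutativeRing
  open ≈-Reasoning setoid

  to-injective : ∀ {x y} → to x ≡ to y → x ≈ y
  to-injective {x} {y} e = begin
    x ≈⟨ strictlyInverseʳ x ⟨
    from (to x)  ≡⟨ ≡.cong from e ⟩
    from (to y) ≈⟨ strictlyInverseʳ y ⟩
    y            ∎

  infix 4 _≟_
  _≟_ : ∀ x y → Dec (x ≈ y)
  x ≟ y with to x Fin.≟ to y
  ... | yes e = yes (to-injective e)
  ... | no ¬e = no (λ e → ¬e (to-cong e))

  nonzero⇒regular : ∀ {x} → ¬ (x ≈ 0#) → Regular commutativeRing x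
  nonzero⇒regular {x} x≉0 = let (_ , xy≈1) = inverse x x≉0 in
    RegularProperties.regular-unit commutativeRing xy≈1

  private
    ^≈0⇒≈0 : ∀ {x} n → x ^′ n ≈ 0# → x ≈ 0#
    ^≈0⇒≈0 {x} zero    1≈0 = contradiction 1≈0 1≉0
    ^≈0⇒≈0 {x} (suc n) x^≈0 with x ≟ 0#
    ... | yes x≈0 = x≈0
    ... | no  x≉0 = ^≈0⇒≈0 n (nonzero⇒regular x≉0 _ x^≈0)

    translate : Permutation.Permutation q q
    translate = Permutation.permutation (λ i → to (from i + 1#)) (λ i → to (from i - 1#))
      (λ i → ≡.trans (to-cong (begin
        from (to (from i - 1#)) + 1# ≈⟨ +-congʳ (strictlyInverseʳ _) ⟩
        (from i - 1#) + 1# ≈⟨ solve 2 (λ x y → (x :- y) :+ y := x) refl (from i) 1# ⟩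
        from i                        ∎)) (strictlyInverseˡ i))
      (λ i → ≡.trans (to-cong (begin
        from (to (from i + 1#)) - 1# ≈⟨ +-congʳ (strictlyInverseʳ _) ⟩
        (from i + 1#) - 1# ≈⟨ solve 2 (λ x y → (x :+ y) :- y := x) refl (from i) 1# ⟩
        from i                        ∎)) (strictlyInverseˡ i))

    -- Translation by 1 permutes the field, so the sum s of all elements equals s + q · 1.
    q·1≈0 : q · 1# ≈ 0#
    q·1≈0 = begin
      q · 1# ≈⟨ solve 2 (λ s x → x := (s :+ x) :- s) refl s (q · 1#) ⟩
      (s + q · 1#) - s             ≈⟨ +-congʳ (begin
        s + q · 1# ≈⟨ +-congˡ (sum-replicate q) ⟨
        s + sum {q} (λ _ → 1#) ≈⟨ ∑-distrib-+ {q} from (λ _ → 1#) ⟨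
        sum {q} (λ i → from i + 1#) ≈⟨ sum-cong-≋ {q} (λ i → strictlyInverseʳ (from i + 1#)) ⟨
        sum {q} (λ i → from (to (from i + 1#))) ≈⟨ sum-permute from translate ⟨
        s                             ∎) ⟩
      s - s ≈⟨ -‿inverseʳ s ⟩
      0#                           ∎
      where s = sum {q} from

    ^-·1 : ∀ n → (p ^ n) · 1# ≈ (p · 1#) ^′ n
    ^-·1 zero    = +-identityʳ 1#
    ^-·1 (suc n) = trans (×1-homo-* p (p ^ n)) (*-congˡ (^-·1 n))

  -- (p · 1)^k is q · 1 = 0, and a field has no nilpotent elements.
  characteristic : p · 1# ≈ 0#
  characteristic = ^≈0⇒≈0 k (begin
    (p · 1#) ^′ k ≈⟨ ^-·1 k ⟨
    (p ^ k) · 1# ≈⟨ ×-congˡ q≡pᵏ ⟨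
    q · 1# ≈⟨ q·1≈0 ⟩
    0#             ∎)

  open Frobenius commutativeRing pr characteristic

  private
    frobenius-injective : ∀ n {x y} → x ^′ (p ^ n) ≈ y ^′ (p ^ n) → x ≈ y
    frobenius-injective n {x} {y} e = begin
      x ≈⟨ solve 2 (λ x y → x := (x :- y) :+ y) refl x y ⟩
      (x - y) + y  ≈⟨ +-congʳ (^≈0⇒≈0 (p ^ n) (begin
        z ^′ Q ≈⟨ solve 2 (λ z y → z := (z :+ y) :- y) refl (z ^′ Q) (y ^′ Q) ⟩
        (z ^′ Q + y ^′ Q) - y ^′ Q ≈⟨ +-congʳ (frobenius-+ n z y) ⟨
        (z + y) ^′ Q - y ^′ Q ≈⟨ +-congʳ (^-congˡ Q (solve 2 (λ x y → (x :- y) :+ y := x) refl x y)) ⟩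
        x ^′ Q - y ^′ Q ≈⟨ +-congʳ e ⟩
        y ^′ Q - y ^′ Q ≈⟨ -‿inverseʳ _ ⟩
        0#                           ∎)) ⟩
      0# + y ≈⟨ +-identityˡ y ⟩
      y            ∎
      where
      Q = p ^ n
      z = x - y

    -- Among the q + 1 iterates x^(p^i) with i ≤ q two coincide; injectivity of the Frobenius map
    -- cancels the earlier one, so `x` is periodic with a period of at most q.
    frobenius-orbit : ∀ x → ∃[ e ] 0 < e × e ≤ q × x ^′ (p ^ e) ≈ x
    frobenius-orbit x with Fin.pigeonhole (ℕ.n<1+n q) (λ i → to (x ^′ (p ^ toℕ i)))
    ... | i , j , i<j , eq = e , ℕ.m<n⇒0<n∸m i<j , ℕ.≤-trans (ℕ.m∸n≤m (toℕ j) (toℕ i)) (ℕ.s≤s⁻¹ (Fin.toℕ<n j)) ,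
      frobenius-injective (toℕ i) (begin
        (x ^′ (p ^ e)) ^′ (p ^ toℕ i) ≈⟨ ^-assocʳ x (p ^ e) (p ^ toℕ i) ⟩
        x ^′ (p ^ e ℕ.* p ^ toℕ i)      ≡⟨ ≡.cong (x ^′_) (≡.trans (≡.sym (ℕ.^-distribˡ-+-* p e (toℕ i))) (≡.cong (p ^_) (ℕ.m∸n+n≡m (ℕ.<⇒≤ i<j)))) ⟩
        x ^′ (p ^ toℕ j) ≈⟨ to-injective eq ⟨
        x ^′ (p ^ toℕ i)                ∎)
      where e = toℕ j ∸ toℕ i

    fixed-multiple : ∀ e x → x ^′ (p ^ e) ≈ x → ∀ n → x ^′ (p ^ (n ℕ.* e)) ≈ x
    fixed-multiple e x fix zero    = *-identityʳ x
    fixed-multiple e x fix (suc n) = begin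
      x ^′ (p ^ (e ℕ.+ n ℕ.* e))           ≡⟨ ≡.cong (x ^′_) (ℕ.^-distribˡ-+-* p e (n ℕ.* e)) ⟩
      x ^′ (p ^ e ℕ.* p ^ (n ℕ.* e)) ≈⟨ ^-assocʳ x (p ^ e) (p ^ (n ℕ.* e)) ⟨
      (x ^′ (p ^ e)) ^′ (p ^ (n ℕ.* e)) ≈⟨ ^-congˡ (p ^ (n ℕ.* e)) fix ⟩
      x ^′ (p ^ (n ℕ.* e)) ≈⟨ fixed-multiple e x fix n ⟩
      x                                    ∎

  private
    factorial-multiple : ∀ {e n} → 0 < e → e ≤ n → e ∣ n !
    factorial-multiple {suc e} _ e≤n = ∣.∣-trans (∣.m∣m*n (e !)) (m≤n⇒m!∣n! e≤n)

  -- The period of `x` depends on `x`, but every number from 1 to q divides q!, so one exponent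
  -- serves the whole field.
  frobenius-fixed : ∀ x → x ^′ (p ^ (q !)) ≈ x
  frobenius-fixed x =
    let (e , 0<e , e≤q , fix) = frobenius-orbit x
        e∣q! = factorial-multiple 0<e e≤q
    in ≡.subst (λ m → x ^′ (p ^ m) ≈ x) (≡.sym (_∣_.equality e∣q!)) (fixed-multiple e x fix (_∣_.quotient e∣q!))

-- Formal power series: ring structure, precision, substitution

module PowerSeries {c ℓ} (R : CommutativeRing c ℓ) where
  private
    module R = CommutativeRing R
  open Sum R.+-commutativeMonoid using (sum; sum-cong-≋)
  open RingSolver R

  Series : Set c
  Series = ℕ → R.Carrier

  infix 4 _≐_
  _≐_ : Series → Series → Set ℓ
  u ≐ v = ∀ n → u n R.≈ v n

  tail : Series → Series
  tail u n = u (suc n)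

  private
    module ≈R = ≈-Reasoning R.setoid

  opaque
    conv : Series → Series → Series
    conv u v k = sum {suc k} (λ i → u (toℕ i) R.* v (k ∸ toℕ i))

    conv-sum : ∀ u v k → conv u v k ≡ sum {suc k} (λ i → u (toℕ i) R.* v (k ∸ toℕ i))
    conv-sum u v k = ≡.refl

    conv-zero : ∀ u v → conv u v 0 R.≈ u 0 R.* v 0
    conv-zero u v = R.+-identityʳ _

    conv-suc : ∀ u v n → conv u v (suc n) ≡ u 0 R.* v (suc n) R.+ conv (tail u) v n
    conv-suc u v n = ≡.refl

    conv-congʳ-≤ : ∀ u {v v'} n → (∀ k → k ≤ n → v k R.≈ v' k) → conv u v n R.≈ conv u v' n
    conv-congʳ-≤ u n e = sum-cong-≋ {suc n} (λ i → R.*-congˡ {u (toℕ i)} (e (n ∸ toℕ i) (ℕ.m∸n≤m n (toℕ i))))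

    conv-cong : ∀ {u u' v v'} → u ≐ u' → v ≐ v' → conv u v ≐ conv u' v'
    conv-cong e f n = sum-cong-≋ {suc n} (λ i → R.*-cong (e (toℕ i)) (f (n ∸ toℕ i)))

    -- The mirror image of `conv-suc`: commutativity and the long division `*-quotient` peel off the
    -- second factor.
    conv-sucʳ : ∀ u v n → conv u v (suc n) R.≈ conv u (tail v) n R.+ u (suc n) R.* v 0
    conv-sucʳ u v zero    = solve 2 (λ x y → x :+ (y :+ con (+ 0)) := (x :+ con (+ 0)) :+ y) R.refl _ _
    conv-sucʳ u v (suc n) = R.trans (R.+-congˡ (conv-sucʳ (tail u) v n)) (R.sym (R.+-assoc _ _ _))

    conv-comm : ∀ u v → conv u v ≐ conv v u
    conv-comm u v zero    = R.+-congʳ (R.*-comm _ _)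
    conv-comm u v (suc n) = ≈R.begin
      u 0 R.* v (suc n) R.+ conv (tail u) v n  ≈R.≈⟨ R.+-cong (R.*-comm _ _) (conv-comm (tail u) v n) ⟩
      v (suc n) R.* u 0 R.+ conv v (tail u) n  ≈R.≈⟨ R.+-comm _ _ ⟩
      conv v (tail u) n R.+ v (suc n) R.* u 0  ≈R.≈⟨ conv-sucʳ v u n ⟨
      conv v u (suc n)                         ≈R.∎

    conv-distribʳ : ∀ w u v → conv (λ n → u n R.+ v n) w ≐ (λ n → conv u w n R.+ conv v w n)
    conv-distribʳ w u v zero    = solve 3 (λ w u v → (u :+ v) :* w :+ con (+ 0) := (u :* w :+ con (+ 0)) :+ (v :* w :+ con (+ 0))) R.refl _ _ _
    conv-distribʳ w u v (suc n) = R.trans (R.+-congˡ (conv-distribʳ w (tail u) (tail v) n))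
      (solve 5 (λ w u v x y → (u :+ v) :* w :+ (x :+ y) := (u :* w :+ x) :+ (v :* w :+ y)) R.refl _ _ _ _ _)

    conv-scaleˡ : ∀ a u v → conv (λ n → a R.* u n) v ≐ (λ n → a R.* conv u v n)
    conv-scaleˡ a u v zero    = solve 3 (λ a u v → a :* u :* v :+ con (+ 0) := a :* (u :* v :+ con (+ 0))) R.refl _ _ _
    conv-scaleˡ a u v (suc n) = R.trans (R.+-congˡ (conv-scaleˡ a (tail u) v n))
      (solve 4 (λ a u v x → a :* u :* v :+ a :* x := a :* (u :* v :+ x)) R.refl _ _ _ _)

    conv-assoc : ∀ u v w → conv (conv u v) w ≐ conv u (conv v w)
    conv-assoc u v w zero    = solve 3 (λ u v w → (u :* v :+ con (+ 0)) :* w :+ con (+ 0) := u :* (v :* w :+ con (+ 0)) :+ con (+ 0)) R.refl _ _ _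
    conv-assoc u v w (suc n) = ≈R.begin
      (u 0 R.* v 0 R.+ R.0#) R.* w (suc n) R.+ conv (λ k → u 0 R.* v (suc k) R.+ conv (tail u) v k) w n
        ≈R.≈⟨ R.+-congˡ (R.trans (conv-distribʳ w (λ k → u 0 R.* v (suc k)) (conv (tail u) v) n) (R.+-cong (conv-scaleˡ (u 0) (tail v) w n) (conv-assoc (tail u) v w n))) ⟩
      (u 0 R.* v 0 R.+ R.0#) R.* w (suc n) R.+ (u 0 R.* conv (tail v) w n R.+ conv (tail u) (conv v w) n)
        ≈R.≈⟨ solve 5 (λ u v w x y → (u :* v :+ con (+ 0)) :* w :+ (u :* x :+ y) := u :* (v :* w :+ x) :+ y) R.refl _ _ _ _ _ ⟩
      u 0 R.* (v 0 R.* w (suc n) R.+ conv (tail v) w n) R.+ conv (tail u) (conv v w) n ≈R.∎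

  const : R.Carrier → Series
  const a zero    = a
  const a (suc _) = R.0#

  shift : Series → Series
  shift u zero    = R.0#
  shift u (suc n) = u n

  private
    conv-const : ∀ a u → conv (const a) u ≐ (λ n → a R.* u n)
    conv-const a u zero    = conv-zero (const a) u
    conv-const a u (suc n) = R.trans (R.reflexive (conv-suc (const a) u n)) (R.trans (R.+-congˡ (conv-0 n)) (R.+-identityʳ _))
      where
      conv-0 : ∀ n → conv (λ _ → R.0#) u n R.≈ R.0#
      conv-0 zero    = R.trans (conv-zero _ u) (R.zeroˡ _)
      conv-0 (suc n) = R.trans (R.reflexive (conv-suc _ u n)) (R.trans (R.+-cong (R.zeroˡ _) (conv-0 n)) (R.+-identityʳ _))

  seriesRing : CommutativeRing c ℓ
  seriesRing = record
    { Carrier = Series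
    ; _≈_ = _≐_
    ; _+_ = λ u v n → u n R.+ v n
    ; _*_ = conv
    ; -_ = λ u n → R.- u n
    ; 0# = λ _ → R.0#
    ; 1# = const R.1#
    ; isCommutativeRing = record
      { isRing = record
        { +-isAbelianGroup = record
          { isGroup = record
            { isMonoid = record
              { isSemigroup = record
                { isMagma = record
                  { isEquivalence = record
                    { refl = λ _ → R.refl
                    ; sym = λ e n → R.sym (e n)
                    ; trans = λ e f n → R.trans (e n) (f n)
                    }
                  ; ∙-cong = λ e f n → R.+-cong (e n) (f n)
                  }
                ; assoc = λ _ _ _ n → R.+-assoc _ _ _
                }
              ; identity = (λ _ n → R.+-identityˡ _) , (λ _ n → R.+-identityʳ _)
              }
            ; inverse = (λ _ n → R.-‿inverseˡ _) , (λ _ n → R.-‿inverseʳ _)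
            ; ⁻¹-cong = λ e n → R.-‿cong (e n)
            }
          ; comm = λ _ _ n → R.+-comm _ _
          }
        ; *-cong = conv-cong
        ; *-assoc = conv-assoc
        ; *-identity = identityˡ , (λ u n → R.trans (conv-comm u (const R.1#) n) (identityˡ u n))
        ; distrib = (λ w u v n → R.trans (conv-comm w (λ k → u k R.+ v k) n) (R.trans (conv-distribʳ w u v n) (R.+-cong (conv-comm u w n) (conv-comm v w n))))
                  , conv-distribʳ
        }
      ; *-comm = conv-comm
      }
    }
    where
    identityˡ : ∀ u → conv (const R.1#) u ≐ u
    identityˡ u n = R.trans (conv-const R.1# u n) (R.*-identityˡ _)

  open CommutativeRing seriesRing hiding (zero)
  open Exp commutativeSemiring using () renaming (_^_ to _^′_)
  private
    module S = RingSolver seriesRing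
  open ≈-Reasoning setoid

  const-cong : ∀ {a b} → a R.≈ b → const a ≈ const b
  const-cong e zero    = e
  const-cong e (suc n) = R.refl

  const-*-coefficient : ∀ a u n → (const a * u) n R.≈ a R.* u n
  const-*-coefficient = conv-const

  const-+ : ∀ a b → const (a R.+ b) ≈ const a + const b
  const-+ a b zero    = R.refl
  const-+ a b (suc n) = R.sym (R.+-identityˡ R.0#)

  const-* : ∀ a b → const (a R.* b) ≈ const a * const b
  const-* a b zero    = R.sym (conv-const a (const b) zero)
  const-* a b (suc n) = R.sym (R.trans (conv-const a (const b) (suc n)) (R.zeroʳ a))

  X : Series
  X = shift 1#

  X*-shift : ∀ u → X * u ≈ shift u
  X*-shift u zero    = R.trans (conv-zero X u) (R.zeroˡ _)
  X*-shift u (suc n) = R.trans (R.reflexive (conv-suc X u n)) (R.trans (R.+-cong (R.zeroˡ _) (*-identityˡ u n)) (R.+-identityˡ _))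

  head-tail : ∀ u → u ≈ const (u 0) + X * tail u
  head-tail u zero    = R.sym (R.trans (R.+-congˡ (X*-shift (tail u) 0)) (R.+-identityʳ _))
  head-tail u (suc n) = R.sym (R.trans (R.+-congˡ (X*-shift (tail u) (suc n))) (R.+-identityˡ _))

  *-head-tail : ∀ u v → u * v ≈ const (u 0) * v + X * (tail u * v)
  *-head-tail u v = begin
    u * v ≈⟨ *-congʳ (head-tail u) ⟩
    (const (u 0) + X * tail u) * v ≈⟨ S.solve 4 (λ a x t v → (a S.:+ x S.:* t) S.:* v S.:= a S.:* v S.:+ x S.:* (t S.:* v)) refl (const (u 0)) X (tail u) v ⟩
    const (u 0) * v + X * (tail u * v)   ∎

  X-regular : Regular seriesRing X
  X-regular u Xu≈0 n = R.trans (R.sym (X*-shift u (suc n))) (Xu≈0 (suc n))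

  -- Long division of `y` by `u`, where `a` is to be the inverse of u 0: subtract (a · y 0) u and
  -- divide what remains, shifted by one place.
  quotient : R.Carrier → Series → Series → Series
  quotient a u y zero    = a R.* y 0
  quotient a u y (suc n) = quotient a u (tail (λ k → y k R.- (a R.* y 0) R.* u k)) n

  *-quotient : ∀ {a u} → u 0 R.* a R.≈ R.1# → ∀ y → u * quotient a u y ≈ y
  *-quotient {a} {u} ua≈1 y zero    = ≈R.begin
    (u * quotient a u y) 0           ≈R.≈⟨ conv-zero u (quotient a u y) ⟩
    u 0 R.* (a R.* y 0)              ≈R.≈⟨ R.*-assoc _ _ _ ⟨
    u 0 R.* a R.* y 0                ≈R.≈⟨ R.*-congʳ ua≈1 ⟩
    R.1# R.* y 0                     ≈R.≈⟨ R.*-identityˡ _ ⟩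
    y 0                              ≈R.∎
  *-quotient {a} {u} ua≈1 y (suc n) = ≈R.begin
    (u * quotient a u y) (suc n)                                             ≈R.≈⟨ conv-sucʳ u (quotient a u y) n ⟩
    (u * quotient a u y') n R.+ u (suc n) R.* (a R.* y 0)                    ≈R.≈⟨ R.+-congʳ (*-quotient ua≈1 y' n) ⟩
    (y (suc n) R.- (a R.* y 0) R.* u (suc n)) R.+ u (suc n) R.* (a R.* y 0)  ≈R.≈⟨ solve 3 (λ y b u → (y :- b :* u) :+ u :* b := y) R.refl _ _ _ ⟩
    y (suc n)                                                                ≈R.∎
    where y' = tail (λ k → y k R.- (a R.* y 0) R.* u k)

  infix 4 _≈[_]_
  -- Congruence modulo X^N. Identities of series are proved by induction on N, a factor X gaining
  -- one place of precision (`X*-≈[]`).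
  _≈[_]_ : Series → ℕ → Series → Set ℓ
  u ≈[ N ] v = ∀ n → n < N → u n R.≈ v n

  module Approximation where
    ≈⇒≈[] : ∀ {N u v} → u ≈ v → u ≈[ N ] v
    ≈⇒≈[] e n _ = e n

    ≈[]-trans : ∀ {N u v w} → u ≈[ N ] v → v ≈[ N ] w → u ≈[ N ] w
    ≈[]-trans e f n n<N = R.trans (e n n<N) (f n n<N)

    +-≈[] : ∀ {N u u' v v'} → u ≈[ N ] u' → v ≈[ N ] v' → (u + v) ≈[ N ] (u' + v')
    +-≈[] e f n n<N = R.+-cong (e n n<N) (f n n<N)

    *-≈[] : ∀ {N v v'} u → v ≈[ N ] v' → (u * v) ≈[ N ] (u * v')
    *-≈[] u e n n<N = conv-congʳ-≤ u n (λ k k≤n → e k (ℕ.≤-<-trans k≤n n<N))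

    X*-≈[] : ∀ {N u v} → u ≈[ N ] v → (X * u) ≈[ suc N ] (X * v)
    X*-≈[] e zero    _         = R.trans (X*-shift _ 0) (R.sym (X*-shift _ 0))
    X*-≈[] e (suc n) (s≤s n<N) = R.trans (X*-shift _ (suc n)) (R.trans (e n n<N) (R.sym (X*-shift _ (suc n))))

    ≈[]⇒≈ : ∀ {u v} → (∀ N → u ≈[ N ] v) → u ≈ v
    ≈[]⇒≈ e n = e (suc n) n ℕ.≤-refl

  module Substitution (ω : Series) where
    open Approximation

    private
      -- Horner's scheme for u(Xω), cut off after N steps. The factor X in each step makes the first
      -- N coefficients final, so the value of `σ` can be read along the diagonal.
      approx : ℕ → Series → Series
      approx zero    u = 0#
      approx (suc N) u = const (u 0) + X * (ω * approx N (tail u))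

      approx-stable : ∀ {M N} u → M ≤ N → approx M u ≈[ M ] approx N u
      approx-stable u z≤n       = λ _ ()
      approx-stable {suc M} {suc N} u (s≤s M≤N) =
        +-≈[] {suc M} {const (u 0)} (λ _ _ → R.refl) (X*-≈[] (*-≈[] ω (approx-stable (tail u) M≤N)))

    σ : Series → Series
    σ u n = approx (suc n) u n

    private
      approx-σ : ∀ N u → approx N u ≈[ N ] σ u
      approx-σ N u n n<N = R.sym (approx-stable u n<N n ℕ.≤-refl)

    -- The functional equation of the substitution X ↦ Xω. It determines `σ` to any precision, and
    -- the homomorphism laws are derived from it alone.
    σ-step : ∀ u → σ u ≈ const (u 0) + X * (ω * σ (tail u))
    σ-step u = ≈[]⇒≈ λ
      { zero    → λ _ ()
      ; (suc N) → ≈[]-trans (λ n n<N → R.sym (approx-σ (suc N) u n n<N))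
                    (+-≈[] {suc N} {const (u 0)} (λ _ _ → R.refl) (X*-≈[] (*-≈[] ω (approx-σ N (tail u)))))
      }

    σ-cong : ∀ {u v} → u ≈ v → σ u ≈ σ v
    σ-cong {u} {v} e = ≈[]⇒≈ (λ N → go N e)
      where
      go : ∀ N {u v} → u ≈ v → σ u ≈[ N ] σ v
      go zero    e = λ _ ()
      go (suc N) {u} {v} e = ≈[]-trans (≈⇒≈[] (σ-step u)) (≈[]-trans
        (+-≈[] (≈⇒≈[] (const-cong (e 0))) (X*-≈[] (*-≈[] ω (go N (λ n → e (suc n)))))) (≈⇒≈[] (sym (σ-step v))))

    σ-+ : ∀ u v → σ (u + v) ≈ σ u + σ v
    σ-+ u v = ≈[]⇒≈ (λ N → go N u v)
      where
      go : ∀ N u v → σ (u + v) ≈[ N ] (σ u + σ v)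
      go zero    u v = λ _ ()
      go (suc N) u v = ≈[]-trans (≈⇒≈[] (σ-step (u + v))) (≈[]-trans
        (+-≈[] (≈⇒≈[] (const-+ (u 0) (v 0))) (X*-≈[] (*-≈[] ω (go N (tail u) (tail v)))))
        (≈⇒≈[] (begin
          const (u 0) + const (v 0) + X * (ω * (σ (tail u) + σ (tail v)))
            ≈⟨ S.solve 6 (λ a b x o s t → a S.:+ b S.:+ x S.:* (o S.:* (s S.:+ t)) S.:= (a S.:+ x S.:* (o S.:* s)) S.:+ (b S.:+ x S.:* (o S.:* t))) refl (const (u 0)) (const (v 0)) X ω (σ (tail u)) (σ (tail v)) ⟩
          (const (u 0) + X * (ω * σ (tail u))) + (const (v 0) + X * (ω * σ (tail v)))
            ≈⟨ +-cong (σ-step u) (σ-step v) ⟨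
          σ u + σ v ∎)))

    private
      σ-const* : ∀ a v → σ (const a * v) ≈ const a * σ v
      σ-const* a v = ≈[]⇒≈ (λ N → go N v)
        where
        tail-const* : ∀ v → tail (const a * v) ≈ const a * tail v
        tail-const* v n = R.trans (conv-const a v (suc n)) (R.sym (conv-const a (tail v) n))
        go : ∀ N v → σ (const a * v) ≈[ N ] (const a * σ v)
        go zero    v = λ _ ()
        go (suc N) v = ≈[]-trans (≈⇒≈[] (trans (σ-step (const a * v))
            (+-cong (trans (const-cong (conv-const a v 0)) (const-* a (v 0))) (*-congˡ (*-congˡ (σ-cong (tail-const* v)))))))
          (≈[]-trans (+-≈[] {suc N} {const a * const (v 0)} (λ _ _ → R.refl) (X*-≈[] (*-≈[] ω (go N (tail v)))))
          (≈⇒≈[] (begin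
            const a * const (v 0) + X * (ω * (const a * σ (tail v)))
              ≈⟨ S.solve 5 (λ a b x o s → a S.:* b S.:+ x S.:* (o S.:* (a S.:* s)) S.:= a S.:* (b S.:+ x S.:* (o S.:* s))) refl (const a) (const (v 0)) X ω (σ (tail v)) ⟩
            const a * (const (v 0) + X * (ω * σ (tail v))) ≈⟨ *-congˡ (σ-step v) ⟨
            const a * σ v                                   ∎)))

    σ-X* : ∀ u → σ (X * u) ≈ X * (ω * σ u)
    σ-X* u = begin
      σ (X * u) ≈⟨ σ-step (X * u) ⟩
      const ((X * u) 0) + X * (ω * σ (tail (X * u))) ≈⟨ +-cong const0 (*-congˡ (*-congˡ (σ-cong (λ n → X*-shift u (suc n))))) ⟩
      0# + X * (ω * σ u) ≈⟨ +-identityˡ _ ⟩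
      X * (ω * σ u)                                       ∎
      where
      const0 : const ((X * u) 0) ≈ 0#
      const0 zero    = X*-shift u 0
      const0 (suc n) = R.refl

    σ-* : ∀ u v → σ (u * v) ≈ σ u * σ v
    σ-* u v = ≈[]⇒≈ (λ N → go N u)
      where
      go : ∀ N u → σ (u * v) ≈[ N ] (σ u * σ v)
      go zero    u = λ _ ()
      go (suc N) u = ≈[]-trans (≈⇒≈[] (begin
          σ (u * v) ≈⟨ σ-cong (*-head-tail u v) ⟩
          σ (const (u 0) * v + X * (tail u * v)) ≈⟨ σ-+ (const (u 0) * v) (X * (tail u * v)) ⟩
          σ (const (u 0) * v) + σ (X * (tail u * v)) ≈⟨ +-cong (σ-const* (u 0) v) (σ-X* (tail u * v)) ⟩
          const (u 0) * σ v + X * (ω * σ (tail u * v))         ∎))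
        (≈[]-trans (+-≈[] {suc N} {const (u 0) * σ v} (λ _ _ → R.refl) (X*-≈[] (*-≈[] ω (go N (tail u)))))
        (≈⇒≈[] (begin
          const (u 0) * σ v + X * (ω * (σ (tail u) * σ v))
            ≈⟨ S.solve 5 (λ a v x o s → a S.:* v S.:+ x S.:* (o S.:* (s S.:* v)) S.:= (a S.:+ x S.:* (o S.:* s)) S.:* v) refl (const (u 0)) (σ v) X ω (σ (tail u)) ⟩
          (const (u 0) + X * (ω * σ (tail u))) * σ v ≈⟨ *-congʳ (σ-step u) ⟨
          σ u * σ v                                            ∎)))

    σ-const : ∀ a → σ (const a) ≈ const a
    σ-const a = begin
      σ (const a) ≈⟨ σ-step (const a) ⟩
      const a + X * (ω * σ (λ _ → R.0#)) ≈⟨ +-congˡ (*-congˡ (*-congˡ σ0)) ⟩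
      const a + X * (ω * 0#) ≈⟨ S.solve 3 (λ a x o → a S.:+ x S.:* (o S.:* S.con (+ 0)) S.:= a) refl (const a) X ω ⟩
      const a                                  ∎
      where
      σ0 : σ 0# ≈ 0#
      σ0 = begin
        σ 0# ≈⟨ S.solve 1 (λ x → x S.:= (x S.:+ x) S.:- x) refl (σ 0#) ⟩
        (σ 0# + σ 0#) - σ 0# ≈⟨ +-congʳ (σ-+ 0# 0#) ⟨
        σ (0# + 0#) - σ 0# ≈⟨ +-congʳ (σ-cong (+-identityˡ 0#)) ⟩
        σ 0# - σ 0# ≈⟨ -‿inverseʳ _ ⟩
        0#                     ∎

  IsPolynomial : ℕ → Series → Set ℓ
  IsPolynomial N u = ∀ n → N ≤ n → u n R.≈ R.0#

  polynomial-weaken : ∀ {M N u} → M ≤ N → IsPolynomial M u → IsPolynomial N u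
  polynomial-weaken M≤N p n N≤n = p n (ℕ.≤-trans M≤N N≤n)

  polynomial-resp : ∀ {N u v} → u ≈ v → IsPolynomial N u → IsPolynomial N v
  polynomial-resp e p n N≤n = R.trans (R.sym (e n)) (p n N≤n)

  polynomial-+ : ∀ {N u v} → IsPolynomial N u → IsPolynomial N v → IsPolynomial N (u + v)
  polynomial-+ p r n N≤n = R.trans (R.+-cong (p n N≤n) (r n N≤n)) (R.+-identityˡ _)

  polynomial-* : ∀ {M N u v} → IsPolynomial M u → IsPolynomial N v → IsPolynomial (M ℕ.+ N) (u * v)
  polynomial-* {zero}  {N} {u} {v} p r n       _ =
    R.trans (*-congʳ {v} {u} {0#} (λ k → p k z≤n) n) (zeroˡ v n)
  polynomial-* {suc M} {N} {u} {v} p r (suc n) (s≤s le) = R.trans (R.reflexive (conv-suc u v n)) (R.trans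
    (R.+-cong (R.trans (R.*-congˡ (r (suc n) (ℕ.≤-trans (ℕ.m≤n+m N M) (ℕ.m≤n⇒m≤1+n le)))) (R.zeroʳ _))
              (polynomial-* {M} {N} {tail u} {v} (λ k M≤k → p (suc k) (s≤s M≤k)) r n le))
    (R.+-identityˡ _))

  polynomial-const : ∀ a → IsPolynomial 1 (const a)
  polynomial-const a (suc n) _ = R.refl

  polynomial-X : IsPolynomial 2 X
  polynomial-X (suc (suc n)) _           = R.refl
  polynomial-X (suc zero)    (s≤s ())

-- Spans of Q-th powers

module FrobeniusLinearAlgebra {a ℓ r} (K : CommutativeRing a ℓ) (𝓡 : CommutativeRing.Carrier K → Set r) (coefficients : IsCoefficientRing K 𝓡) (Q : ℕ) (2≤Q : 2 ≤ Q) (frobenius-+ : IsAdditivePower K Q) where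
  open CommutativeRing K hiding (zero)
  open IsCoefficientRing coefficients
  open LinearAlgebra K 𝓡 coefficients
  open RegularProperties K
  open Membership setoid using (_∈_)
  open Exp commutativeSemiring using (^-congˡ; ^-distrib-*; ^-assocʳ) renaming (_^_ to _^′_)
  open ≈-Reasoning setoid

  frobeniusImage : List Carrier → List Carrier
  frobeniusImage = map (_^′ Q)

  private
    1^ : ∀ n → 1# ^′ n ≈ 1#
    1^ zero    = refl
    1^ (suc n) = trans (*-identityˡ _) (1^ n)

    0^Q : 0# ^′ Q ≈ 0#
    0^Q = ≡.subst (λ n → 0# ^′ n ≈ 0#) (ℕ.suc-pred Q {{ℕ.>-nonZero (ℕ.<⇒≤ 2≤Q)}}) (zeroˡ _)

    𝓡-^ : ∀ {x} n → 𝓡 x → 𝓡 (x ^′ n)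
    𝓡-^ zero    _  = 𝓡-1
    𝓡-^ (suc n) 𝓡x = 𝓡-* 𝓡x (𝓡-^ n 𝓡x)

    regular-^ : ∀ {x} n → Regular K x → Regular K (x ^′ n)
    regular-^ zero    _   = regular-1
    regular-^ (suc n) reg = regular-* reg (regular-^ n reg)

    ∈image⁻ : ∀ {A v} → v ∈ frobeniusImage A → ∃[ u ] u ∈ A × v ≈ u ^′ Q
    ∈image⁻ = Membershipₚ.∈-map⁻ setoid setoid

  frobenius-span : ∀ {A u} → Span A u → Span (frobeniusImage A) (u ^′ Q)
  frobenius-span {A} = span-elim {N = λ u → Span (frobeniusImage A) (u ^′ Q)} (record
    { resp     = λ e → resp (^-congˡ Q e)
    ; null     = resp (sym 0^Q) null
    ; add      = λ s t → resp (sym (frobenius-+ _ _)) (add s t)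
    ; scale    = λ c s → resp (sym (^-distrib-* _ _ Q)) (scale (𝓡-^ Q c) s)
    ; saturate = λ g reg s → saturate (𝓡-^ Q g) (regular-^ Q reg) (resp (^-distrib-* _ _ Q) s)
    }) (λ v∈ → generator (Membershipₚ.∈-map⁺ setoid setoid (^-congˡ Q) v∈))

  module _ {A : List Carrier} (contracted : ∀ {u} → Span A u → Span (frobeniusImage A) u) where
    private
      iterate : ℕ → List Carrier
      iterate zero    = A
      iterate (suc n) = frobeniusImage (iterate n)

      iterate-length : ∀ n → length (iterate n) ≡ length A
      iterate-length zero    = ≡.refl
      iterate-length (suc n) = ≡.trans (List.length-map (_^′ Q) (iterate n)) (iterate-length n)

      iterate-⊆ : ∀ n {u} → Span (iterate n) u → Span (iterate (suc n)) u
      iterate-⊆ zero    = contracted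
      iterate-⊆ (suc n) = span-elim (span-isSubspace _) λ v∈ →
        let (u , u∈ , v≈) = ∈image⁻ v∈ in resp (sym v≈) (frobenius-span (iterate-⊆ n (generator u∈)))

      towers : Carrier → ℕ → List Carrier
      towers y zero    = y ^′ 1 ∷ []
      towers y (suc n) = y ^′ (Q ^ suc n) ∷ towers y n

      towers-length : ∀ y n → length (towers y n) ≡ suc n
      towers-length y zero    = ≡.refl
      towers-length y (suc n) = ≡.cong suc (towers-length y n)

      tower-span : ∀ {y} n → Span A y → Span (iterate n) (y ^′ (Q ^ n))
      tower-span {y} zero    y∈ = resp (sym (*-identityʳ y)) y∈
      tower-span {y} (suc n) y∈ = resp (trans (^-assocʳ y (Q ^ n) Q) (reflexive (≡.cong (y ^′_) (ℕ.*-comm (Q ^ n) Q))))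
        (frobenius-span (tower-span n y∈))

      towers-span : ∀ {y} n → Span A y → All (Span (iterate n)) (towers y n)
      towers-span zero    y∈ = tower-span 0 y∈ ∷ []
      towers-span (suc n) y∈ = tower-span (suc n) y∈ ∷ All.map (iterate-⊆ n) (towers-span n y∈)

      ∈towers⇒^ : ∀ y n {v} → v ∈ towers y n → ∃[ i ] i ≤ Q ^ n × v ≈ y ^′ i
      ∈towers⇒^ y zero    (here e)  = 1 , ℕ.≤-refl , e
      ∈towers⇒^ y (suc n) (here e)  = Q ^ suc n , ℕ.≤-refl , e
      ∈towers⇒^ y (suc n) (there p) = let (i , i≤ , e) = ∈towers⇒^ y n p in
        i , ℕ.≤-trans i≤ (ℕ.m≤n*m (Q ^ n) Q {{ℕ.>-nonZero (ℕ.<⇒≤ 2≤Q)}}) , e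

      Q^n<Q^1+n : ∀ n → Q ^ n < Q ^ suc n
      Q^n<Q^1+n n = ℕ.^-monoʳ-< Q 2≤Q (ℕ.n<1+n n)

      go : ∀ {y} n → Dependent (towers y n) → Algebraic y
      go {y} zero (here y∈) = 0 , resp (sym (span-[] y∈)) null
      go {y} (suc n) (there d)     = go n d
      -- The relation involves only the powers y^(Q^i), but it is read as one of degree Q^(n+1) in
      -- all lower powers; `Algebraic` records that degree minus one.
      go {y} (suc n) (here y∈)     = ℕ.pred (Q ^ suc n) , resp (reflexive (≡.cong (y ^′_) (≡.sym eq)))
        (span-elim (span-isSubspace _) gens y∈)
        where
        eq : suc (ℕ.pred (Q ^ suc n)) ≡ Q ^ suc n
        eq = ℕ.suc-pred (Q ^ suc n) {{ℕ.m^n≢0 Q (suc n) {{ℕ.>-nonZero (ℕ.<⇒≤ 2≤Q)}}}}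
        gens : ∀ {v} → v ∈ towers y n → Span (powers y (ℕ.pred (Q ^ suc n))) v
        gens v∈ = let (i , i≤ , v≈) = ∈towers⇒^ y n v∈ in
          resp (sym v≈) (generator (^∈powers y (ℕ.≤-pred (≡.subst (suc i ≤_) (≡.sym eq) (ℕ.≤-<-trans i≤ (Q^n<Q^1+n n))))))

    -- y, y^Q, …, y^{Q^n} all lie in the span of the Q^n-th powers of A.
    contracted⇒algebraic : ∀ {y} → Span A y → Algebraic y
    contracted⇒algebraic {y} y∈ = go (length A) (dependent (towers-span (length A) y∈)
      (ℕ.≤-reflexive (≡.trans (≡.cong suc (iterate-length (length A))) (≡.sym (towers-length y (length A))))))

  -- `root` is the linear disjointness of MacLane's criterion for separability: independent elements
  -- stay independent when raised to the power Q. It is assumed here because its proof needs the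
  -- operator Λ on Laurent series.
  module Separable (root : ∀ {A u} → Span (frobeniusImage A) (u ^′ Q) → Span A u) where
    private
      orbit : ℕ → Carrier → List Carrier
      orbit zero    y = []
      orbit (suc n) y = y ∷ orbit n (y ^′ Q)

      orbit-image : ∀ n y → orbit n (y ^′ Q) ≡ frobeniusImage (orbit n y)
      orbit-image zero    y = ≡.refl
      orbit-image (suc n) y = ≡.cong (y ^′ Q ∷_) (orbit-image n (y ^′ Q))

      orbit-length : ∀ n y → length (orbit n y) ≡ n
      orbit-length zero    y = ≡.refl
      orbit-length (suc n) y = ≡.cong suc (orbit-length n (y ^′ Q))

      orbit-span : ∀ {A} → IsRing A → ∀ n {y} → Span A y → All (Span A) (orbit n y)
      orbit-span ring zero    y∈ = []
      orbit-span ring (suc n) y∈ = y∈ ∷ orbit-span ring n (IsRing.pow ring Q y∈)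

      -- A dependency expresses some y^(Q^i) through later members of the orbit; i extractions of
      -- roots bring it down to y itself.
      orbit-root : ∀ n {y} → Dependent (orbit n y) → ∃[ m ] Span (orbit m (y ^′ Q)) y
      orbit-root (suc n) (here y∈)     = n , y∈
      orbit-root (suc n) {y} (there d) = let (m , y∈) = orbit-root n d in
        m , root (≡.subst (λ A → Span A (y ^′ Q)) (orbit-image m (y ^′ Q)) y∈)

      orbit-∈image : ∀ {A} → IsRing A → ∀ n {y v} → Span A y → v ∈ orbit n (y ^′ Q) → Span (frobeniusImage A) v
      orbit-∈image ring (suc n) y∈ (here e)  = resp (sym e) (frobenius-span y∈)
      orbit-∈image ring (suc n) y∈ (there p) = orbit-∈image ring n (IsRing.pow ring Q y∈) p

    -- By separability y depends on y^Q, y^(Q²), ..., and each of these is the Q-th power of an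
    -- element of the algebra.
    ring⇒contracted : ∀ {A y} → IsRing A → Span A y → Span (frobeniusImage A) y
    ring⇒contracted {A} {y} ring y∈ =
      let n = suc (length A)
          (m , y∈orbit) = orbit-root n (dependent (orbit-span ring n y∈) (ℕ.≤-reflexive (≡.sym (orbit-length n y))))
      in span-elim (span-isSubspace _) (orbit-∈image ring m y∈) y∈orbit

-- Automata and finite kernels

module Automata {a ℓ} (X : Setoid a ℓ) where
  open Setoid X

  -- The state y stands for the sequence value y; reading the digit d of base B
  -- passes to its subsequence of indices congruent to d modulo B.
  record Automaton (B : ℕ) s : Set (a ⊔ ℓ ⊔ Level.suc s) where
    field
      State      : Set s
      next       : State → ℕ → State
      value      : State → ℕ → Carrier
      value-next : ∀ y {d} → d < B → ∀ n → value (next y d) n ≈ value y (n ℕ.* B ℕ.+ d)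
      {size}     : ℕ
      code       : State → Fin size
      code-value : ∀ {y y'} → code y ≡ code y' → ∀ n → value y n ≈ value y' n

  module _ {p s} .{{_ : NonZero p}} (M : Automaton p s) where
    open Automaton M

    private
      run : State → List ℕ → State
      run y []       = y
      run y (d ∷ ds) = run (next y d) ds

      run-++ : ∀ y ds es → run y (ds ++ es) ≡ run (run y ds) es
      run-++ y []       es = ≡.refl
      run-++ y (d ∷ ds) es = run-++ (next y d) ds es

      number : List ℕ → ℕ
      number []       = 0
      number (d ∷ ds) = number ds ℕ.* p ℕ.+ d

      number-< : ∀ {ds} → All (_< p) ds → number ds < p ^ length ds
      number-< []                = s≤s z≤n
      number-< {d ∷ ds} (b ∷ bs) = ℕ.<-≤-trans (ℕ.+-monoʳ-< (number ds ℕ.* p) b)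
        (≡.subst₂ _≤_ (ℕ.+-comm p (number ds ℕ.* p)) (ℕ.*-comm (p ^ length ds) p) (ℕ.*-monoˡ-≤ p (number-< bs)))

      run-value : ∀ y {ds} → All (_< p) ds → ∀ n → value (run y ds) n ≈ value y (n ℕ.* p ^ length ds ℕ.+ number ds)
      run-value y []                n = reflexive (≡.cong (value y) (≡.sym (≡.trans (ℕ.+-identityʳ (n ℕ.* 1)) (ℕ.*-identityʳ n))))
      run-value y {d ∷ ds} (b ∷ bs) n = trans (run-value (next y d) bs n)
        (trans (value-next y b (n ℕ.* p ^ length ds ℕ.+ number ds)) (reflexive (≡.cong (value y) (arith n p (p ^ length ds) (number ds) d))))
        where
        arith : ∀ n p P k d → (n ℕ.* P ℕ.+ k) ℕ.* p ℕ.+ d ≡ n ℕ.* (p ℕ.* P) ℕ.+ (k ℕ.* p ℕ.+ d)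
        arith = solve-∀

      digits : ∀ i j → j < p ^ i → ∃[ ds ] All (_< p) ds × length ds ≡ i × number ds ≡ j
      digits zero    zero    _  = [] , [] , ≡.refl , ≡.refl
      digits zero    (suc j) (s≤s ())
      digits (suc i) j       j< =
        let (ds , b , len , num) = digits i (j / p) (m<n*o⇒m/o<n (≡.subst (j <_) (ℕ.*-comm p (p ^ i)) j<)) in
        j % p ∷ ds , m%n<n j p ∷ b , ≡.cong suc len ,
        ≡.trans (≡.cong (λ k → k ℕ.* p ℕ.+ j % p) num) (≡.trans (ℕ.+-comm (j / p ℕ.* p) (j % p)) (≡.sym (m≡m%n+[m/n]*n j p)))

      -- By the pigeonhole principle two prefixes lead to states of the same code;
      -- delete the digits in between.
      shorten : ∀ y ds → All (_< p) ds → size < length ds →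
        ∃[ es ] All (_< p) es × length es < length ds × (∀ n → value (run y ds) n ≈ value (run y es) n)
      shorten y ds bs N<len with Fin.pigeonhole (ℕ.n<1+n size) (λ k → code (run y (List.take (toℕ k) ds)))
      ... | k , l , k<l , same = es , All.++⁺ (All.take⁺ k' bs) (All.drop⁺ l' bs) , shorter , equal
        where
        k' = toℕ k
        l' = toℕ l
        es = List.take k' ds ++ List.drop l' ds
        b≤len : l' ≤ length ds
        b≤len = ℕ.≤-trans (ℕ.s≤s⁻¹ (Fin.toℕ<n l)) (ℕ.<⇒≤ N<len)
        shorter : length es < length ds
        shorter = ≡.subst (_< length ds) (≡.sym (≡.trans (List.length-++ (List.take k' ds))
            (≡.cong₂ ℕ._+_ (≡.trans (List.length-take k' ds) (ℕ.m≤n⇒m⊓n≡m (ℕ.≤-trans (ℕ.<⇒≤ k<l) b≤len))) (List.length-drop l' ds))))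
          (≡.subst (k' ℕ.+ (length ds ∸ l') <_) (ℕ.m+[n∸m]≡n b≤len) (ℕ.+-monoˡ-< (length ds ∸ l') k<l))
        equal : ∀ n → value (run y ds) n ≈ value (run y es) n
        equal n = trans (reflexive (≡.cong (λ y → value y n)
            (≡.trans (≡.cong (run y) (≡.sym (List.take++drop≡id l' ds))) (run-++ y (List.take l' ds) (List.drop l' ds)))))
          (trans (run-value (run y (List.take l' ds)) (All.drop⁺ l' bs) n)
          (trans (sym (code-value same _))
          (trans (sym (run-value (run y (List.take k' ds)) (All.drop⁺ l' bs) n))
          (reflexive (≡.cong (λ y → value y n) (≡.sym (run-++ y (List.take k' ds) (List.drop l' ds))))))))

      short : ∀ y ds → Acc _<_ (length ds) → All (_< p) ds →
        ∃[ es ] All (_< p) es × length es ≤ size × (∀ n → value (run y ds) n ≈ value (run y es) n)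
      short y ds (acc rec) bs with length ds ℕ.≤? size
      ... | yes len≤ = ds , bs , len≤ , λ n → refl
      ... | no  len≰ =
        let (es , bs' , lt , eq)     = shorten y ds bs (ℕ.≰⇒> len≰)
            (fs , bs″ , len≤ , eq')  = short y es (rec lt) bs'
        in fs , bs″ , len≤ , λ n → trans (eq n) (eq' n)

      indices : ℕ → List (Σ[ i ∈ ℕ ] Fin (p ^ i))
      indices zero    = map (0 ,_) (allFin (p ^ 0))
      indices (suc n) = map (suc n ,_) (allFin (p ^ suc n)) ++ indices n

      ∈indices : ∀ {n i} → i ≤ n → ∀ j → Any ((i , j) ≡_) (indices n)
      ∈indices {zero}  {zero}  z≤n j = Any.map⁺ (Any.map (≡.cong (0 ,_)) (Membership≡.∈-allFin j))
      ∈indices {suc n} {i}     i≤  j with ℕ.m≤n⇒m<n∨m≡n i≤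
      ... | inj₁ (s≤s i≤n) = Any.++⁺ʳ _ (∈indices i≤n j)
      ... | inj₂ ≡.refl    = Any.++⁺ˡ (Any.map⁺ (Any.map (≡.cong (suc n ,_)) (Membership≡.∈-allFin j)))

    -- Each kernel sequence is the value after running some digit word, and `short` replaces the
    -- word by one of length at most `size`; only finitely many indices remain. Codes are compared
    -- and not states, because a state may carry proofs.
    automaton⇒automatic : ∀ y (f : ℕ → Carrier) → (∀ n → f n ≈ value y n) → IsAutomatic X p f
    automaton⇒automatic y f f≈ = indices size , λ { (i , j) → enumerates i j }
      where
      enumerates : ∀ i j → Any (λ κ → ∀ n → kernelSequence X p f (i , j) n ≈ kernelSequence X p f κ n) (indices size)
      enumerates i j =
        let (ds , bs , len , num)  = digits i (toℕ j) (Fin.toℕ<n j)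
            (es , bs' , len≤ , eq) = short y ds (<-wellFounded _) bs
        in Any.map (λ { ≡.refl n →
             trans (f≈ (n ℕ.* p ^ i ℕ.+ toℕ j))
             (trans (reflexive (≡.cong (value y) (≡.cong₂ (λ i j → n ℕ.* p ^ i ℕ.+ j) (≡.sym len) (≡.sym num))))
             (trans (sym (run-value y bs n))
             (trans (eq n)
             (trans (run-value y bs' n)
             (trans (reflexive (≡.cong (λ j → value y (n ℕ.* p ^ length es ℕ.+ j)) (≡.sym (Fin.toℕ-fromℕ< (number-< bs')))))
             (sym (f≈ _))))))) })
             (∈indices len≤ (fromℕ< (number-< bs')))

  -- An automaton reading m digits at a time is turned into one that reads
  -- single digits by storing the digits of the current block.
  module _ {p m s} .{{_ : NonZero p}} .{{_ : NonZero m}} (M : Automaton (p ^ m) s) where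
    open Automaton M

    private
      record Block : Set s where
        constructor block
        field
          state   : State
          {place} : ℕ
          place<m : place < m
          {digit} : ℕ
          digit<  : digit < p ^ place

      0<m : 0 < m
      0<m = ℕ.>-nonZero⁻¹ m

      valueᵇ : Block → ℕ → Carrier
      valueᵇ (block y {b} _ {j} _) n = value y (n ℕ.* p ^ b ℕ.+ j)

      nextᵇ : Block → ℕ → Block
      nextᵇ x@(block y {b} b<m {j} j<) d with d ℕ.<? p | suc b ℕ.<? m
      ... | no  _   | _       = x
      ... | yes d<p | yes b<  = block y b< {d ℕ.* p ^ b ℕ.+ j}
        (ℕ.<-≤-trans (ℕ.+-monoʳ-< (d ℕ.* p ^ b) j<) (≡.subst (_≤ p ^ suc b) (ℕ.+-comm (p ^ b) (d ℕ.* p ^ b)) (ℕ.*-monoˡ-≤ (p ^ b) d<p)))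
      ... | yes d<p | no  _   = block (next y (d ℕ.* p ^ b ℕ.+ j)) 0<m {0} (s≤s z≤n)

      arith : ∀ n p P d j → (n ℕ.* p ℕ.+ d) ℕ.* P ℕ.+ j ≡ n ℕ.* (p ℕ.* P) ℕ.+ (d ℕ.* P ℕ.+ j)
      arith = solve-∀

      value-nextᵇ : ∀ x {d} → d < p → ∀ n → valueᵇ (nextᵇ x d) n ≈ valueᵇ x (n ℕ.* p ℕ.+ d)
      value-nextᵇ (block y {b} b<m {j} j<) {d} d<p n with d ℕ.<? p | suc b ℕ.<? m
      ... | no ¬d<p | _      = contradiction d<p ¬d<p
      ... | yes _   | yes b< = reflexive (≡.cong (value y) (≡.sym (arith n p (p ^ b) d j)))
      ... | yes _   | no b≮  = trans (reflexive (≡.cong (value _) (≡.trans (ℕ.+-identityʳ (n ℕ.* 1)) (ℕ.*-identityʳ n))))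
        (trans (value-next y (≡.subst (λ b' → d ℕ.* p ^ b ℕ.+ j < p ^ b') 1+b≡m
            (ℕ.<-≤-trans (ℕ.+-monoʳ-< (d ℕ.* p ^ b) j<) (≡.subst (_≤ p ^ suc b) (ℕ.+-comm (p ^ b) (d ℕ.* p ^ b)) (ℕ.*-monoˡ-≤ (p ^ b) d<p)))) n)
          (reflexive (≡.cong (value y) (≡.trans (≡.cong (λ b' → n ℕ.* p ^ b' ℕ.+ (d ℕ.* p ^ b ℕ.+ j)) (≡.sym 1+b≡m)) (≡.sym (arith n p (p ^ b) d j))))))
        where
        1+b≡m : suc b ≡ m
        1+b≡m = ℕ.≤-antisym b<m (ℕ.≮⇒≥ b≮)

      digit<pᵐ : ∀ x → Block.digit x < p ^ m
      digit<pᵐ x = ℕ.<-≤-trans (Block.digit< x) (ℕ.^-monoʳ-≤ p (ℕ.<⇒≤ (Block.place<m x)))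

      place : Block → Fin m
      place x = fromℕ< (Block.place<m x)

      digit : Block → Fin (p ^ m)
      digit x = fromℕ< (digit<pᵐ x)

      codeᵇ : Block → Fin (size ℕ.* (m ℕ.* p ^ m))
      codeᵇ x = Fin.combine (code (Block.state x)) (Fin.combine (place x) (digit x))

      code-valueᵇ : ∀ {x x'} → codeᵇ x ≡ codeᵇ x' → ∀ n → valueᵇ x n ≈ valueᵇ x' n
      code-valueᵇ {x} {x'} eq n
        with same , eq' ← Fin.combine-injective (code (Block.state x)) (Fin.combine (place x) (digit x)) (code (Block.state x')) (Fin.combine (place x') (digit x')) eq
        with eqᵖ , eqᵈ ← Fin.combine-injective (place x) (digit x) (place x') (digit x') eq'
        = trans (code-value same _) (reflexive (≡.cong₂ (λ b j → value (Block.state x') (n ℕ.* p ^ b ℕ.+ j))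
            (Fin.fromℕ<-injective (Block.place x) (Block.place x') (Block.place<m x) (Block.place<m x') eqᵖ)
            (Fin.fromℕ<-injective (Block.digit x) (Block.digit x') (digit<pᵐ x) (digit<pᵐ x') eqᵈ)))

    digitAutomaton : Automaton p s
    digitAutomaton = record
      { State = Block ; next = nextᵇ ; value = valueᵇ ; value-next = value-nextᵇ
      ; code = codeᵇ ; code-value = λ {x} {x'} → code-valueᵇ {x} {x'} }

    blockAutomaton⇒automatic : ∀ y (f : ℕ → Carrier) → (∀ n → f n ≈ value y n) → IsAutomatic X p f
    blockAutomaton⇒automatic y f f≈ = automaton⇒automatic digitAutomaton (block y 0<m {0} (s≤s z≤n)) f
      (λ n → trans (f≈ n) (reflexive (≡.cong (value y) (≡.sym (≡.trans (ℕ.+-identityʳ (n ℕ.* 1)) (ℕ.*-identityʳ n))))))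

-- Algebraicity through spans and through polynomial equations

module PolynomialRelations {a ℓ r} (K : CommutativeRing a ℓ) (𝓡 : CommutativeRing.Carrier K → Set r) (coefficients : IsCoefficientRing K 𝓡) where
  open CommutativeRing K hiding (zero)
  open IsCoefficientRing coefficients
  open LinearAlgebra K 𝓡 coefficients
  open RegularProperties K
  open RingSolver K
  open Membership setoid using (_∈_)
  open Exp commutativeSemiring using () renaming (_^_ to _^′_)
  open ≈-Reasoning setoid

  evaluate : List Carrier → Carrier → Carrier
  evaluate []       y = 0#
  evaluate (b ∷ bs) y = b + y * evaluate bs y

  private
    lowerPowers : Carrier → ℕ → List Carrier
    lowerPowers y zero    = []
    lowerPowers y (suc n) = powers y n

    step : ∀ {y n u} → Span (lowerPowers y n) u → Span (lowerPowers y (suc n)) (y * u)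
    step {y} {n} u∈ = resp (*-comm _ y) (span-elim (preimage-isSubspace (span-isSubspace _) y) (gens n) u∈)
      where
      gens : ∀ n {v} → v ∈ lowerPowers y n → Span (powers y n) (v * y)
      gens (suc n) v∈ = let (i , i≤n , v≈) = ∈powers⇒^ y v∈ in
        resp (trans (*-comm y _) (*-congʳ (sym v≈))) (generator (^∈powers y (s≤s i≤n)))

    record Leading (bs : List Carrier) (y : Carrier) : Set (a ⊔ ℓ ⊔ r) where
      constructor leading
      field
        {degree}  : ℕ
        {c u}     : Carrier
        𝓡c        : 𝓡 c
        c-regular : Regular K c
        lower     : Span (lowerPowers y degree) u
        eq        : evaluate bs y ≈ c * y ^′ degree + u

    evaluate-zero : ∀ {bs y} → All (_≈ 0#) bs → evaluate bs y ≈ 0#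
    evaluate-zero []         = refl
    evaluate-zero (e ∷ es) = trans (+-cong e (trans (*-congˡ (evaluate-zero es)) (zeroʳ _))) (+-identityˡ 0#)

    -- The last entries of `bs` may be zero; `zero?` discards them until a regular leading
    -- coefficient appears.
    leading-term : ∀ {bs} y → All 𝓡 bs → All (_≈ 0#) bs ⊎ Leading bs y
    leading-term y [] = inj₁ []
    leading-term {b ∷ bs} y (𝓡b ∷ 𝓡bs) with leading-term y 𝓡bs
    ... | inj₂ (leading {n} {c} {u} 𝓡c reg u∈ eq) = inj₂ (leading {degree = suc n} 𝓡c reg
        (add (scale 𝓡b (generator (^∈powers y {0} z≤n))) (step u∈)) (begin
      b + y * evaluate bs y ≈⟨ +-congˡ (*-congˡ eq) ⟩
      b + y * (c * y ^′ n + u) ≈⟨ solve 5 (λ b y c q u → b :+ y :* (c :* q :+ u) := c :* (y :* q) :+ (b :* con (+ 1) :+ y :* u)) refl b y c (y ^′ n) u ⟩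
      c * (y * y ^′ n) + (b * 1# + y * u) ∎))
    ... | inj₁ bs≈0 with zero? 𝓡b
    ... | inj₁ b≈0 = inj₁ (b≈0 ∷ bs≈0)
    ... | inj₂ reg = inj₂ (leading {degree = 0} 𝓡b reg null
        (+-cong (sym (*-identityʳ b)) (trans (*-congˡ (evaluate-zero bs≈0)) (zeroʳ y))))

    trivial : ∀ {x} → Regular K x → x ≈ 0# → ∀ y → y ≈ 0#
    trivial reg x≈0 y = reg y (trans (*-congʳ x≈0) (zeroˡ y))

    any-regular : ∀ {bs} → Any (Regular K) bs → All (_≈ 0#) bs → ∀ y → y ≈ 0#
    any-regular (here reg)  (e ∷ _)  = trivial reg e
    any-regular (there any) (_ ∷ es) = any-regular any es

  relation⇒algebraic : ∀ {bs y} → All 𝓡 bs → Any (Regular K) bs → evaluate bs y ≈ 0# → Algebraic y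
  relation⇒algebraic {bs} {y} 𝓡bs any eval≈0 with leading-term y 𝓡bs
  -- All coefficients vanish although one is regular, so `K` is the zero ring.
  ... | inj₁ bs≈0 = 0 , resp (sym (any-regular any bs≈0 _)) null
  ... | inj₂ (leading {zero} {c} {u} 𝓡c reg u∈ eq) = 0 , resp (sym (trivial reg (begin
      c ≈⟨ *-identityʳ c ⟨
      c * 1# ≈⟨ +-identityʳ _ ⟨
      c * 1# + 0# ≈⟨ +-congˡ (span-[] u∈) ⟨
      c * 1# + u ≈⟨ eq ⟨
      evaluate bs y ≈⟨ eval≈0 ⟩
      0#            ∎) _)) null
  ... | inj₂ (leading {suc n} {c} {u} 𝓡c reg u∈ eq) = n , saturate 𝓡c reg (resp (begin
      - u ≈⟨ solve 2 (λ x u → :- u := x :- (x :+ u)) refl (c * y ^′ suc n) u ⟩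
      c * y ^′ suc n - (c * y ^′ suc n + u) ≈⟨ +-congˡ (-‿cong (trans (sym eq) eval≈0)) ⟩
      c * y ^′ suc n - 0# ≈⟨ solve 1 (λ x → x :- con (+ 0) := x) refl _ ⟩
      c * y ^′ suc n              ∎) (span-negate u∈))

  private
    evaluate-+ : ∀ n (f g : ℕ → Carrier) y → evaluate (applyUpTo (λ i → f i + g i) n) y ≈ evaluate (applyUpTo f n) y + evaluate (applyUpTo g n) y
    evaluate-+ zero    f g y = sym (+-identityˡ 0#)
    evaluate-+ (suc n) f g y = trans (+-congˡ (*-congˡ (evaluate-+ n (f ∘ suc) (g ∘ suc) y)))
      (solve 5 (λ a b y s t → (a :+ b) :+ y :* (s :+ t) := (a :+ y :* s) :+ (b :+ y :* t)) refl (f 0) (g 0) y _ _)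

    evaluate-* : ∀ n d (f : ℕ → Carrier) y → evaluate (applyUpTo (λ i → d * f i) n) y ≈ d * evaluate (applyUpTo f n) y
    evaluate-* zero    d f y = sym (zeroʳ d)
    evaluate-* (suc n) d f y = trans (+-congˡ (*-congˡ (evaluate-* n d (f ∘ suc) y)))
      (solve 4 (λ d a y s → d :* a :+ y :* (d :* s) := d :* (a :+ y :* s)) refl d (f 0) y _)

    evaluate-zeros : ∀ n y → evaluate (applyUpTo (λ _ → 0#) n) y ≈ 0#
    evaluate-zeros n y = evaluate-zero (All.applyUpTo⁺₂ (λ _ → 0#) n (λ _ → refl))

    evaluate-snoc : ∀ n (f : ℕ → Carrier) y → evaluate (applyUpTo f (suc n)) y ≈ evaluate (applyUpTo f n) y + f n * y ^′ n
    evaluate-snoc zero    f y = solve 2 (λ a y → a :+ y :* con (+ 0) := con (+ 0) :+ a :* con (+ 1)) refl (f 0) y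
    evaluate-snoc (suc n) f y = trans (+-congˡ (*-congˡ (evaluate-snoc n (f ∘ suc) y)))
      (solve 5 (λ a y s b q → a :+ y :* (s :+ b :* q) := (a :+ y :* s) :+ b :* (y :* q)) refl (f 0) y _ (f (suc n)) (y ^′ n))

    delta : ℕ → ℕ → Carrier
    delta zero    zero    = 1#
    delta zero    (suc j) = 0#
    delta (suc i) zero    = 0#
    delta (suc i) (suc j) = delta i j

    delta-𝓡 : ∀ i j → 𝓡 (delta i j)
    delta-𝓡 zero    zero    = 𝓡-1
    delta-𝓡 zero    (suc j) = 𝓡-0
    delta-𝓡 (suc i) zero    = 𝓡-0
    delta-𝓡 (suc i) (suc j) = delta-𝓡 i j

    evaluate-delta : ∀ {i n} y → i < n → evaluate (applyUpTo (delta i) n) y ≈ y ^′ i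
    evaluate-delta {zero}  {suc n} y _         = trans (+-congˡ (trans (*-congˡ (evaluate-zeros n y)) (zeroʳ y))) (+-identityʳ 1#)
    evaluate-delta {suc i} {suc n} y (s≤s i<n) = trans (+-identityˡ _) (*-congˡ (evaluate-delta y i<n))

    -- An inductively generated span does not exhibit its coefficients. Carrying them along the
    -- derivation, over a common denominator `g`, recovers an explicit polynomial.
    record Combination (y : Carrier) (n : ℕ) (x : Carrier) : Set (a ⊔ ℓ ⊔ r) where
      constructor combination
      field
        {g}       : Carrier
        𝓡g        : 𝓡 g
        g-regular : Regular K g
        {f}       : ℕ → Carrier
        𝓡f        : ∀ i → 𝓡 (f i)
        eq        : g * x ≈ evaluate (applyUpTo f n) y

    span⇒combination : ∀ {y n x} → Span (powers y n) x → Combination y (suc n) x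
    span⇒combination {y} {n} = span-elim {N = Combination y (suc n)} (record
      { resp     = λ { e (combination 𝓡g reg 𝓡f eq) → combination 𝓡g reg 𝓡f (trans (*-congˡ (sym e)) eq) }
      ; null     = combination 𝓡-1 regular-1 (λ _ → 𝓡-0) (trans (zeroʳ 1#) (sym (evaluate-zeros (suc n) y)))
      ; add      = λ { {x} {x'} (combination {g} 𝓡g reg {f} 𝓡f eq) (combination {g'} 𝓡g' reg' {f'} 𝓡f' eq') →
          combination (𝓡-* 𝓡g 𝓡g') (regular-* reg reg') (λ i → 𝓡-+ (𝓡-* 𝓡g' (𝓡f i)) (𝓡-* 𝓡g (𝓡f' i))) (begin
            g * g' * (x + x') ≈⟨ solve 4 (λ g g' x y → g :* g' :* (x :+ y) := g' :* (g :* x) :+ g :* (g' :* y)) refl g g' x x' ⟩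
            g' * (g * x) + g * (g' * x') ≈⟨ +-cong (*-congˡ eq) (*-congˡ eq') ⟩
            g' * evaluate (applyUpTo f (suc n)) y + g * evaluate (applyUpTo f' (suc n)) y
              ≈⟨ +-cong (evaluate-* (suc n) g' f y) (evaluate-* (suc n) g f' y) ⟨
            evaluate (applyUpTo (λ i → g' * f i) (suc n)) y + evaluate (applyUpTo (λ i → g * f' i) (suc n)) y
              ≈⟨ evaluate-+ (suc n) (λ i → g' * f i) (λ i → g * f' i) y ⟨
            evaluate (applyUpTo (λ i → g' * f i + g * f' i) (suc n)) y ∎) }
      ; scale    = λ { {d} {x} 𝓡d (combination {g} 𝓡g reg {f} 𝓡f eq) →
          combination 𝓡g reg (λ i → 𝓡-* 𝓡d (𝓡f i)) (begin
            g * (d * x) ≈⟨ solve 3 (λ g d x → g :* (d :* x) := d :* (g :* x)) refl g d x ⟩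
            d * (g * x) ≈⟨ *-congˡ eq ⟩
            d * evaluate (applyUpTo f (suc n)) y ≈⟨ evaluate-* (suc n) d f y ⟨
            evaluate (applyUpTo (λ i → d * f i) (suc n)) y ∎) }
      ; saturate = λ { {h} {x} 𝓡h s (combination {g} 𝓡g reg 𝓡f eq) →
          combination (𝓡-* 𝓡g 𝓡h) (regular-* reg s) 𝓡f (trans (*-assoc g h x) eq) }
      }) λ v∈ → let (i , i≤n , v≈) = ∈powers⇒^ y v∈ in
        combination 𝓡-1 regular-1 (delta-𝓡 i) (trans (*-identityˡ _) (trans v≈ (sym (evaluate-delta y (s≤s i≤n)))))

  algebraic⇒relation : ∀ {y} → Algebraic y → ∃[ bs ] All 𝓡 bs × Any (Regular K) bs × evaluate bs y ≈ 0#
  algebraic⇒relation {y} (n , y∈) with span⇒combination y∈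
  ... | combination {g} 𝓡g reg {f} 𝓡f eq = applyUpTo h (suc (suc n)) , All.applyUpTo⁺₂ h (suc (suc n)) 𝓡h ,
    Any.applyUpTo⁺ h h-regular ℕ.≤-refl , (begin
      evaluate (applyUpTo h (suc (suc n))) y ≈⟨ evaluate-snoc (suc n) h y ⟩
      evaluate (applyUpTo h (suc n)) y + h (suc n) * y ^′ suc n ≈⟨ +-cong (low (suc n) f (λ i i<n → h-low (ℕ.<⇒≢ i<n))) (trans (*-congʳ h-top) eq) ⟩
      - evaluate (applyUpTo f (suc n)) y + evaluate (applyUpTo f (suc n)) y ≈⟨ -‿inverseˡ _ ⟩
      0#                                                               ∎)
    where
    -- The coefficients of g y^(n+1) - Σ f(i) y^i; the top one, `g`, is regular, so the relation is
    -- nontrivial.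
    h : ℕ → Carrier
    h i with i ℕ.≟ suc n
    ... | yes _ = g
    ... | no  _ = - f i
    𝓡h : ∀ i → 𝓡 (h i)
    𝓡h i with i ℕ.≟ suc n
    ... | yes _ = 𝓡g
    ... | no  _ = 𝓡-neg (𝓡f i)
    h-top : h (suc n) ≈ g
    h-top with suc n ℕ.≟ suc n
    ... | yes _ = refl
    ... | no ¬e = contradiction ≡.refl ¬e
    h-regular : Regular K (h (suc n))
    h-regular = regular-resp (sym h-top) reg
    h-low : ∀ {i} → ¬ (i ≡ suc n) → h i ≈ - f i
    h-low {i} i≢ with i ℕ.≟ suc n
    ... | yes e = contradiction e i≢
    ... | no  _ = refl
    low : ∀ m {h : ℕ → Carrier} (f : ℕ → Carrier) → (∀ i → i < m → h i ≈ - f i) → evaluate (applyUpTo h m) y ≈ - evaluate (applyUpTo f m) y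
    low zero    f e = solve 0 (con (+ 0) := :- con (+ 0)) refl
    low (suc m) f e = trans (+-cong (e 0 (s≤s z≤n)) (*-congˡ (low m (f ∘ suc) (λ i i<m → e (suc i) (s≤s i<m)))))
      (solve 3 (λ a y s → :- a :+ y :* (:- s) := :- (a :+ y :* s)) refl (f 0) y _)

-- Coefficient indices and ring homomorphisms

data Position (M : ℕ) : ℤ → Set where
  above : ∀ k → Position M (k ⊖ M)
  below : ∀ n → n ℤ.+ + M ℤ.< 0ℤ → Position M n

position : ∀ M n → Position M n
position M n with n ℤ.+ + M in eq
... | + k      = ≡.subst (Position M) k⊖M≡n (above k)
  where
  cancel : ∀ n m → (n ℤ.+ m) ℤ.- m ≡ n
  cancel = solve-∀ᶻ
  k⊖M≡n : k ⊖ M ≡ n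
  k⊖M≡n = ≡.trans (≡.sym (ℤ.[+m]-[+n]≡m⊖n k M)) (≡.trans (≡.cong (ℤ._- + M) (≡.sym eq)) (cancel n (+ M)))
... | -[1+ j ] = below n (≡.subst (ℤ._< 0ℤ) (≡.sym eq) -<+)

⊖-+ : ∀ k e m → (k ⊖ (e ℕ.+ m)) ℤ.+ + m ≡ k ⊖ e
⊖-+ k e m = ≡.trans (ℤ.distribˡ-⊖-+-pos m k (e ℕ.+ m))
  (≡.trans (≡.cong₂ _⊖_ (ℕ.+-comm k m) (ℕ.+-comm e m)) (ℤ.+-cancelˡ-⊖ m k e))

⊖-+-self : ∀ k m → (k ⊖ m) ℤ.+ + m ≡ + k
⊖-+-self k m = ⊖-+ k 0 m

record IsHomomorphism {a b ℓ₁ ℓ₂} (A : CommutativeRing a ℓ₁) (B : CommutativeRing b ℓ₂)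
                      (φ : CommutativeRing.Carrier A → CommutativeRing.Carrier B) : Set (a ⊔ ℓ₁ ⊔ ℓ₂) where
  private
    module A = CommutativeRing A
    module B = CommutativeRing B
  open Exp A.commutativeSemiring using () renaming (_^_ to _^A_)
  open Exp B.commutativeSemiring using () renaming (_^_ to _^B_)
  open Mult× A.semiring using () renaming (_×_ to _·A_)
  open Mult× B.semiring using () renaming (_×_ to _·B_)
  field
    φ-cong : ∀ {x y} → x A.≈ y → φ x B.≈ φ y
    φ-1    : φ A.1# B.≈ B.1#
    φ-+    : ∀ x y → φ (x A.+ y) B.≈ φ x B.+ φ y
    φ-*    : ∀ x y → φ (x A.* y) B.≈ φ x B.* φ y

  open RingSolver B

  φ-0 : φ A.0# B.≈ B.0#
  φ-0 = begin
    φ A.0# ≈⟨ solve 1 (λ x → x := (x :+ x) :- x) B.refl (φ A.0#) ⟩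
    (φ A.0# B.+ φ A.0#) B.- φ A.0# ≈⟨ B.+-congʳ (φ-+ A.0# A.0#) ⟨
    φ (A.0# A.+ A.0#) B.- φ A.0# ≈⟨ B.+-congʳ (φ-cong (A.+-identityˡ A.0#)) ⟩
    φ A.0# B.- φ A.0# ≈⟨ B.-‿inverseʳ _ ⟩
    B.0#                                ∎
    where
    open ≈-Reasoning B.setoid

  φ-neg : ∀ x → φ (A.- x) B.≈ B.- φ x
  φ-neg x = begin
    φ (A.- x) ≈⟨ solve 2 (λ x y → y := (y :+ x) :- x) B.refl (φ x) (φ (A.- x)) ⟩
    (φ (A.- x) B.+ φ x) B.- φ x ≈⟨ B.+-congʳ (B.trans (B.sym (φ-+ (A.- x) x)) (B.trans (φ-cong (A.-‿inverseˡ x)) φ-0)) ⟩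
    B.0# B.- φ x ≈⟨ B.+-identityˡ _ ⟩
    B.- φ x                          ∎
    where
    open ≈-Reasoning B.setoid

  φ-^ : ∀ x n → φ (x ^A n) B.≈ φ x ^B n
  φ-^ x zero    = φ-1
  φ-^ x (suc n) = B.trans (φ-* x (x ^A n)) (B.*-congˡ (φ-^ x n))

  open FiniteSum A using () renaming (sumTo to sumToA)
  open FiniteSum B using () renaming (sumTo to sumToB)

  φ-sum : ∀ n f → φ (sumToA n f) B.≈ sumToB n (λ i → φ (f i))
  φ-sum zero    f = φ-0
  φ-sum (suc n) f = B.trans (φ-+ (sumToA n f) (f n)) (B.+-congʳ (φ-sum n f))

  φ-· : ∀ n x → φ (n ·A x) B.≈ n ·B φ x
  φ-· zero    x = φ-0
  φ-· (suc n) x = B.trans (φ-+ x (n ·A x)) (B.+-congˡ (φ-· n x))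

id-homomorphism : ∀ {a ℓ} (A : CommutativeRing a ℓ) → IsHomomorphism A A id
id-homomorphism A = record { φ-cong = id ; φ-1 = refl ; φ-+ = λ _ _ → refl ; φ-* = λ _ _ → refl }
  where open CommutativeRing A

∘-homomorphism : ∀ {a b c ℓ₁ ℓ₂ ℓ₃} {A : CommutativeRing a ℓ₁} {B : CommutativeRing b ℓ₂} {D : CommutativeRing c ℓ₃}
                 {ψ φ} → IsHomomorphism B D ψ → IsHomomorphism A B φ → IsHomomorphism A D (ψ ∘ φ)
∘-homomorphism {D = D} {φ = φ} G H = record
  { φ-cong = λ e → G.φ-cong (H.φ-cong e)
  ; φ-1    = trans (G.φ-cong H.φ-1) G.φ-1
  ; φ-+    = λ x y → trans (G.φ-cong (H.φ-+ x y)) (G.φ-+ (φ x) (φ y))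
  ; φ-*    = λ x y → trans (G.φ-cong (H.φ-* x y)) (G.φ-* (φ x) (φ y))
  }
  where
  open CommutativeRing D
  module G = IsHomomorphism G
  module H = IsHomomorphism H

i+j<0⇒i<-j : ∀ i j → i ℤ.+ j ℤ.< 0ℤ → i ℤ.< ℤ.- j
i+j<0⇒i<-j i j lt = ≡.subst₂ ℤ._<_ (cancel i j) (ℤ.+-identityˡ (ℤ.- j)) (ℤ.+-monoˡ-< (ℤ.- j) lt)
  where
  cancel : ∀ i j → (i ℤ.+ j) ℤ.- j ≡ i
  cancel = solve-∀ᶻ

automatic-cong : ∀ {a ℓ} (X : Setoid a ℓ) {p} {f g : ℕ → Setoid.Carrier X} → (∀ n → Setoid._≈_ X (f n) (g n)) →
                 IsAutomatic X p f → IsAutomatic X p g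
automatic-cong X f≈g (κs , enumerates) = κs , λ κ →
  Any.map (λ eq n → Setoid.trans X (Setoid.sym X (f≈g _)) (Setoid.trans X (eq n) (f≈g _))) (enumerates κ)

module FormalSeries {c ℓ} {p q k : ℕ} (pr : Prime p) (q≡pᵏ : q ≡ p ^ k) (F : FiniteField c ℓ q) where
  module F = FiniteField F
  module 𝔽 = FiniteFieldProperties {k = k} pr q≡pᵏ F
  module L = LaurentSeries F
  module ≈F = ≈-Reasoning F.setoid
  open PowerSeries F.commutativeRing
  module S = CommutativeRing seriesRing
  module SExp = Exp S.commutativeSemiring
  open SExp using () renaming (_^_ to _^S_)
  module SR = RingSolver seriesRing

  -- Frobenius powers and sections of power series over 𝔽_q

  module SeriesFrobenius where
    open S hiding (zero)
    open SExp using (^-distrib-*; ^-congˡ) renaming (_^_ to _^′_)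
    open Approximation
    open Mult× semiring using () renaming (_×_ to _·_)
    open Mult× F.semiring using () renaming (_×_ to _·F_)
    open Exp F.commutativeSemiring using () renaming (_^_ to _^F_)
    open SR
    open ≈-Reasoning setoid

    -- x ↦ x^Q is the identity on 𝔽_q; unlike for x ↦ x^q, this does not
    -- require the group theory of the multiplicative group.
    Q : ℕ
    Q = p ^ (q !)

    2≤p : 2 ≤ p
    2≤p = ℕ.nonTrivial⇒n>1 p {{prime⇒nonTrivial pr}}

    private
      2≤p^ : ∀ n → 0 < n → 2 ≤ p ^ n
      2≤p^ (suc n) _ = ℕ.≤-trans 2≤p (ℕ.m≤m*n p (p ^ n) {{ℕ.m^n≢0 p n {{prime⇒nonZero pr}}}})

    2≤Q : 2 ≤ Q
    2≤Q = 2≤p^ (q !) (ℕ.1≤n! q)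

    0<Q : 0 < Q
    0<Q = ℕ.<⇒≤ 2≤Q

    ·-coefficient : ∀ m u n → (m · u) n F.≈ m ·F (u n)
    ·-coefficient zero    u n = F.refl
    ·-coefficient (suc m) u n = F.+-congˡ (·-coefficient m u n)

    series-characteristic : p · 1# ≈ 0#
    series-characteristic zero    = F.trans (·-coefficient p 1# 0) 𝔽.characteristic
    series-characteristic (suc n) = F.trans (·-coefficient p 1# (suc n)) (×-0 p)
      where
      ×-0 : ∀ m → m ·F F.0# F.≈ F.0#
      ×-0 zero    = F.refl
      ×-0 (suc m) = F.trans (F.+-identityˡ _) (×-0 m)

    open Frobenius seriesRing pr series-characteristic

    const-^ : ∀ a n → const a ^′ n ≈ const (a ^F n)
    const-^ a zero    = refl
    const-^ a (suc n) = trans (*-congˡ (const-^ a n)) (sym (const-* a (a ^F n)))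

    -- Since the Q-th power fixes constants, u^Q is u(X^Q); in this form the fact can be used in
    -- recursions on `tail`.
    frobenius-step : ∀ u → u ^′ Q ≈ const (u 0) + X ^′ Q * tail u ^′ Q
    frobenius-step u = begin
      u ^′ Q ≈⟨ ^-congˡ Q (head-tail u) ⟩
      (const (u 0) + X * tail u) ^′ Q ≈⟨ frobenius-+ (q !) (const (u 0)) (X * tail u) ⟩
      const (u 0) ^′ Q + (X * tail u) ^′ Q ≈⟨ +-cong (trans (const-^ (u 0) Q) (const-cong (𝔽.frobenius-fixed (u 0)))) (^-distrib-* X (tail u) Q) ⟩
      const (u 0) + X ^′ Q * tail u ^′ Q         ∎

    X^*-coefficient : ∀ m u n → (X ^′ m * u) (m ℕ.+ n) F.≈ u n
    X^*-coefficient zero    u n = *-identityˡ u n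
    X^*-coefficient (suc m) u n = F.trans (*-assoc X (X ^′ m) u (suc (m ℕ.+ n)))
      (F.trans (X*-shift (X ^′ m * u) (suc (m ℕ.+ n))) (X^*-coefficient m u n))

    X^*-low : ∀ m u n → n < m → (X ^′ m * u) n F.≈ F.0#
    X^*-low (suc m) u zero    _         = F.trans (*-assoc X (X ^′ m) u 0) (X*-shift (X ^′ m * u) 0)
    X^*-low (suc m) u (suc n) (s≤s n<m) = F.trans (*-assoc X (X ^′ m) u (suc n))
      (F.trans (X*-shift (X ^′ m * u) (suc n)) (X^*-low m u n n<m))

    X^*-≈[] : ∀ {N u v} m → 0 < m → u ≈[ N ] v → (X ^′ m * u) ≈[ suc N ] (X ^′ m * v)
    X^*-≈[] {N} {u} {v} (suc m) _ e = ≈[]-trans (≈⇒≈[] (*-assoc X (X ^′ m) u))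
      (≈[]-trans (X*-≈[] (*-≈[] (X ^′ m) e)) (≈⇒≈[] (sym (*-assoc X (X ^′ m) v))))

    Λ : Series → Series
    Λ u n = u (n ℕ.* Q)

    Λ-X^Q : ∀ u → Λ (X ^′ Q * u) ≈ X * Λ u
    Λ-X^Q u zero    = F.trans (X^*-low Q u 0 0<Q) (F.sym (X*-shift (Λ u) 0))
    Λ-X^Q u (suc n) = F.trans (X^*-coefficient Q u (n ℕ.* Q)) (F.sym (X*-shift (Λ u) (suc n)))

    -- The projection formula of the Cartier operator. Both sides satisfy the same recursion in `u`,
    -- the left one by `frobenius-step`, so they agree to any precision.
    Λ-frobenius : ∀ u v → Λ (u ^′ Q * v) ≈ u * Λ v
    Λ-frobenius u v = ≈[]⇒≈ (λ N → go N u)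
      where
      go : ∀ N u → Λ (u ^′ Q * v) ≈[ N ] (u * Λ v)
      go zero    u = λ _ ()
      go (suc N) u = ≈[]-trans (≈⇒≈[] (begin
          Λ (u ^′ Q * v) ≈⟨ (λ n → *-congʳ {v} (frobenius-step u) (n ℕ.* Q)) ⟩
          Λ ((const (u 0) + X ^′ Q * tail u ^′ Q) * v) ≈⟨ (λ n → solve 4 (λ a x t v → (a :+ x :* t) :* v := a :* v :+ x :* (t :* v)) refl (const (u 0)) (X ^′ Q) (tail u ^′ Q) v (n ℕ.* Q)) ⟩
          Λ (const (u 0) * v) + Λ (X ^′ Q * (tail u ^′ Q * v)) ≈⟨ +-cong Λ-const (Λ-X^Q (tail u ^′ Q * v)) ⟩
          const (u 0) * Λ v + X * Λ (tail u ^′ Q * v)             ∎))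
        (≈[]-trans (+-≈[] {suc N} {const (u 0) * Λ v} (λ _ _ → F.refl) (X*-≈[] (go N (tail u))))
        (≈⇒≈[] (sym (*-head-tail u (Λ v)))))
        where
        Λ-const : Λ (const (u 0) * v) ≈ const (u 0) * Λ v
        Λ-const n = F.trans (const-*-coefficient (u 0) v (n ℕ.* Q)) (F.sym (const-*-coefficient (u 0) (Λ v) n))

    open FiniteSum seriesRing public

    section : ℕ → Series → Series
    section r u n = u (n ℕ.* Q ℕ.+ r)

    private
      discard : ℕ → Series → Series
      discard m u n = u (m ℕ.+ n)

      truncation : ∀ m u → u ≈ sumTo m (λ r → X ^′ r * const (u r)) + X ^′ m * discard m u
      truncation zero    u = sym (trans (+-identityˡ _) (*-identityˡ u))
      truncation (suc m) u = begin
        u ≈⟨ truncation m u ⟩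
        s + X ^′ m * discard m u ≈⟨ +-congˡ (*-congˡ (head-tail (discard m u))) ⟩
        s + X ^′ m * (const (u (m ℕ.+ 0)) + X * tail (discard m u))
          ≈⟨ +-congˡ (*-congˡ (+-cong (const-cong (F.reflexive (≡.cong u (ℕ.+-identityʳ m))))
               (*-congˡ (λ n → F.reflexive (≡.cong u (ℕ.+-suc m n)))))) ⟩
        s + X ^′ m * (const (u m) + X * discard (suc m) u)
          ≈⟨ solve 5 (λ s y a x d → s :+ y :* (a :+ x :* d) := (s :+ y :* a) :+ x :* y :* d) refl s (X ^′ m) (const (u m)) X (discard (suc m) u) ⟩
        (s + X ^′ m * const (u m)) + X * X ^′ m * discard (suc m) u ∎
        where s = sumTo m (λ r → X ^′ r * const (u r))

    -- The constant terms of the sections account for the first Q coefficients; what remains is X^Q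
    -- times the same sum for the series shifted by Q, which gains precision.
    section-decomposition : ∀ u → u ≈ sumTo Q (λ r → X ^′ r * section r u ^′ Q)
    section-decomposition u = ≈[]⇒≈ (λ N → go N u)
      where
      sections : Series → Series
      sections u = sumTo Q (λ r → X ^′ r * section r u ^′ Q)
      section-discard : ∀ u r → tail (section r u) ≈ section r (discard Q u)
      section-discard u r n = F.reflexive (≡.cong u (ℕ.+-assoc Q (n ℕ.* Q) r))
      sections-step : ∀ u → sections u ≈ sumTo Q (λ r → X ^′ r * const (u r)) + X ^′ Q * sections (discard Q u)
      sections-step u = begin
        sections u
          ≈⟨ sumTo-cong Q (λ r _ → begin
               X ^′ r * section r u ^′ Q ≈⟨ *-congˡ (frobenius-step (section r u)) ⟩
               X ^′ r * (const (u r) + X ^′ Q * tail (section r u) ^′ Q) ≈⟨ *-congˡ (+-congˡ (*-congˡ (^-congˡ Q (section-discard u r)))) ⟩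
               X ^′ r * (const (u r) + X ^′ Q * section r (discard Q u) ^′ Q)
                 ≈⟨ solve 4 (λ x a y s → x :* (a :+ y :* s) := x :* a :+ y :* (x :* s)) refl (X ^′ r) (const (u r)) (X ^′ Q) (section r (discard Q u) ^′ Q) ⟩
               X ^′ r * const (u r) + X ^′ Q * (X ^′ r * section r (discard Q u) ^′ Q)       ∎) ⟩
        sumTo Q (λ r → X ^′ r * const (u r) + X ^′ Q * (X ^′ r * section r (discard Q u) ^′ Q))
          ≈⟨ trans (sumTo-+ Q (λ r → X ^′ r * const (u r)) (λ r → X ^′ Q * (X ^′ r * section r (discard Q u) ^′ Q)))
               (+-congˡ (sumTo-* Q (X ^′ Q) (λ r → X ^′ r * section r (discard Q u) ^′ Q))) ⟩
        sumTo Q (λ r → X ^′ r * const (u r)) + X ^′ Q * sections (discard Q u) ∎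
      go : ∀ N u → u ≈[ N ] sections u
      go zero    u = λ _ ()
      go (suc N) u = ≈[]-trans (≈⇒≈[] (truncation Q u)) (≈[]-trans
        (+-≈[] {suc N} {sumTo Q (λ r → X ^′ r * const (u r))} (λ _ _ → F.refl) (X^*-≈[] Q 0<Q (go N (discard Q u))))
        (≈⇒≈[] (sym (sections-step u))))

    polynomial-Λ : ∀ {M N u} → M ≤ N ℕ.* Q → IsPolynomial M u → IsPolynomial N (Λ u)
    polynomial-Λ M≤NQ pol n N≤n = pol (n ℕ.* Q) (ℕ.≤-trans M≤NQ (ℕ.*-monoˡ-≤ Q N≤n))

    unit : ∀ {u} → ¬ (u 0 F.≈ F.0#) → ∃[ v ] u * v ≈ 1#
    unit {u} u0≉0 = let (a , ua≈1) = F.inverse (u 0) u0≉0 in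
      quotient a u 1# , *-quotient ua≈1 1#

    -- The search stops at the lowest nonzero coefficient, so a nonzero polynomial is X^n times a
    -- unit. The form u v = X^n lets regularity be checked on X alone.
    polynomial-zero? : ∀ {N u} → IsPolynomial N u →
      u ≈ 0# ⊎ (∃[ n ] ¬ (u n F.≈ F.0#)) × (∃[ n ] ∃[ v ] u * v ≈ X ^′ n)
    polynomial-zero? {zero}  {u} pol = inj₁ (λ n → pol n z≤n)
    polynomial-zero? {suc N} {u} pol with u 0 𝔽.≟ F.0#
    ... | no u0≉0 = let (v , uv≈1) = unit u0≉0 in inj₂ ((0 , u0≉0) , 0 , v , uv≈1)
    ... | yes u0≈0 with polynomial-zero? {N} {tail u} (λ n N≤n → pol (suc n) (s≤s N≤n))
    ... | inj₁ tu≈0 = inj₁ λ { zero → u0≈0 ; (suc n) → tu≈0 n }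
    ... | inj₂ ((n , un≉0) , m , v , eq) = inj₂ ((suc n , un≉0) , suc m , v , (begin
      u * v ≈⟨ *-head-tail u v ⟩
      const (u 0) * v + X * (tail u * v) ≈⟨ +-cong (*-congʳ (trans (const-cong u0≈0) const-0)) (*-congˡ eq) ⟩
      0# * v + X * X ^′ m ≈⟨ trans (+-congʳ (zeroˡ v)) (+-identityˡ _) ⟩
      X * X ^′ m                              ∎))
      where
      const-0 : const F.0# ≈ 0#
      const-0 zero    = F.refl
      const-0 (suc n) = F.refl

    -- The shift by nQ - n moves the coefficient of index n to the place nQ, which Λ sends back to
    -- n.
    Λ-X^*-coefficient : ∀ u n → Λ (X ^′ (n ℕ.* Q ∸ n) * u) n F.≈ u n
    Λ-X^*-coefficient u n = F.trans
      (F.reflexive (≡.cong (X ^′ (n ℕ.* Q ∸ n) * u) (≡.sym (ℕ.m∸n+n≡m (ℕ.m≤m*n n Q {{ℕ.>-nonZero 0<Q}})))))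
      (X^*-coefficient (n ℕ.* Q ∸ n) u n)

  module SF = SeriesFrobenius
  open SF using (Q; 0<Q; 2≤Q)

  -- The ring of Laurent series

  module LaurentRing where
    open L

    extend-negative : ∀ u {i} → i ℤ.< 0ℤ → extend u i F.≈ F.0#
    extend-negative u { -[1+ _ ]} _ = F.refl
    extend-negative u {+ n} (+<+ ())

    private
      below-≤ : ∀ {m M} n → m ≤ M → n ℤ.+ + M ℤ.< 0ℤ → n ℤ.+ + m ℤ.< 0ℤ
      below-≤ n m≤M n<0 = ℤ.≤-<-trans (ℤ.+-monoʳ-≤ n (ℤ.+≤+ m≤M)) n<0

      coeff-below : ∀ x {M} n → bound x ≤ M → n ℤ.+ + M ℤ.< 0ℤ → coeff x n F.≈ F.0#
      coeff-below x n b≤M n<0 = extend-negative (coefs x) (below-≤ n b≤M n<0)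

    -- The power series z^{-M} x.
    rep : ℕ → Laurent → Series
    rep M x k = coeff x (k ⊖ M)

    private
      coeff-⟨⟩ : ∀ M u k → coeff ⟨ M , u ⟩ (k ⊖ M) ≡ u k
      coeff-⟨⟩ M u k = ≡.cong (extend u) (⊖-+-self k M)

      extend-⊖ : ∀ u e k → extend u (k ⊖ e) F.≈ (X ^S e S.* u) k
      extend-⊖ u e k with ℕ.≤-total e k
      ... | inj₁ e≤k = ≡.subst (λ k → extend u (k ⊖ e) F.≈ (X ^S e S.* u) k) (ℕ.m+[n∸m]≡n e≤k)
        (F.trans (F.reflexive (≡.cong (extend u) (≡.trans (ℤ.⊖-≥ (ℕ.m≤m+n e (k ∸ e))) (≡.cong +_ (ℕ.m+n∸m≡n e (k ∸ e))))))
                 (F.sym (SF.X^*-coefficient e u (k ∸ e))))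
      ... | inj₂ k≤e with ℕ.m≤n⇒m<n∨m≡n k≤e
      ... | inj₁ k<e    = F.trans (extend-negative u (≡.subst (k ⊖ e ℤ.<_) (ℤ.n⊖n≡0 e) (ℤ.⊖-monoˡ-< e k<e)))
                                  (F.sym (SF.X^*-low e u k k<e))
      ... | inj₂ ≡.refl = F.trans (F.reflexive (≡.cong (extend u) (ℤ.n⊖n≡0 k)))
                                  (F.sym (F.trans (F.reflexive (≡.cong (X ^S k S.* u) (≡.sym (ℕ.+-identityʳ k)))) (SF.X^*-coefficient k u 0)))

      rep-shift : ∀ x e → rep (e ℕ.+ bound x) x ≐ X ^S e S.* coefs x
      rep-shift x e k = F.trans (F.reflexive (≡.cong (extend (coefs x)) (⊖-+ k e (bound x)))) (extend-⊖ (coefs x) e k)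

      from-rep : ∀ {x y} M → bound x ≤ M → bound y ≤ M → rep M x ≐ rep M y → x ≈ y
      from-rep {x} {y} M x≤M y≤M e n with position M n
      ... | above k = e k
      ... | below n b = F.trans (coeff-below x n x≤M b) (F.sym (coeff-below y n y≤M b))

    coeff-+ : ∀ x y n → coeff (x + y) n F.≈ coeff x n F.+ coeff y n
    coeff-+ x y n with position (bound x ℕ.⊔ bound y) n
    ... | above k = F.reflexive (coeff-⟨⟩ (bound x ℕ.⊔ bound y) _ k)
    ... | below n b = F.trans (coeff-below (x + y) n ℕ.≤-refl b) (F.sym (F.trans
        (F.+-cong (coeff-below x n (ℕ.m≤m⊔n (bound x) (bound y)) b) (coeff-below y n (ℕ.m≤n⊔m (bound x) (bound y)) b))
        (F.+-identityˡ F.0#)))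

    coeff-neg : ∀ x n → coeff (- x) n F.≈ F.- coeff x n
    coeff-neg x n with n ℤ.+ + bound x
    ... | + k      = F.refl
    ... | -[1+ _ ] = F.sym (AbelianGroupProperties.ε⁻¹≈ε F.+-abelianGroup)

    private
      -- Multiplication by high powers of 1/z turns a product of Laurent series into one of power
      -- series, whatever bounds are chosen; the multiplicative laws are inherited in this way.
      rep-* : ∀ x y a b → rep ((a ℕ.+ bound x) ℕ.+ (b ℕ.+ bound y)) (x * y) ≐ rep (a ℕ.+ bound x) x S.* rep (b ℕ.+ bound y) y
      rep-* x y a b = begin
        rep ((a ℕ.+ bound x) ℕ.+ (b ℕ.+ bound y)) (x * y)      ≡⟨ ≡.cong (λ M → rep M (x * y)) (rearrange a (bound x) b (bound y)) ⟩
        rep ((a ℕ.+ b) ℕ.+ bound (x * y)) (x * y) ≈⟨ rep-shift (x * y) (a ℕ.+ b) ⟩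
        X ^S (a ℕ.+ b) S.* coefs (x * y)                       ≈⟨ S.*-cong (Exp.^-homo-* S.commutativeSemiring X a b)
                                                                    (λ k → F.reflexive (≡.sym (conv-sum (coefs x) (coefs y) k))) ⟩
        (X ^S a S.* X ^S b) S.* (coefs x S.* coefs y) ≈⟨ SR.solve 4 (λ a b x y → (a SR.:* b) SR.:* (x SR.:* y) SR.:= (a SR.:* x) SR.:* (b SR.:* y)) S.refl _ _ _ _ ⟩
        (X ^S a S.* coefs x) S.* (X ^S b S.* coefs y) ≈⟨ S.*-cong (rep-shift x a) (rep-shift y b) ⟨
        rep (a ℕ.+ bound x) x S.* rep (b ℕ.+ bound y) y        ∎
        where
        open ≈-Reasoning S.setoid
        rearrange : ∀ a m b n → (a ℕ.+ m) ℕ.+ (b ℕ.+ n) ≡ (a ℕ.+ b) ℕ.+ (m ℕ.+ n)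
        rearrange a m b n = ≡.trans (ℕ.+-assoc a m (b ℕ.+ n)) (≡.trans (≡.cong (a ℕ.+_) (≡.trans (≡.sym (ℕ.+-assoc m b n))
          (≡.trans (≡.cong (ℕ._+ n) (ℕ.+-comm m b)) (ℕ.+-assoc b m n)))) (≡.sym (ℕ.+-assoc a b (m ℕ.+ n))))

      rep-*≤ : ∀ x y {M N} → bound x ≤ M → bound y ≤ N → rep (M ℕ.+ N) (x * y) ≐ rep M x S.* rep N y
      rep-*≤ x y {M} {N} x≤M y≤N = ≡.subst₂ (λ M N → rep (M ℕ.+ N) (x * y) ≐ rep M x S.* rep N y)
        (ℕ.m∸n+n≡m x≤M) (ℕ.m∸n+n≡m y≤N) (rep-* x y (M ∸ bound x) (N ∸ bound y))

      *-cong′ : ∀ {x x' y y'} → x ≈ x' → y ≈ y' → x * y ≈ x' * y'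
      *-cong′ {x} {x'} {y} {y'} e f = from-rep (M ℕ.+ N) (ℕ.+-mono-≤ x≤ y≤) (ℕ.+-mono-≤ x'≤ y'≤)
        (S.trans (rep-*≤ x y x≤ y≤) (S.trans (S.*-cong (λ k → e (k ⊖ M)) (λ k → f (k ⊖ N))) (S.sym (rep-*≤ x' y' x'≤ y'≤))))
        where
        M = bound x ℕ.+ bound x'
        N = bound y ℕ.+ bound y'
        x≤  = ℕ.m≤m+n (bound x) (bound x')
        x'≤ = ℕ.m≤n+m (bound x') (bound x)
        y≤  = ℕ.m≤m+n (bound y) (bound y')
        y'≤ = ℕ.m≤n+m (bound y') (bound y)

      *-assoc′ : ∀ x y z → (x * y) * z ≈ x * (y * z)
      *-assoc′ x y z = from-rep ((l ℕ.+ m) ℕ.+ n) ℕ.≤-refl (ℕ.≤-reflexive (≡.sym (ℕ.+-assoc l m n)))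
        (S.trans (rep-*≤ (x * y) z ℕ.≤-refl ℕ.≤-refl) (S.trans (S.*-congʳ (rep-*≤ x y ℕ.≤-refl ℕ.≤-refl))
        (S.trans (S.*-assoc (rep l x) (rep m y) (rep n z)) (S.sym (≡.subst (λ M → rep M (x * (y * z)) ≐ rep l x S.* (rep m y S.* rep n z)) (≡.sym (ℕ.+-assoc l m n))
          (S.trans (rep-*≤ x (y * z) ℕ.≤-refl ℕ.≤-refl) (S.*-congˡ {rep l x} (rep-*≤ y z ℕ.≤-refl ℕ.≤-refl))))))))
        where
        l = bound x
        m = bound y
        n = bound z

      *-comm′ : ∀ x y → x * y ≈ y * x
      *-comm′ x y = from-rep (bound x ℕ.+ bound y) ℕ.≤-refl (ℕ.≤-reflexive (ℕ.+-comm (bound y) (bound x)))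
        (S.trans (rep-*≤ x y ℕ.≤-refl ℕ.≤-refl) (S.trans (S.*-comm (rep (bound x) x) (rep (bound y) y))
        (S.sym (≡.subst (λ M → rep M (y * x) ≐ rep (bound y) y S.* rep (bound x) x) (ℕ.+-comm (bound y) (bound x)) (rep-*≤ y x ℕ.≤-refl ℕ.≤-refl)))))

      *-identityˡ′ : ∀ x → 1L * x ≈ x
      *-identityˡ′ x = from-rep (bound x) ℕ.≤-refl ℕ.≤-refl
        (S.trans (rep-*≤ 1L x {0} z≤n ℕ.≤-refl) (S.trans (S.*-congʳ {rep (bound x) x} 1L≐1) (S.*-identityˡ (rep (bound x) x))))
        where
        1L≐1 : rep 0 1L ≐ S.1#
        1L≐1 zero    = F.refl
        1L≐1 (suc k) = F.reflexive (≡.cong (coefs 1L) (ℕ.+-identityʳ (suc k)))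

      distribʳ′ : ∀ z x y → (x + y) * z ≈ x * z + y * z
      distribʳ′ z x y = from-rep (M ℕ.+ N) ℕ.≤-refl (ℕ.⊔-lub (ℕ.+-monoˡ-≤ N x≤) (ℕ.+-monoˡ-≤ N y≤))
        (S.trans (rep-*≤ (x + y) z ℕ.≤-refl ℕ.≤-refl) (S.trans (S.*-congʳ {rep N z} (λ k → coeff-+ x y (k ⊖ M)))
        (S.trans (S.distribʳ (rep N z) (rep M x) (rep M y))
        (S.trans (S.+-cong (S.sym (rep-*≤ x z x≤ ℕ.≤-refl)) (S.sym (rep-*≤ y z y≤ ℕ.≤-refl)))
          (λ k → F.sym (coeff-+ (x * z) (y * z) (k ⊖ (M ℕ.+ N))))))))
        where
        M = bound x ℕ.⊔ bound y
        N = bound z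
        x≤ = ℕ.m≤m⊔n (bound x) (bound y)
        y≤ = ℕ.m≤n⊔m (bound x) (bound y)

      coeff-0 : ∀ n → coeff 0L n F.≈ F.0#
      coeff-0 n with n ℤ.+ + 0
      ... | + zero   = F.refl
      ... | + suc _  = F.refl
      ... | -[1+ _ ] = F.refl

      +-cong′ : ∀ {x x' y y'} → x ≈ x' → y ≈ y' → x + y ≈ x' + y'
      +-cong′ {x} {x'} {y} {y'} e f n = F.trans (coeff-+ x y n) (F.trans (F.+-cong (e n) (f n)) (F.sym (coeff-+ x' y' n)))

      +-comm′ : ∀ x y → x + y ≈ y + x
      +-comm′ x y n = F.trans (coeff-+ x y n) (F.trans (F.+-comm _ _) (F.sym (coeff-+ y x n)))

      +-identityˡ′ : ∀ x → 0L + x ≈ x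
      +-identityˡ′ x n = F.trans (coeff-+ 0L x n) (F.trans (F.+-congʳ (coeff-0 n)) (F.+-identityˡ _))

      +-inverseˡ′ : ∀ x → (- x) + x ≈ 0L
      +-inverseˡ′ x n = F.trans (coeff-+ (- x) x n) (F.trans (F.+-congʳ (coeff-neg x n)) (F.trans (F.-‿inverseˡ _) (F.sym (coeff-0 n))))

      ≈-refl′ : ∀ {x} → x ≈ x
      ≈-refl′ n = F.refl

      ≈-sym′ : ∀ {x y} → x ≈ y → y ≈ x
      ≈-sym′ e n = F.sym (e n)

      ≈-trans′ : ∀ {x y z} → x ≈ y → y ≈ z → x ≈ z
      ≈-trans′ e f n = F.trans (e n) (f n)

    private
      isCommutativeRing : IsCommutativeRing _≈_ _+_ _*_ -_ 0L 1L
      isCommutativeRing = record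
        { isRing = record
          { +-isAbelianGroup = record
            { isGroup = record
              { isMonoid = record
                { isSemigroup = record
                  { isMagma = record
                    { isEquivalence = record
                      { refl  = λ {x} → ≈-refl′ {x}
                      ; sym   = λ {x} {y} → ≈-sym′ {x} {y}
                      ; trans = λ {x} {y} {z} → ≈-trans′ {x} {y} {z}
                      }
                    ; ∙-cong = λ {x} {y} {u} {v} → +-cong′ {x} {y} {u} {v}
                    }
                  ; assoc = λ x y z n → F.trans (coeff-+ (x + y) z n) (F.trans (F.+-congʳ (coeff-+ x y n)) (F.trans (F.+-assoc _ _ _)
                      (F.sym (F.trans (coeff-+ x (y + z) n) (F.+-congˡ (coeff-+ y z n))))))
                  }
                ; identity = +-identityˡ′ , λ x n → F.trans (+-comm′ x 0L n) (+-identityˡ′ x n)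
                }
              ; inverse = +-inverseˡ′ , λ x n → F.trans (+-comm′ x (- x) n) (+-inverseˡ′ x n)
              ; ⁻¹-cong = λ {x} {y} e n → F.trans (coeff-neg x n) (F.trans (F.-‿cong (e n)) (F.sym (coeff-neg y n)))
              }
            ; comm = +-comm′
            }
          ; *-cong = λ {x} {y} {u} {v} → *-cong′ {x} {y} {u} {v}
          ; *-assoc = *-assoc′
          ; *-identity = *-identityˡ′ , λ x n → F.trans (*-comm′ x 1L n) (*-identityˡ′ x n)
          ; distrib = (λ z x y n → F.trans (*-comm′ z (x + y) n) (F.trans (distribʳ′ z x y n)
                        (+-cong′ {x * z} {z * x} {y * z} {z * y} (*-comm′ x z) (*-comm′ y z) n)))
                    , distribʳ′
          }
        ; *-comm = *-comm′
        }

    opaque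
      laurentRing : CommutativeRing c ℓ
      laurentRing = record { isCommutativeRing = isCommutativeRing }

    private
      module K = CommutativeRing laurentRing

    𝕃 : Set c
    𝕃 = K.Carrier

    opaque
      unfolding laurentRing

      -- `𝕃` is a sealed copy of `Laurent`; `⌈_⌉` and `⌊_⌋` are the identity maps across the seal.
      ⌈_⌉ : Laurent → 𝕃
      ⌈ x ⌉ = x

      ⌊_⌋ : 𝕃 → Laurent
      ⌊ x ⌋ = x

      ⌊⌈⌉⌋ : ∀ x → ⌊ ⌈ x ⌉ ⌋ ≡ x
      ⌊⌈⌉⌋ x = ≡.refl

      ⌈⌊⌋⌉ : ∀ x → ⌈ ⌊ x ⌋ ⌉ ≡ x
      ⌈⌊⌋⌉ x = ≡.refl

      ≈ᴷ⇒≈ : ∀ {x y} → x K.≈ y → ⌊ x ⌋ ≈ ⌊ y ⌋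
      ≈ᴷ⇒≈ e = e

      ≈⇒≈ᴷ : ∀ {x y} → ⌊ x ⌋ ≈ ⌊ y ⌋ → x K.≈ y
      ≈⇒≈ᴷ e = e

      +ᴷ-def : ∀ x y → ⌈ x + y ⌉ ≡ ⌈ x ⌉ K.+ ⌈ y ⌉
      +ᴷ-def x y = ≡.refl

      *ᴷ-def : ∀ x y → ⌈ x * y ⌉ ≡ ⌈ x ⌉ K.* ⌈ y ⌉
      *ᴷ-def x y = ≡.refl

      -ᴷ-def : ∀ x → ⌈ - x ⌉ ≡ K.- ⌈ x ⌉
      -ᴷ-def x = ≡.refl

      0ᴷ-def : ⌈ 0L ⌉ ≡ K.0#
      0ᴷ-def = ≡.refl

      1ᴷ-def : ⌈ 1L ⌉ ≡ K.1#
      1ᴷ-def = ≡.refl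

      coeff-+ᴷ : ∀ x y n → coeff ⌊ x K.+ y ⌋ n F.≈ coeff ⌊ x ⌋ n F.+ coeff ⌊ y ⌋ n
      coeff-+ᴷ = coeff-+

      coeff-negᴷ : ∀ x n → coeff ⌊ K.- x ⌋ n F.≈ F.- coeff ⌊ x ⌋ n
      coeff-negᴷ = coeff-neg

  open LaurentRing
  module K = CommutativeRing laurentRing
  module KExp = Exp K.commutativeSemiring
  module KMembership = Membership K.setoid
  module KReasoning = ≈-Reasoning K.setoid
  module KRegular = RegularProperties laurentRing
  module KSolver = RingSolver laurentRing

  -- Images of 𝔽_q[X] as coefficient rings

  module PolynomialImage where
    -- The subring φ(𝔽_q[X]): 𝔽_q[X] itself, 𝔽_q[1/z] or 𝔽_q[w], according to the homomorphism.
    record Image {a ℓ'} (A : CommutativeRing a ℓ') (φ : Series → CommutativeRing.Carrier A) (x : CommutativeRing.Carrier A) : Set (c ⊔ ℓ ⊔ ℓ') where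
      constructor image
      open CommutativeRing A using (_≈_)
      field
        {degree}      : ℕ
        {series}      : Series
        isPolynomial  : IsPolynomial degree series
        equality      : x ≈ φ series

    module _ {a ℓ'} {A : CommutativeRing a ℓ'} {φ : Series → CommutativeRing.Carrier A}
             (hom : IsHomomorphism seriesRing A φ) where
      open CommutativeRing A
      open IsHomomorphism hom
      open RegularProperties A

      -- A nonzero polynomial divides some X^n among the power series, so its image divides the
      -- regular element φ(X)^n.
      image-regular : Regular A (φ X) → ∀ {u n} → IsPolynomial n u → ∀ m → ¬ (u m F.≈ F.0#) → Regular A (φ u)
      image-regular regX {u} pol m um≉0 with SF.polynomial-zero? pol
      ... | inj₁ u≈0 = contradiction (u≈0 m) um≉0
      ... | inj₂ (_ , n , v , uv≈Xⁿ) = regular-factor (regular-resp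
          (trans (sym (φ-^ X n)) (trans (φ-cong (S.sym uv≈Xⁿ)) (φ-* u v))) (regular-^ n))
        where
        regular-^ : ∀ n → Regular A (Exp._^_ commutativeSemiring (φ X) n)
        regular-^ zero    = regular-1
        regular-^ (suc n) = regular-* regX (regular-^ n)

      image-isCoefficientRing : Regular A (φ X) → IsCoefficientRing A (Image A φ)
      image-isCoefficientRing regX = record
        { 𝓡-resp = λ { x≈y (image p e) → image p (trans (sym x≈y) e) }
        ; 𝓡-0    = image {degree = 0} {series = S.0#} (λ _ _ → F.refl) (sym φ-0)
        ; 𝓡-1    = image {degree = 1} {series = S.1#} (polynomial-const F.1#) (sym φ-1)
        ; 𝓡-+    = λ { (image {m} {u} p e) (image {n} {v} p' e') →
                     image (polynomial-+ (polynomial-weaken (ℕ.m≤m⊔n m n) p) (polynomial-weaken (ℕ.m≤n⊔m m n) p'))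
                           (trans (+-cong e e') (sym (φ-+ u v))) }
        ; 𝓡-*    = λ { (image {m} {u} p e) (image {n} {v} p' e') →
                     image (polynomial-* {m} {n} {u} {v} p p') (trans (*-cong e e') (sym (φ-* u v))) }
        ; 𝓡-neg  = λ { (image {m} {u} p e) → image {degree = m} {series = S.- u}
                     (λ n m≤n → F.trans (F.-‿cong (p n m≤n)) (AbelianGroupProperties.ε⁻¹≈ε F.+-abelianGroup))
                     (trans (-‿cong e) (sym (φ-neg u))) }
        ; zero?  = λ { (image {m} {u} p e) → decide p e }
        }
        where
        decide : ∀ {m u x} → IsPolynomial m u → x ≈ φ u → x ≈ 0# ⊎ Regular A x
        decide p e with SF.polynomial-zero? p
        ... | inj₁ u≈0                = inj₁ (trans e (trans (φ-cong u≈0) φ-0))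
        ... | inj₂ ((m , um≉0) , _)   = inj₂ (regular-resp (sym e) (image-regular regX p m um≉0))

  open PolynomialImage

  -- Automatic power series are algebraic

  module AutomaticSeries where
    open S hiding (zero)
    open SExp using () renaming (_^_ to _^′_)
    open SF using (section)

    seriesCoefficientRing : IsCoefficientRing seriesRing (Image seriesRing id)
    seriesCoefficientRing = image-isCoefficientRing (id-homomorphism seriesRing) X-regular

    module Series = LinearAlgebra seriesRing (Image seriesRing id) seriesCoefficientRing
    open FrobeniusLinearAlgebra seriesRing (Image seriesRing id) seriesCoefficientRing Q 2≤Q
      (Frobenius.frobenius-+ seriesRing pr SF.series-characteristic (q !))

    private
      X^-𝓡 : ∀ r → Image seriesRing id (X ^′ r)
      X^-𝓡 zero    = IsCoefficientRing.𝓡-1 seriesCoefficientRing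
      X^-𝓡 (suc r) = IsCoefficientRing.𝓡-* seriesCoefficientRing (image {degree = 2} {series = X} polynomial-X refl) (X^-𝓡 r)

      span-sumTo : ∀ {A} n {f : ℕ → Series} → (∀ r → r < n → Series.Span A (f r)) → Series.Span A (SF.sumTo n f)
      span-sumTo zero    f∈ = Series.null
      span-sumTo (suc n) f∈ = Series.add (span-sumTo n (λ r r<n → f∈ r (ℕ.m≤n⇒m≤1+n r<n))) (f∈ n ℕ.≤-refl)

    -- The p-kernel is mapped into itself by taking sections, so u = Σ X^r (section r u)^Q
    -- shows that it lies in the span of its Q-th powers.
    automatic⇒algebraic : ∀ s → IsAutomatic F.setoid p s → Series.Algebraic s
    automatic⇒algebraic s (κs , enumerates) = contracted⇒algebraic contracted
      (Series.resp (λ n → F.reflexive (≡.cong s (≡.trans (ℕ.+-identityʳ (n ℕ.* 1)) (ℕ.*-identityʳ n)))) (kernel∈ (0 , Fin.zero)))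
      where
      sequence : (Σ[ i ∈ ℕ ] Fin (p ^ i)) → Series
      sequence = kernelSequence F.setoid p s
      A : List Series
      A = map sequence κs
      kernel∈A : ∀ κ → Membership._∈_ setoid (sequence κ) A
      kernel∈A κ = Any.map⁺ (enumerates κ)
      kernel∈ : ∀ κ → Series.Span A (sequence κ)
      kernel∈ κ = Series.generator (kernel∈A κ)
      -- As Q = p^(q!), taking a section modulo Q raises the level in the kernel by q!.
      section-index : ∀ κ {r} → r < Q → Σ[ κ' ∈ (Σ[ i ∈ ℕ ] Fin (p ^ i)) ] section r (sequence κ) ≈ sequence κ'
      section-index (i , j) {r} r<Q = (q ! ℕ.+ i , fromℕ< index<) , λ n → F.reflexive (≡.cong s
          (≡.trans (arith n Q (p ^ i) r (toℕ j)) (≡.cong₂ (λ P j → n ℕ.* P ℕ.+ j) (≡.sym (ℕ.^-distribˡ-+-* p (q !) i)) (≡.sym (Fin.toℕ-fromℕ< index<)))))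
        where
        arith : ∀ n Q P r j → (n ℕ.* Q ℕ.+ r) ℕ.* P ℕ.+ j ≡ n ℕ.* (Q ℕ.* P) ℕ.+ (r ℕ.* P ℕ.+ j)
        arith = solve-∀
        index< : r ℕ.* p ^ i ℕ.+ toℕ j < p ^ (q ! ℕ.+ i)
        index< = ℕ.<-≤-trans (ℕ.+-monoʳ-< (r ℕ.* p ^ i) (Fin.toℕ<n j))
          (≡.subst₂ _≤_ (ℕ.+-comm (p ^ i) (r ℕ.* p ^ i)) (≡.sym (ℕ.^-distribˡ-+-* p (q !) i)) (ℕ.*-monoˡ-≤ (p ^ i) r<Q))
      contracted : ∀ {u} → Series.Span A u → Series.Span (frobeniusImage A) u
      contracted = Series.span-elim (Series.span-isSubspace _) λ {v} v∈ →
        let (κ , _ , v≈) = Membershipₚ.∈-map⁻ (≡.setoid _) setoid v∈ in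
        Series.resp (trans (sym (SF.section-decomposition (sequence κ))) (sym v≈))
          (span-sumTo Q (λ r r<Q → let (κ' , eq) = section-index κ r<Q in
            Series.scale (X^-𝓡 r) (frobenius-span (Series.resp (sym eq) (kernel∈ κ')))))

    module _ {a ℓ'} {A : CommutativeRing a ℓ'} {φ : Series → CommutativeRing.Carrier A}
             (hom : IsHomomorphism seriesRing A φ) (φX-regular : Regular A (φ X)) where
      private
        module A = CommutativeRing A
        module LA = LinearAlgebra A (Image A φ) (image-isCoefficientRing hom φX-regular)
      open IsHomomorphism hom

      -- A homomorphism need not preserve regularity, which `saturate` requires; but a regular
      -- polynomial is nonzero, and then `image-regular` applies.
      algebraic-image : ∀ {u} → Series.Algebraic u → LA.Algebraic (φ u)
      algebraic-image {u} (n , u∈) = n , LA.resp (φ-^ u (suc n)) (Series.span-elim {N = λ v → LA.Span (LA.powers (φ u) n) (φ v)} (record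
        { resp     = λ e → LA.resp (φ-cong e)
        ; null     = LA.resp (A.sym φ-0) LA.null
        ; add      = λ s t → LA.resp (A.sym (φ-+ _ _)) (LA.add s t)
        ; scale    = λ { (image pol e) s → LA.resp (A.trans (A.*-congʳ (φ-cong (sym e))) (A.sym (φ-* _ _))) (LA.scale (image pol A.refl) s) }
        ; saturate = λ { {g} {v} (image pol e) reg s → LA.saturate (image pol (φ-cong e)) (regular pol e reg) (LA.resp (φ-* g v) s) }
        }) (λ v∈ → let (i , i≤n , v≈) = Series.∈powers⇒^ u v∈ in
             LA.resp (A.sym (A.trans (φ-cong v≈) (φ-^ u i))) (LA.generator (LA.^∈powers (φ u) i≤n))) u∈)
        where
        regular : ∀ {N g v} → IsPolynomial N v → g ≈ v → Regular seriesRing g → Regular A (φ g)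
        regular {g = g} {v} pol e reg with SF.polynomial-zero? pol
        ... | inj₁ v≈0              = contradiction (reg 1# (trans (*-congʳ (trans e v≈0)) (zeroˡ 1#)) 0) F.1≉0
        ... | inj₂ ((m , vm≉0) , _) = RegularProperties.regular-resp A (φ-cong (sym e)) (image-regular hom φX-regular pol m vm≉0)

  module AS = AutomaticSeries

  -- Power series inside Laurent series; the operator Λ

  module LaurentProperties where
    open L using (Laurent; ⟨_,_⟩; extend; constant; z⁻¹)
    open K hiding (zero)
    open KExp using (^-homo-*; ^-distrib-*; ^-assocʳ; ^-congˡ) renaming (_^_ to _^′_)
    open KMembership using (_∈_)
    open KSolver
    open KRegular
    open KReasoning

    coeff : 𝕃 → ℤ → F.Carrier
    coeff x = L.coeff ⌊ x ⌋

    extensional : ∀ {x y} → (∀ n → coeff x n F.≈ coeff y n) → x ≈ y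
    extensional = ≈⇒≈ᴷ

    coeff-cong : ∀ {x y} → x ≈ y → ∀ n → coeff x n F.≈ coeff y n
    coeff-cong = ≈ᴷ⇒≈

    coeff-sum : ∀ x y n → coeff (x + y) n F.≈ coeff x n F.+ coeff y n
    coeff-sum = coeff-+ᴷ

    coeff-minus : ∀ x n → coeff (- x) n F.≈ F.- coeff x n
    coeff-minus = coeff-negᴷ

    coeff-⌈⌉ : ∀ x n → coeff ⌈ x ⌉ n F.≈ L.coeff x n
    coeff-⌈⌉ x n = F.reflexive (≡.cong (λ x → L.coeff x n) (⌊⌈⌉⌋ x))

    ⌈⌉-cong : ∀ {x y} → x L.≈ y → ⌈ x ⌉ ≈ ⌈ y ⌉
    ⌈⌉-cong {x} {y} e = extensional λ n → F.trans (coeff-⌈⌉ x n) (F.trans (e n) (F.sym (coeff-⌈⌉ y n)))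

    ⌈⌉-injective : ∀ {x y} → ⌈ x ⌉ ≈ ⌈ y ⌉ → x L.≈ y
    ⌈⌉-injective {x} {y} e n = F.trans (F.sym (coeff-⌈⌉ x n)) (F.trans (coeff-cong e n) (coeff-⌈⌉ y n))

    extend-cong : ∀ {u v} → u ≐ v → ∀ i → extend u i F.≈ extend v i
    extend-cong e (+ n)    = e n
    extend-cong e -[1+ _ ] = F.refl

    ι : Series → 𝕃
    ι u = ⌈ ⟨ 0 , u ⟩ ⌉

    coeff-ι : ∀ u n → coeff (ι u) (+ n) F.≈ u n
    coeff-ι u n = F.trans (coeff-⌈⌉ ⟨ 0 , u ⟩ (+ n)) (F.reflexive (≡.cong u (ℕ.+-identityʳ n)))

    coeff-ι-negative : ∀ u {n} → n ℤ.< 0ℤ → coeff (ι u) n F.≈ F.0#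
    coeff-ι-negative u {n} n<0 = F.trans (coeff-⌈⌉ ⟨ 0 , u ⟩ n) (extend-negative u (≡.subst (ℤ._< 0ℤ) (≡.sym (ℤ.+-identityʳ n)) n<0))

    ι-cong : ∀ {u v} → u S.≈ v → ι u ≈ ι v
    ι-cong e = ⌈⌉-cong (λ n → extend-cong e (n ℤ.+ + 0))

    ι-injective : ∀ {u v} → ι u ≈ ι v → u S.≈ v
    ι-injective {u} {v} e n = F.trans (F.sym (coeff-ι u n)) (F.trans (coeff-cong e (+ n)) (coeff-ι v n))

    constant≈ι : ∀ a → ⌈ constant a ⌉ ≈ ι (const a)
    constant≈ι a = ⌈⌉-cong (λ n → extend-cong eq (n ℤ.+ + 0))
      where
      eq : L.coefs (constant a) ≐ const a
      eq zero    = F.refl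
      eq (suc n) = F.refl

    ι-homomorphism : IsHomomorphism seriesRing laurentRing ι
    ι-homomorphism = record
      { φ-cong = ι-cong
      ; φ-1    = trans (sym (constant≈ι F.1#)) (reflexive 1ᴷ-def)
      ; φ-+    = λ u v → trans (⌈⌉-cong (λ n → F.sym (F.trans (coeff-+ ⟨ 0 , u ⟩ ⟨ 0 , v ⟩ n) (additive u v n))))
                   (reflexive (+ᴷ-def ⟨ 0 , u ⟩ ⟨ 0 , v ⟩))
      ; φ-*    = λ u v → trans (⌈⌉-cong (λ n → extend-cong (λ k → F.reflexive (conv-sum u v k)) (n ℤ.+ + 0)))
                   (reflexive (*ᴷ-def ⟨ 0 , u ⟩ ⟨ 0 , v ⟩))
      }
      where
      additive : ∀ u v n → L.coeff ⟨ 0 , u ⟩ n F.+ L.coeff ⟨ 0 , v ⟩ n F.≈ L.coeff ⟨ 0 , u S.+ v ⟩ n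
      additive u v n with n ℤ.+ + 0
      ... | + _      = F.refl
      ... | -[1+ _ ] = F.+-identityˡ F.0#

    open IsHomomorphism ι-homomorphism public renaming
      (φ-1 to ι-1; φ-+ to ι-+; φ-* to ι-*; φ-0 to ι-0; φ-neg to ι-neg; φ-^ to ι-^; φ-· to ι-·; φ-sum to ι-sum) hiding (φ-cong)

    t : 𝕃
    t = ι X

    z⁻¹≈t : ⌈ z⁻¹ ⌉ ≈ t
    z⁻¹≈t = ⌈⌉-cong (λ n → extend-cong eq (n ℤ.+ + 0))
      where
      eq : L.coefs z⁻¹ ≐ X
      eq zero          = F.refl
      eq (suc zero)    = F.refl
      eq (suc (suc n)) = F.refl

    z : 𝕃
    z = ⌈ ⟨ 1 , const F.1# ⟩ ⌉

    coeff-z* : ∀ x n → coeff (z * x) n F.≈ coeff x (n ℤ.+ + 1)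
    coeff-z* x n = F.trans (coeff-cong (trans (*-congˡ (reflexive (≡.sym (⌈⌊⌋⌉ x)))) (reflexive (≡.sym (*ᴷ-def z′ x′)))) n)
      (F.trans (coeff-⌈⌉ (z′ L.* x′) n)
      (F.trans (extend-cong (λ k → F.trans (F.reflexive (≡.sym (conv-sum (const F.1#) (L.coefs x′) k))) (S.*-identityˡ (L.coefs x′) k)) (n ℤ.+ + (1 ℕ.+ L.bound x′)))
               (F.reflexive (≡.cong (extend (L.coefs x′)) (≡.sym (ℤ.+-assoc n (+ 1) (+ L.bound x′)))))))
      where
      z′ = ⟨ 1 , const F.1# ⟩
      x′ = ⌊ x ⌋

    coeff-z^* : ∀ e x n → coeff (z ^′ e * x) n F.≈ coeff x (n ℤ.+ + e)
    coeff-z^* zero    x n = F.trans (coeff-cong (*-identityˡ x) n) (F.reflexive (≡.cong (coeff x) (≡.sym (ℤ.+-identityʳ n))))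
    coeff-z^* (suc e) x n = F.trans (coeff-cong (*-assoc z (z ^′ e) x) n) (F.trans (coeff-z* (z ^′ e * x) n)
      (F.trans (coeff-z^* e x (n ℤ.+ + 1)) (F.reflexive (≡.cong (coeff x) (ℤ.+-assoc n (+ 1) (+ e))))))

    z*t≈1 : z * t ≈ 1#
    z*t≈1 = trans (extensional (λ n → F.trans (coeff-z* t n) (eq n))) ι-1
      where
      eq : ∀ n → coeff t (n ℤ.+ + 1) F.≈ coeff (ι S.1#) n
      eq (+ n)          = F.trans (coeff-ι X (n ℕ.+ 1)) (F.trans (F.reflexive (≡.cong X (ℕ.+-comm n 1))) (F.sym (coeff-ι S.1# n)))
      eq -[1+ zero ]    = F.trans (coeff-ι X 0) (F.sym (coeff-ι-negative S.1# { -[1+ 0 ]} -<+))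
      eq -[1+ suc n ]   = F.trans (coeff-ι-negative X { -[1+ n ]} -<+) (F.sym (coeff-ι-negative S.1# { -[1+ suc n ]} -<+))

    t-regular : Regular laurentRing t
    t-regular = regular-unit (trans (*-comm t z) z*t≈1)

    z^*t^≈1 : ∀ e → z ^′ e * t ^′ e ≈ 1#
    z^*t^≈1 zero    = *-identityˡ 1#
    z^*t^≈1 (suc e) = begin
      (z * z ^′ e) * (t * t ^′ e) ≈⟨ solve 4 (λ z y t s → (z :* y) :* (t :* s) := (z :* t) :* (y :* s)) refl z (z ^′ e) t (t ^′ e) ⟩
      (z * t) * (z ^′ e * t ^′ e) ≈⟨ *-cong z*t≈1 (z^*t^≈1 e) ⟩
      1# * 1# ≈⟨ *-identityˡ 1# ⟩
      1#                           ∎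

    normal-form : ∀ e x → (∀ n → n ℤ.+ + e ℤ.< 0ℤ → coeff x n F.≈ F.0#) → x ≈ z ^′ e * ι (rep e ⌊ x ⌋)
    normal-form e x low = extensional (λ n → F.sym (F.trans (coeff-z^* e (ι (rep e ⌊ x ⌋)) n) (eq n)))
      where
      eq : ∀ n → coeff (ι (rep e ⌊ x ⌋)) (n ℤ.+ + e) F.≈ coeff x n
      eq n with position e n
      ... | below n b = F.trans (coeff-ι-negative (rep e ⌊ x ⌋) b) (F.sym (low n b))
      ... | above k   = F.trans (F.reflexive (≡.cong (coeff (ι (rep e ⌊ x ⌋))) (⊖-+-self k e))) (coeff-ι (rep e ⌊ x ⌋) k)

    normal-form-≥ : ∀ x {e} → L.bound ⌊ x ⌋ ≤ e → x ≈ z ^′ e * ι (rep e ⌊ x ⌋)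
    normal-form-≥ x {e} b≤e = normal-form e x (λ n n<0 →
      extend-negative (L.coefs ⌊ x ⌋) (ℤ.≤-<-trans (ℤ.+-monoʳ-≤ n (ℤ.+≤+ b≤e)) n<0))

    laurent-characteristic : Mult×._×_ semiring p 1# ≈ 0#
    laurent-characteristic = begin
      Mult×._×_ semiring p 1# ≈⟨ Mult×.×-congʳ semiring p ι-1 ⟨
      Mult×._×_ semiring p (ι S.1#) ≈⟨ ι-· p S.1# ⟨
      ι (Mult×._×_ S.semiring p S.1#) ≈⟨ ι-cong SF.series-characteristic ⟩
      ι S.0# ≈⟨ ι-0 ⟩
      0#                                ∎

    laurent-frobenius-+ : ∀ x y → (x + y) ^′ Q ≈ x ^′ Q + y ^′ Q
    laurent-frobenius-+ = Frobenius.frobenius-+ laurentRing pr laurent-characteristic (q !)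

    opaque
      Λ : 𝕃 → 𝕃
      Λ x = ⌈ ⟨ L.bound ⌊ x ⌋ , (λ k → coeff x ((k ⊖ L.bound ⌊ x ⌋) ℤ.* + Q)) ⟩ ⌉

      coeff-Λ : ∀ x n → coeff (Λ x) n F.≈ coeff x (n ℤ.* + Q)
      coeff-Λ x n = F.trans (coeff-⌈⌉ _ n) (eq n)
        where
        m : ℕ
        m = L.bound ⌊ x ⌋
        Λx : Laurent
        Λx = ⟨ m , (λ k → coeff x ((k ⊖ m) ℤ.* + Q)) ⟩
        eq : ∀ n → L.coeff Λx n F.≈ coeff x (n ℤ.* + Q)
        eq n with position m n
        ... | above k   = F.reflexive (≡.cong (extend (L.coefs Λx)) (⊖-+-self k m))
        -- For n ≤ 0 also nQ ≤ n, so the bound of `x` serves for `Λ x` as well.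
        ... | below n b = F.trans (extend-negative (L.coefs Λx) b) (F.sym (extend-negative (L.coefs ⌊ x ⌋)
            (ℤ.≤-<-trans (ℤ.+-monoˡ-≤ (+ m) nQ≤n) b)))
          where
          n≤0 : n ℤ.≤ 0ℤ
          n≤0 = ℤ.<⇒≤ (ℤ.≤-<-trans (ℤ.i≤i+j n (+ m)) b)
          nQ≤n : n ℤ.* + Q ℤ.≤ n
          nQ≤n = ≡.subst (n ℤ.* + Q ℤ.≤_) (ℤ.*-identityʳ n)
            (ℤ.*-monoˡ-≤-nonPos n {{ℤ.nonPositive n≤0}} (ℤ.+≤+ 0<Q))

    Λ-cong : ∀ {x y} → x ≈ y → Λ x ≈ Λ y
    Λ-cong {x} {y} e = extensional (λ n → F.trans (coeff-Λ x n) (F.trans (coeff-cong e (n ℤ.* + Q)) (F.sym (coeff-Λ y n))))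

    Λ-+ : ∀ x y → Λ (x + y) ≈ Λ x + Λ y
    Λ-+ x y = extensional λ n → F.trans (coeff-Λ (x + y) n) (F.trans (coeff-sum x y (n ℤ.* + Q))
      (F.trans (F.sym (F.+-cong (coeff-Λ x n) (coeff-Λ y n))) (F.sym (coeff-sum (Λ x) (Λ y) n))))

    Λ-ι : ∀ u → Λ (ι u) ≈ ι (SF.Λ u)
    Λ-ι u = extensional λ n → F.trans (coeff-Λ (ι u) n) (eq n)
      where
      eq : ∀ n → coeff (ι u) (n ℤ.* + Q) F.≈ coeff (ι (SF.Λ u)) n
      eq (+ n)    = F.trans (F.reflexive (≡.cong (coeff (ι u)) (≡.sym (ℤ.pos-* n Q)))) (F.trans (coeff-ι u (n ℕ.* Q)) (F.sym (coeff-ι (SF.Λ u) n)))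
      eq -[1+ n ] = F.trans (coeff-ι-negative u (ℤ.≤-<-trans (ℤ.*-monoˡ-≤-nonPos -[1+ n ] (ℤ.+≤+ 0<Q)) -<+))
        (F.sym (coeff-ι-negative (SF.Λ u) { -[1+ n ]} -<+))

    Λ-z^Q : ∀ e x → Λ (z ^′ (e ℕ.* Q) * x) ≈ z ^′ e * Λ x
    Λ-z^Q e x = extensional λ n → F.trans (coeff-Λ (z ^′ (e ℕ.* Q) * x) n) (F.trans (coeff-z^* (e ℕ.* Q) x (n ℤ.* + Q))
      (F.trans (F.reflexive (≡.cong (coeff x) (≡.trans (≡.cong (λ i → n ℤ.* + Q ℤ.+ i) (ℤ.pos-* e Q)) (≡.sym (ℤ.*-distribʳ-+ (+ Q) n (+ e))))))
      (F.sym (F.trans (coeff-z^* e (Λ x) n) (coeff-Λ x (n ℤ.+ + e))))))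

    -- Reduced to power series by splitting off powers of z. For `y` the exponent is chosen as a
    -- multiple of Q, since Λ lets only powers of z^Q pass; for `x`, which is raised to the power Q,
    -- any exponent will do.
    Λ-frobenius : ∀ x y → Λ (x ^′ Q * y) ≈ x * Λ y
    Λ-frobenius x y = begin
      Λ (x ^′ Q * y) ≈⟨ Λ-cong (*-cong (^-congˡ Q x≈) y≈) ⟩
      Λ ((z ^′ a * ι u) ^′ Q * (z ^′ (b ℕ.* Q) * ι v)) ≈⟨ Λ-cong combine ⟩
      Λ (z ^′ ((a ℕ.+ b) ℕ.* Q) * ι (u ^S Q S.* v)) ≈⟨ Λ-z^Q (a ℕ.+ b) (ι (u ^S Q S.* v)) ⟩
      z ^′ (a ℕ.+ b) * Λ (ι (u ^S Q S.* v)) ≈⟨ *-congˡ (trans (Λ-ι (u ^S Q S.* v)) (trans (ι-cong (SF.Λ-frobenius u v)) (ι-* u (SF.Λ v)))) ⟩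
      z ^′ (a ℕ.+ b) * (ι u * ι (SF.Λ v)) ≈⟨ *-cong (^-homo-* z a b) (*-congˡ (sym (Λ-ι v))) ⟩
      (z ^′ a * z ^′ b) * (ι u * Λ (ι v)) ≈⟨ solve 4 (λ x y u w → (x :* y) :* (u :* w) := (x :* u) :* (y :* w)) refl (z ^′ a) (z ^′ b) (ι u) (Λ (ι v)) ⟩
      (z ^′ a * ι u) * (z ^′ b * Λ (ι v)) ≈⟨ *-cong (sym x≈) (trans (sym (Λ-z^Q b (ι v))) (Λ-cong (sym y≈))) ⟩
      x * Λ y                                                    ∎
      where
      a = L.bound ⌊ x ⌋
      b = L.bound ⌊ y ⌋
      u = rep a ⌊ x ⌋
      v = rep (b ℕ.* Q) ⌊ y ⌋
      x≈ : x ≈ z ^′ a * ι u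
      x≈ = normal-form-≥ x ℕ.≤-refl
      y≈ : y ≈ z ^′ (b ℕ.* Q) * ι v
      y≈ = normal-form-≥ y (ℕ.m≤m*n b Q {{ℕ.>-nonZero 0<Q}})
      combine : (z ^′ a * ι u) ^′ Q * (z ^′ (b ℕ.* Q) * ι v) ≈ z ^′ ((a ℕ.+ b) ℕ.* Q) * ι (u ^S Q S.* v)
      combine = begin
        (z ^′ a * ι u) ^′ Q * (z ^′ (b ℕ.* Q) * ι v) ≈⟨ *-congʳ (^-distrib-* (z ^′ a) (ι u) Q) ⟩
        ((z ^′ a) ^′ Q * ι u ^′ Q) * (z ^′ (b ℕ.* Q) * ι v) ≈⟨ *-congʳ (*-congʳ (^-assocʳ z a Q)) ⟩
        (z ^′ (a ℕ.* Q) * ι u ^′ Q) * (z ^′ (b ℕ.* Q) * ι v) ≈⟨ solve 4 (λ x y u w → (x :* u) :* (y :* w) := (x :* y) :* (u :* w)) refl (z ^′ (a ℕ.* Q)) (z ^′ (b ℕ.* Q)) (ι u ^′ Q) (ι v) ⟩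
        (z ^′ (a ℕ.* Q) * z ^′ (b ℕ.* Q)) * (ι u ^′ Q * ι v)        ≈⟨ *-cong (trans (sym (^-homo-* z (a ℕ.* Q) (b ℕ.* Q))) (reflexive (≡.cong (z ^′_) (≡.sym (ℕ.*-distribʳ-+ Q a b)))))
                                                                         (trans (*-congʳ (sym (ι-^ u Q))) (sym (ι-* (u ^S Q) v))) ⟩
        z ^′ ((a ℕ.+ b) ℕ.* Q) * ι (u ^S Q S.* v)                   ∎

    ε : 𝕃 → F.Carrier
    ε x = coeff x 0ℤ

    -- The index 0 is fixed by n ↦ nQ, which is why values are read at z⁰.
    ε-Λ : ∀ x → ε (Λ x) F.≈ ε x
    ε-Λ x = coeff-Λ x 0ℤ

  open LaurentProperties

  -- Separability by means of Λ; coefficient sequences of algebraic series are automatic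

  module LaurentLinearAlgebra where
    open K hiding (zero)
    open KExp using (^-homo-*; ^-distrib-*; ^-assocʳ; ^-congˡ) renaming (_^_ to _^′_)
    open KMembership using (_∈_)
    open KSolver
    open KRegular
    open KReasoning

    coefficientRing : IsCoefficientRing laurentRing (Image laurentRing ι)
    coefficientRing = image-isCoefficientRing ι-homomorphism t-regular

    open IsCoefficientRing coefficientRing public
    open LinearAlgebra laurentRing (Image laurentRing ι) coefficientRing public
    open FrobeniusLinearAlgebra laurentRing (Image laurentRing ι) coefficientRing Q 2≤Q laurent-frobenius-+ public
    open PolynomialRelations laurentRing (Image laurentRing ι) coefficientRing public

    private
      𝓡 : 𝕃 → Set (c ⊔ ℓ)
      𝓡 = Image laurentRing ι

    Λ-𝓡 : ∀ {x} → 𝓡 x → 𝓡 (Λ x)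
    Λ-𝓡 (image {N} {u} pol e) = image {degree = N} (SF.polynomial-Λ (ℕ.m≤m*n N Q {{ℕ.>-nonZero 0<Q}}) pol) (trans (Λ-cong e) (Λ-ι u))

    t^-𝓡 : ∀ n → 𝓡 (t ^′ n)
    t^-𝓡 zero    = 𝓡-1
    t^-𝓡 (suc n) = 𝓡-* (image {degree = 2} {series = X} polynomial-X refl) (t^-𝓡 n)

    1≉0 : ¬ (1# ≈ 0#)
    1≉0 1≈0 = F.1≉0 (ι-injective {S.1#} {S.0#} (trans ι-1 (trans 1≈0 (sym ι-0))) 0)

    nonzero-coefficient : ∀ {g} → 𝓡 g → Regular laurentRing g → ∃[ u ] ∃[ N ] ∃[ n ] IsPolynomial N u × g ≈ ι u × ¬ (u n F.≈ F.0#)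
    nonzero-coefficient {g} (image {N} {u} pol e) reg with SF.polynomial-zero? pol
    ... | inj₁ u≈0                 = contradiction (reg 1# (trans (*-congʳ (trans e (trans (ι-cong u≈0) ι-0))) (zeroˡ 1#))) 1≉0
    ... | inj₂ ((n , un≉0) , _)    = u , N , n , pol , e , un≉0

    -- Λ g may vanish although g does not; a factor t^a moves a nonzero coefficient of g to an index
    -- that Λ keeps.
    Λ-regular : ∀ {g} → 𝓡 g → Regular laurentRing g → ∃[ a ] Regular laurentRing (Λ (t ^′ a * g))
    Λ-regular {g} 𝓡g reg =
      let (u , N , n , pol , g≈ , un≉0) = nonzero-coefficient 𝓡g reg
          a = n ℕ.* Q ∸ n
          v = X ^S a S.* u
          (M , pol-v) = X^-polynomial a pol
          eq : Λ (t ^′ a * g) ≈ ι (SF.Λ v)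
          eq = trans (Λ-cong (trans (*-cong (sym (ι-^ X a)) g≈) (sym (ι-* (X ^S a) u)))) (Λ-ι v)
      in a , regular-resp (sym eq) (image-regular ι-homomorphism t-regular
               {SF.Λ v} {M} (SF.polynomial-Λ (ℕ.m≤m*n M Q {{ℕ.>-nonZero 0<Q}}) pol-v) n
               (λ Λn≈0 → un≉0 (F.trans (F.sym (SF.Λ-X^*-coefficient u n)) Λn≈0)))
      where
      X^-polynomial : ∀ {N u} a → IsPolynomial N u → ∃[ M ] IsPolynomial M (X ^S a S.* u)
      X^-polynomial {N} {u} zero    pol = N , polynomial-resp (S.sym (S.*-identityˡ u)) pol
      X^-polynomial {N} {u} (suc a) pol = let (M , pol') = X^-polynomial a pol in
        2 ℕ.+ M , polynomial-resp (S.sym (S.*-assoc X (X ^S a) u)) (polynomial-* {2} {M} {X} {X ^S a S.* u} polynomial-X pol')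

    -- Λ extracts roots: Λ(d v^Q) = Λ(d) v. It therefore maps combinations of the Q-th powers of `A`
    -- into `Span A`, and a multiple of u^Q to a multiple of u. The predicate N quantifies over all
    -- multipliers d because Λ does not commute with scalars, and over one denominator g because u^Q
    -- is a combination only up to denominators.
    root : ∀ {A u} → Span (frobeniusImage A) (u ^′ Q) → Span A u
    root {A} {u} u^Q∈ = conclude (span-elim {N = N} N-isSubspace gens u^Q∈)
      where
      N : 𝕃 → Set (c ⊔ ℓ)
      N x = ∃[ g ] 𝓡 g × Regular laurentRing g × (∀ {d} → 𝓡 d → Span A (Λ (d * (g * x))))
      Λ-0 : Λ 0# ≈ 0#
      Λ-0 = begin
        Λ 0# ≈⟨ solve 1 (λ x → x := (x :+ x) :- x) refl (Λ 0#) ⟩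
        (Λ 0# + Λ 0#) - Λ 0# ≈⟨ +-congʳ (trans (sym (Λ-+ 0# 0#)) (Λ-cong (+-identityˡ 0#))) ⟩
        Λ 0# - Λ 0# ≈⟨ -‿inverseʳ _ ⟩
        0#                     ∎
      N-isSubspace : IsSubspace N
      N-isSubspace = record
        { resp     = λ { e (g , 𝓡g , reg , f) → g , 𝓡g , reg , λ c → resp (Λ-cong (*-congˡ (*-congˡ e))) (f c) }
        ; null     = 1# , 𝓡-1 , regular-1 , λ {d} _ → resp (sym (trans (Λ-cong (trans (*-congˡ (zeroʳ 1#)) (zeroʳ d))) Λ-0)) null
        ; add      = λ { {x} {y} (g , 𝓡g , reg , f) (g' , 𝓡g' , reg' , f') → g * g' , 𝓡-* 𝓡g 𝓡g' , regular-* reg reg' , λ {d} 𝓡d →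
            resp (trans (sym (Λ-+ (d * g' * (g * x)) (d * g * (g' * y)))) (Λ-cong (solve 5 (λ d g g' x y → d :* g' :* (g :* x) :+ d :* g :* (g' :* y) := d :* (g :* g' :* (x :+ y))) refl d g g' x y)))
                 (add (f (𝓡-* 𝓡d 𝓡g')) (f' (𝓡-* 𝓡d 𝓡g))) }
        ; scale    = λ { {e} {x} 𝓡e (g , 𝓡g , reg , f) → g , 𝓡g , reg , λ {d} 𝓡d →
            resp (Λ-cong (solve 4 (λ d e g x → d :* e :* (g :* x) := d :* (g :* (e :* x))) refl d e g x)) (f (𝓡-* 𝓡d 𝓡e)) }
        ; saturate = λ { {h} {x} 𝓡h s (g , 𝓡g , reg , f) → g * h , 𝓡-* 𝓡g 𝓡h , regular-* reg s , λ {d} 𝓡d →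
            resp (Λ-cong (*-congˡ (sym (*-assoc g h x)))) (f 𝓡d) }
        }
      gens : ∀ {x} → x ∈ frobeniusImage A → N x
      gens {x} x∈ = let (v , v∈ , x≈) = Membershipₚ.∈-map⁻ setoid setoid x∈ in
        1# , 𝓡-1 , regular-1 , λ {d} 𝓡d → resp (begin
          Λ d * v ≈⟨ *-comm (Λ d) v ⟩
          v * Λ d ≈⟨ Λ-frobenius v d ⟨
          Λ (v ^′ Q * d) ≈⟨ Λ-cong (trans (*-comm (v ^′ Q) d) (*-congˡ (trans (sym x≈) (sym (*-identityˡ x))))) ⟩
          Λ (d * (1# * x))    ∎) (scale (Λ-𝓡 𝓡d) (generator v∈))
      conclude : N (u ^′ Q) → Span A u
      conclude (g , 𝓡g , reg , f) = let (a , Λ-reg) = Λ-regular 𝓡g reg in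
       saturate (Λ-𝓡 (𝓡-* (t^-𝓡 a) 𝓡g)) Λ-reg (resp (begin
        Λ (t ^′ a * (g * u ^′ Q)) ≈⟨ Λ-cong (solve 3 (λ t g u → t :* (g :* u) := u :* (t :* g)) refl (t ^′ a) g (u ^′ Q)) ⟩
        Λ (u ^′ Q * (t ^′ a * g)) ≈⟨ Λ-frobenius u (t ^′ a * g) ⟩
        u * Λ (t ^′ a * g) ≈⟨ *-comm u _ ⟩
        Λ (t ^′ a * g) * u          ∎) (f (t^-𝓡 a)))

    open Separable root public

    -- In contrast to `Span` there are no denominators and the coefficients have degree less than N,
    -- so over 𝔽_q there are finitely many combinations.
    data Bounded (N : ℕ) : List 𝕃 → 𝕃 → Set (c ⊔ ℓ) where
      nil  : ∀ {y} → y ≈ 0# → Bounded N [] y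
      cons : ∀ {v vs y u y'} → IsPolynomial N u → y ≈ ι u * v + y' → Bounded N vs y' → Bounded N (v ∷ vs) y

    bounded-resp : ∀ {N vs x y} → x ≈ y → Bounded N vs x → Bounded N vs y
    bounded-resp x≈y (nil e)        = nil (trans (sym x≈y) e)
    bounded-resp x≈y (cons pol e b) = cons pol (trans (sym x≈y) e) b

    bounded-weaken : ∀ {M N vs y} → M ≤ N → Bounded M vs y → Bounded N vs y
    bounded-weaken M≤N (nil e)        = nil e
    bounded-weaken M≤N (cons pol e b) = cons (polynomial-weaken M≤N pol) e (bounded-weaken M≤N b)

    bounded-null : ∀ {N} vs → Bounded N vs 0#
    bounded-null []       = nil refl
    bounded-null (v ∷ vs) = cons {u = S.0#} (λ _ _ → F.refl)
      (sym (trans (+-identityʳ _) (trans (*-congʳ ι-0) (zeroˡ v)))) (bounded-null vs)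

    bounded-+ : ∀ {N vs x y} → Bounded N vs x → Bounded N vs y → Bounded N vs (x + y)
    bounded-+ (nil e) (nil e') = nil (trans (+-cong e e') (+-identityˡ 0#))
    bounded-+ {vs = v ∷ _} (cons {u = u} {x} pol e b) (cons {u = u'} {y} pol' e' b') =
      cons (polynomial-+ pol pol') (begin
        _ ≈⟨ +-cong e e' ⟩
        (ι u * v + x) + (ι u' * v + y) ≈⟨ solve 5 (λ u u' v x y → (u :* v :+ x) :+ (u' :* v :+ y) := (u :+ u') :* v :+ (x :+ y)) refl (ι u) (ι u') v x y ⟩
        (ι u + ι u') * v + (x + y) ≈⟨ +-congʳ (*-congʳ (ι-+ u u')) ⟨
        ι (u S.+ u') * v + (x + y)        ∎) (bounded-+ b b')

    bounded-scale : ∀ {M N vs d x} → IsPolynomial M d → Bounded N vs x → Bounded (M ℕ.+ N) vs (ι d * x)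
    bounded-scale pol (nil e) = nil (trans (*-congˡ e) (zeroʳ _))
    bounded-scale {M} {N} {v ∷ _} {d} {x} pol (cons {u = u} {y} pol' e b) =
      cons (polynomial-* {M} {N} {d} {u} pol pol') (begin
        ι d * x ≈⟨ *-congˡ e ⟩
        ι d * (ι u * v + y) ≈⟨ solve 4 (λ d u v y → d :* (u :* v :+ y) := (d :* u) :* v :+ d :* y) refl (ι d) (ι u) v y ⟩
        (ι d * ι u) * v + ι d * y ≈⟨ +-congʳ (*-congʳ (ι-* d u)) ⟨
        ι (d S.* u) * v + ι d * y         ∎) (bounded-scale pol b)

    bounded-generator : ∀ {vs v} → v ∈ vs → Bounded 1 vs v
    bounded-generator {v ∷ vs} {x} (here e) = cons (polynomial-const F.1#) (begin
      x ≈⟨ e ⟩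
      v ≈⟨ *-identityˡ v ⟨
      1# * v ≈⟨ *-congʳ ι-1 ⟨
      ι S.1# * v ≈⟨ +-identityʳ _ ⟨
      ι S.1# * v + 0#        ∎) (bounded-null vs)
    bounded-generator {v ∷ vs} {x} (there p) = cons {u = S.0#} (λ _ _ → F.refl)
      (sym (trans (+-congʳ (trans (*-congʳ ι-0) (zeroˡ v))) (+-identityˡ x))) (bounded-generator p)

    record Denominator (A : List 𝕃) (x : 𝕃) : Set (c ⊔ ℓ) where
      constructor denominator
      field
        {degree bound} : ℕ
        {g}            : Series
        isPolynomial   : IsPolynomial degree g
        regular        : Regular laurentRing (ι g)
        bounded        : Bounded bound A (ι g * x)

    -- The uses of `saturate` in the derivation are collected in the denominator, and those of
    -- `scale` in the degree bound.
    span⇒bounded : ∀ {A x} → Span A x → Denominator A x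
    span⇒bounded {A} = span-elim {N = Denominator A} (record
      { resp     = λ { e (denominator pol reg b) → denominator pol reg (bounded-resp (*-congˡ e) b) }
      ; null     = denominator {bound = 0} {g = S.1#} (polynomial-const F.1#) ι1-regular (bounded-resp (sym (zeroʳ (ι S.1#))) (bounded-null A))
      ; add      = λ { {x} {y} (denominator {m} {n} {g} pol reg b) (denominator {m'} {n'} {g'} pol' reg' b') →
          denominator {g = g S.* g'} (polynomial-* {m} {m'} {g} {g'} pol pol') (regular-resp (sym (ι-* g g')) (regular-* reg reg'))
            (bounded-resp (begin
              ι g' * (ι g * x) + ι g * (ι g' * y) ≈⟨ solve 4 (λ g g' x y → g' :* (g :* x) :+ g :* (g' :* y) := (g :* g') :* (x :+ y)) refl (ι g) (ι g') x y ⟩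
              (ι g * ι g') * (x + y) ≈⟨ *-congʳ (ι-* g g') ⟨
              ι (g S.* g') * (x + y)                ∎)
            (bounded-+ (bounded-weaken (ℕ.m≤m+n (m' ℕ.+ n) (m ℕ.+ n')) (bounded-scale pol' b)) (bounded-weaken (ℕ.m≤n+m (m ℕ.+ n') (m' ℕ.+ n)) (bounded-scale pol b')))) }
      ; scale    = λ { {d} {x} (image {series = u} pol' e) (denominator {g = g} pol reg b) → denominator pol reg (bounded-resp (begin
              ι u * (ι g * x) ≈⟨ *-congʳ e ⟨
              d * (ι g * x) ≈⟨ solve 3 (λ d g x → d :* (g :* x) := g :* (d :* x)) refl d (ι g) x ⟩
              ι g * (d * x)     ∎) (bounded-scale pol' b)) }
      ; saturate = λ { {h} {x} (image {n} {u} pol' e) h-reg (denominator {m} {g = g} pol reg b) →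
          denominator {g = g S.* u} (polynomial-* {m} {n} {g} {u} pol pol') (regular-resp (trans (*-congˡ e) (sym (ι-* g u))) (regular-* reg h-reg))
            (bounded-resp (begin
              ι g * (h * x) ≈⟨ *-congˡ (*-congʳ e) ⟩
              ι g * (ι u * x) ≈⟨ *-assoc (ι g) (ι u) x ⟨
              (ι g * ι u) * x ≈⟨ *-congʳ (ι-* g u) ⟨
              ι (g S.* u) * x    ∎) b) }
      }) (λ {v} v∈ → denominator {g = S.1#} (polynomial-const F.1#) ι1-regular
           (bounded-resp (sym (trans (*-congʳ ι-1) (*-identityˡ v))) (bounded-generator v∈)))
      where
      ι1-regular : Regular laurentRing (ι S.1#)
      ι1-regular = regular-resp (sym ι-1) regular-1

    record CommonDenominator {n} (A : List 𝕃) (f : Fin n → 𝕃) : Set (c ⊔ ℓ) where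
      constructor commonDenominator
      field
        {degree bound} : ℕ
        {g}            : Series
        isPolynomial   : IsPolynomial degree g
        regular        : Regular laurentRing (ι g)
        bounded        : ∀ i → Bounded bound A (ι g * f i)

    multiply-denominator : ∀ {A x m n d g} → IsPolynomial m d → Bounded n A (ι g * x) → Bounded (m ℕ.+ n) A (ι (d S.* g) * x)
    multiply-denominator {x = x} {d = d} {g} pol b = bounded-resp (begin
      ι d * (ι g * x) ≈⟨ *-assoc (ι d) (ι g) x ⟨
      (ι d * ι g) * x ≈⟨ *-congʳ (ι-* d g) ⟨
      ι (d S.* g) * x    ∎) (bounded-scale pol b)

    multiply-denominatorʳ : ∀ {A x m n d g} → IsPolynomial m d → Bounded n A (ι g * x) → Bounded (m ℕ.+ n) A (ι (g S.* d) * x)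
    multiply-denominatorʳ {x = x} {d = d} {g} pol b = bounded-resp (*-congʳ (ι-cong (S.*-comm d g))) (multiply-denominator {x = x} {d = d} {g} pol b)

    span⇒common : ∀ {n A} (f : Fin n → 𝕃) → (∀ i → Span A (f i)) → CommonDenominator A f
    span⇒common {zero}  f f∈ = commonDenominator {bound = 0} {g = S.1#} (polynomial-const F.1#) (regular-resp (sym ι-1) regular-1) λ ()
    span⇒common {suc n} {A} f f∈ = merge (span⇒bounded (f∈ Fin.zero)) (span⇒common (λ i → f (Fin.suc i)) (λ i → f∈ (Fin.suc i)))
      where
      merge : Denominator A (f Fin.zero) → CommonDenominator A (λ i → f (Fin.suc i)) → CommonDenominator A f
      merge (denominator {m} {b} {g} pol reg bd) (commonDenominator {m'} {b'} {g'} pol' reg' bd') =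
        commonDenominator {g = g S.* g'} (polynomial-* {m} {m'} {g} {g'} pol pol') (regular-resp (sym (ι-* g g')) (regular-* reg reg')) λ
          { Fin.zero    → bounded-weaken (ℕ.m≤m+n (m' ℕ.+ b) (m ℕ.+ b')) (multiply-denominatorʳ {x = f Fin.zero} {d = g'} {g} pol' bd)
          ; (Fin.suc i) → bounded-weaken (ℕ.m≤n+m (m ℕ.+ b') (m' ℕ.+ b)) (multiply-denominator {x = f (Fin.suc i)} {d = g} {g'} pol (bd' i)) }

    bounded-elim : ∀ {M N A B w y} → Bounded M A y → (∀ j → Bounded N B (w * lookup A j)) → Bounded (M ℕ.+ N) B (w * y)
    bounded-elim {B = B} {w} (nil e) _ = bounded-resp (sym (trans (*-congˡ e) (zeroʳ w))) (bounded-null B)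
    bounded-elim {A = v ∷ _} {B} {w} {y} (cons {u = u} {y'} pol e b) f = bounded-resp (begin
      ι u * (w * v) + w * y' ≈⟨ solve 4 (λ u w v y → u :* (w :* v) :+ w :* y := w :* (u :* v :+ y)) refl (ι u) w v y' ⟩
      w * (ι u * v + y') ≈⟨ *-congˡ e ⟨
      w * y                   ∎) (bounded-+ (bounded-scale pol (f Fin.zero)) (bounded-elim b (λ j → f (Fin.suc j))))

    -- Λ takes v^Q back to v and divides degrees by Q; this contraction keeps the set of states
    -- finite.
    bounded-Λ : ∀ {M N A x} → M ≤ N ℕ.* Q → Bounded M (frobeniusImage A) x → Bounded N A (Λ x)
    bounded-Λ {A = []}    M≤NQ (nil e) = nil (trans (Λ-cong (trans e (sym (zeroˡ (1# ^′ Q * 0#))))) (trans (Λ-cong (trans (zeroˡ _) (sym 0^Q*0))) (trans (Λ-frobenius 0# 0#) (zeroˡ _))))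
      where
      0^Q*0 : 0# ^′ Q * 0# ≈ 0#
      0^Q*0 = zeroʳ _
    bounded-Λ {A = v ∷ A} {x} M≤NQ (cons {u = u} {y} pol e b) = cons (SF.polynomial-Λ M≤NQ pol) (begin
      Λ _ ≈⟨ Λ-cong e ⟩
      Λ (ι u * v ^′ Q + y) ≈⟨ Λ-+ (ι u * v ^′ Q) y ⟩
      Λ (ι u * v ^′ Q) + Λ y ≈⟨ +-congʳ (trans (Λ-cong (*-comm (ι u) (v ^′ Q))) (trans (Λ-frobenius v (ι u)) (trans (*-congˡ (Λ-ι u)) (*-comm v _)))) ⟩
      ι (SF.Λ u) * v + Λ y           ∎) (bounded-Λ M≤NQ b)

    private
      polynomialCode : ℕ → Series → ∀ N → Fin (q ^ N)
      polynomialCode q' u N = Fin.funToFin {N} (λ i → Inverse.to F.card (u (toℕ i)))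

      funToFin-injective : ∀ {m n} {f g : Fin m → Fin n} → Fin.funToFin f ≡ Fin.funToFin g → ∀ i → f i ≡ g i
      funToFin-injective {f = f} {g} e i = ≡.trans (≡.sym (Fin.finToFun-funToFin f i))
        (≡.trans (≡.cong (λ k → Fin.finToFun k i) e) (Fin.finToFun-funToFin g i))

      polynomialCode-injective : ∀ {N u v} → IsPolynomial N u → IsPolynomial N v →
        polynomialCode q u N ≡ polynomialCode q v N → u S.≈ v
      polynomialCode-injective {N} {u} {v} pol pol' e n with n ℕ.<? N
      ... | yes n<N = ≡.subst (λ n → u n F.≈ v n) (Fin.toℕ-fromℕ< n<N)
              (𝔽.to-injective (funToFin-injective {m = N} e (fromℕ< n<N)))
      ... | no  n≮N = F.trans (pol n (ℕ.≮⇒≥ n≮N)) (F.sym (pol' n (ℕ.≮⇒≥ n≮N)))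

    boundedCodes : ℕ → List 𝕃 → ℕ
    boundedCodes N []       = 1
    boundedCodes N (v ∷ vs) = q ^ N ℕ.* boundedCodes N vs

    -- The code belongs to the chosen coefficients and is not determined by the element; it is
    -- enough that equal codes force equal elements.
    boundedCode : ∀ {N vs y} → Bounded N vs y → Fin (boundedCodes N vs)
    boundedCode (nil _) = Fin.zero
    boundedCode {N} (cons {u = u} _ _ b) = Fin.combine (polynomialCode q u N) (boundedCode b)

    boundedCode-injective : ∀ {N vs x y} (b : Bounded N vs x) (b' : Bounded N vs y) → boundedCode b ≡ boundedCode b' → x ≈ y
    boundedCode-injective (nil e) (nil e') _ = trans e (sym e')
    boundedCode-injective {N} (cons {u = u} pol e b) (cons {u = u'} pol' e' b') eq
      with equ , eqb ← Fin.combine-injective (polynomialCode q u N) (boundedCode b) (polynomialCode q u' N) (boundedCode b') eq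
      = trans e (trans (+-cong (*-congʳ (ι-cong (polynomialCode-injective pol pol' equ))) (boundedCode-injective b b' eqb)) (sym e'))

    -- Since β^{nQ+r} y = (β^n)^Q (β^r y), the digit r acts on y by y ↦ Λ (β^r y), which
    -- preserves the finite set of those y for which g y is a combination
    -- of A with coefficients of degree less than D.
    module _ {A : List 𝕃} {β : 𝕃} {g : Series} (g-regular : Regular laurentRing (ι g))
             {D E G′ : ℕ} (power-polynomial : IsPolynomial G′ (g ^S (Q ∸ 2))) (D-bound : G′ ℕ.+ (D ℕ.+ E) ≤ D ℕ.* Q)
             (bounded-products : ∀ {r} → r < Q → ∀ j → Bounded E (frobeniusImage A) (ι g * β ^′ r * lookup A j))
             {l x ℓ'} (X′ : Setoid x ℓ') (G : (Fin l → F.Carrier) → Setoid.Carrier X′)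
             (G-cong : ∀ {f g} → (∀ i → f i F.≈ g i) → Setoid._≈_ X′ (G f) (G g)) where
      private
        Q-2 : ℕ
        Q-2 = Q ∸ 2

        Q≡ : 2 ℕ.+ Q-2 ≡ Q
        Q≡ = ℕ.m+[n∸m]≡n 2≤Q

        -- Several series are followed at once, so that all coefficients of a polynomial digit are
        -- produced by a single automaton.
        record Tuple : Set (c ⊔ ℓ) where
          field
            entries : Fin l → 𝕃
            bounded : ∀ i → Bounded D A (ι g * entries i)
        open Tuple

        bounded-multiplied : ∀ {r y} → r < Q → Bounded D A (ι g * y) → Bounded (G′ ℕ.+ (D ℕ.+ E)) (frobeniusImage A) (ι (g ^S Q-2) * (ι g * β ^′ r * (ι g * y)))
        bounded-multiplied {r} {y} r<Q b = bounded-scale {G′} {D ℕ.+ E} {frobeniusImage A} {g ^S Q-2} {ι g * β ^′ r * (ι g * y)} power-polynomial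
          (bounded-elim {D} {E} {A} {frobeniusImage A} {ι g * β ^′ r} {ι g * y} b (bounded-products r<Q))

        -- Moving g inside Λ makes it g^Q. One factor g clears the denominators of y, one those of
        -- the products of β^r with the generators, and the remaining g^(Q-2) merely raises the
        -- degree.
        multiplied≈ : ∀ r y → ι (g ^S Q-2) * (ι g * β ^′ r * (ι g * y)) ≈ ι g ^′ Q * (β ^′ r * y)
        multiplied≈ r y = begin
          ι (g ^S Q-2) * (ι g * β ^′ r * (ι g * y)) ≈⟨ *-congʳ (ι-^ g Q-2) ⟩
          ι g ^′ Q-2 * (ι g * β ^′ r * (ι g * y)) ≈⟨ solve 4 (λ h g b y → h :* (g :* b :* (g :* y)) := (g :* (g :* h)) :* (b :* y)) refl (ι g ^′ Q-2) (ι g) (β ^′ r) y ⟩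
          (ι g * (ι g * ι g ^′ Q-2)) * (β ^′ r * y)         ≡⟨ ≡.cong (λ n → ι g ^′ n * (β ^′ r * y)) Q≡ ⟩
          ι g ^′ Q * (β ^′ r * y)                           ∎

        bounded-next : ∀ {r y} → r < Q → Bounded D A (ι g * y) → Bounded D A (ι g * Λ (β ^′ r * y))
        bounded-next {r} {y} r<Q b = bounded-resp (trans (Λ-cong (multiplied≈ r y)) (Λ-frobenius (ι g) (β ^′ r * y)))
          (bounded-Λ D-bound (bounded-multiplied r<Q b))

        next : Tuple → ℕ → Tuple
        next y r with r ℕ.<? Q
        -- A default for numbers that are not digits in base Q.
        ... | no  _   = y
        ... | yes r<Q = record
          { entries = λ i → Λ (β ^′ r * entries y i)
          ; bounded = λ i → bounded-next {r} {entries y i} r<Q (bounded y i) }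

        value : Tuple → ℕ → Setoid.Carrier X′
        value y n = G (λ i → ε (β ^′ n * entries y i))

        value-next : ∀ y {r} → r < Q → ∀ n → Setoid._≈_ X′ (value (next y r) n) (value y (n ℕ.* Q ℕ.+ r))
        value-next y {r} r<Q n with r ℕ.<? Q
        ... | no  r≮Q = contradiction r<Q r≮Q
        ... | yes _   = G-cong λ i → coeff-cong (begin
          β ^′ n * Λ (β ^′ r * entries y i) ≈⟨ Λ-frobenius (β ^′ n) (β ^′ r * entries y i) ⟨
          Λ ((β ^′ n) ^′ Q * (β ^′ r * entries y i)) ≈⟨ Λ-cong (trans (sym (*-assoc _ _ _)) (*-congʳ (trans (*-congʳ (^-assocʳ β n Q)) (sym (^-homo-* β (n ℕ.* Q) r))))) ⟩
          Λ (β ^′ (n ℕ.* Q ℕ.+ r) * entries y i)         ∎) 0ℤ ⟨F⟩ ε-Λ (β ^′ (n ℕ.* Q ℕ.+ r) * entries y i)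
          where
          _⟨F⟩_ : ∀ {a b d} → a F.≈ b → b F.≈ d → a F.≈ d
          _⟨F⟩_ = F.trans

        code : Tuple → Fin (boundedCodes D A ^ l)
        code y = Fin.funToFin {l} (λ i → boundedCode (bounded y i))

        code-value : ∀ {y y'} → code y ≡ code y' → ∀ n → Setoid._≈_ X′ (value y n) (value y' n)
        code-value {y} {y'} e n = G-cong λ i → coeff-cong (*-congˡ (regular-cancel g-regular
          (boundedCode-injective (bounded y i) (bounded y' i) (funToFin-injective {m = l} e i)))) 0ℤ

      bounded⇒automatic : (ys : Fin l → 𝕃) → (∀ i → Bounded D A (ι g * ys i)) →
                          IsAutomatic X′ p (λ n → G (λ i → ε (β ^′ n * ys i)))
      bounded⇒automatic ys bounded-ys = Automata.blockAutomaton⇒automatic X′ {p} {q !} {{prime⇒nonZero pr}} {{ℕ.>-nonZero (ℕ.1≤n! q)}}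
        (record { State = Tuple ; next = next ; value = value ; value-next = value-next
                ; code = code ; code-value = λ {y} {y'} → code-value {y} {y'} })
        (record { entries = ys ; bounded = bounded-ys })
        (λ n → G (λ i → ε (β ^′ n * ys i))) (λ n → Setoid.refl X′)

    power-polynomial : ∀ {N u} n → IsPolynomial N u → ∃[ M ] IsPolynomial M (u ^S n)
    power-polynomial {N} {u} zero    pol = 1 , polynomial-const F.1#
    power-polynomial {N} {u} (suc n) pol = let (M , pol') = power-polynomial n pol in
      N ℕ.+ M , polynomial-* {N} {M} {u} {u ^S n} pol pol'

    -- The algebraic-to-automatic half of Christol's theorem in a form that is used twice: with β
    -- for the moments, and with z, where n ↦ ε(z^n ι(u)) is the coefficient sequence of u. By
    -- `ring⇒contracted` the finitely many products β^r v with r < Q have a common denominator over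
    -- the Q-th powers of `A`.
    coefficients-automatic : ∀ {A β l} → IsRing A → Span A β → (ys : Fin l → 𝕃) → (∀ i → Span A (ys i)) →
      ∀ {x ℓ'} (X′ : Setoid x ℓ') (G : (Fin l → F.Carrier) → Setoid.Carrier X′) →
      (∀ {f g} → (∀ i → f i F.≈ g i) → Setoid._≈_ X′ (G f) (G g)) →
      IsAutomatic X′ p (λ n → G (λ i → ε (β ^′ n * ys i)))
    coefficients-automatic {A} {β} ring β∈ ys ys∈ X′ G G-cong = conclude (span⇒common products products∈) (span⇒common ys ys∈)
      where
      products : Fin (Q ℕ.* length A) → 𝕃
      products i = β ^′ toℕ (proj₁ (Fin.remQuot {Q} (length A) i)) * lookup A (proj₂ (Fin.remQuot {Q} (length A) i))
      products∈ : ∀ i → Span (frobeniusImage A) (products i)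
      products∈ i = ring⇒contracted ring (IsRing.mul ring (IsRing.pow ring (toℕ (proj₁ (Fin.remQuot {Q} (length A) i))) β∈)
        (generator (Membershipₚ.∈-lookup setoid A (proj₂ (Fin.remQuot {Q} (length A) i)))))
      products-combine : ∀ {r} (r<Q : r < Q) j → products (Fin.combine (fromℕ< r<Q) j) ≡ β ^′ r * lookup A j
      products-combine r<Q j = let rq = Fin.remQuot-combine {Q} {length A} (fromℕ< r<Q) j in
        ≡.trans (≡.cong₂ (λ r j → β ^′ toℕ r * lookup A j) (≡.cong proj₁ rq) (≡.cong proj₂ rq))
                (≡.cong (λ r → β ^′ r * lookup A j) (Fin.toℕ-fromℕ< r<Q))
      conclude : CommonDenominator (frobeniusImage A) products → CommonDenominator A ys → IsAutomatic X′ p (λ n → G (λ i → ε (β ^′ n * ys i)))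
      conclude (commonDenominator {m₁} {n₁} {g₁} pol₁ reg₁ bd₁) (commonDenominator {m₂} {n₂} {g₂} pol₂ reg₂ bd₂) =
        bounded⇒automatic {A} {β} {g₁ S.* g₂} (regular-resp (sym (ι-* g₁ g₂)) (regular-* reg₁ reg₂)) {D} {E} {G′} pol bound
          (λ {r} r<Q j → bounded-resp (trans (*-congˡ (reflexive (products-combine r<Q j))) (sym (*-assoc (ι (g₁ S.* g₂)) (β ^′ r) (lookup A j))))
            (multiply-denominatorʳ {x = products (Fin.combine (fromℕ< r<Q) j)} {d = g₂} {g₁} pol₂ (bd₁ (Fin.combine (fromℕ< r<Q) j))))
          X′ G G-cong ys
          (λ i → bounded-weaken (ℕ.m≤m+n (m₁ ℕ.+ n₂) (G′ ℕ.+ E)) (multiply-denominator {x = ys i} {d = g₁} {g₂} pol₁ (bd₂ i)))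
        where
        pols = power-polynomial {m₁ ℕ.+ m₂} {g₁ S.* g₂} (Q ∸ 2) (polynomial-* {m₁} {m₂} {g₁} {g₂} pol₁ pol₂)
        G′ : ℕ
        G′ = proj₁ pols
        pol : IsPolynomial G′ ((g₁ S.* g₂) ^S (Q ∸ 2))
        pol = proj₂ pols
        E : ℕ
        E = m₂ ℕ.+ n₁
        -- The summand m₁ + n₂ makes room for the initial tuple. Since Q ≥ 2, the summand G′ + E
        -- ensures G′ + (D + E) ≤ 2D ≤ DQ, so Λ brings the degree back below D.
        D : ℕ
        D = (m₁ ℕ.+ n₂) ℕ.+ (G′ ℕ.+ E)
        rearrange : ∀ G′ D E → G′ ℕ.+ (D ℕ.+ E) ≡ D ℕ.+ (G′ ℕ.+ E)
        rearrange = solve-∀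
        bound : G′ ℕ.+ (D ℕ.+ E) ≤ D ℕ.* Q
        bound = ℕ.≤-trans (ℕ.≤-trans (ℕ.≤-reflexive (rearrange G′ D E)) (ℕ.+-monoʳ-≤ D (ℕ.m≤n+m (G′ ℕ.+ E) (m₁ ℕ.+ n₂))))
          (ℕ.≤-trans (ℕ.≤-reflexive (≡.trans (≡.cong (D ℕ.+_) (≡.sym (ℕ.+-identityʳ D))) (ℕ.*-comm 2 D))) (ℕ.*-monoʳ-≤ D 2≤Q))

  open LaurentLinearAlgebra

  -- Algebraicity with rational and with polynomial coefficients

  module AlgebraicLaurent where
    open L using (Laurent; constant; z⁻¹; 0L; eval; atZ⁻¹; IsRational; IsAlgebraic)
    open K hiding (zero)
    open KExp using (^-homo-*; ^-distrib-*; ^-assocʳ; ^-congˡ) renaming (_^_ to _^′_)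
    open KMembership using (_∈_)
    open KSolver
    open KRegular
    open KReasoning

    private
      𝓡 : 𝕃 → Set (c ⊔ ℓ)
      𝓡 = Image laurentRing ι

      constant-𝓡 : ∀ a → 𝓡 ⌈ constant a ⌉
      constant-𝓡 a = image {degree = 1} {series = const a} (polynomial-const a) (constant≈ι a)

      ⌈+*⌉ : ∀ a y x → ⌈ a L.+ y L.* x ⌉ ≈ ⌈ a ⌉ + ⌈ y ⌉ * ⌈ x ⌉
      ⌈+*⌉ a y x = trans (reflexive (+ᴷ-def a (y L.* x))) (+-congˡ (reflexive (*ᴷ-def y x)))

      eval≈evaluate : ∀ as y → ⌈ eval as y ⌉ ≈ evaluate (map ⌈_⌉ as) ⌈ y ⌉
      eval≈evaluate []       y = reflexive 0ᴷ-def
      eval≈evaluate (a ∷ as) y = trans (⌈+*⌉ a y (eval as y)) (+-congˡ (*-congˡ (eval≈evaluate as y)))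

      constants : List F.Carrier → List 𝕃
      constants = map (λ a → ⌈ constant a ⌉)

      atZ⁻¹≈evaluate : ∀ as → ⌈ atZ⁻¹ as ⌉ ≈ evaluate (constants as) t
      atZ⁻¹≈evaluate []       = reflexive 0ᴷ-def
      atZ⁻¹≈evaluate (a ∷ as) = trans (⌈+*⌉ (constant a) z⁻¹ (atZ⁻¹ as)) (+-congˡ (*-cong z⁻¹≈t (atZ⁻¹≈evaluate as)))

      atZ⁻¹-𝓡 : ∀ as → 𝓡 ⌈ atZ⁻¹ as ⌉
      atZ⁻¹-𝓡 as = 𝓡-resp (sym (atZ⁻¹≈evaluate as)) (go as)
        where
        go : ∀ as → 𝓡 (evaluate (constants as) t)
        go []       = 𝓡-0
        go (a ∷ as) = 𝓡-+ (constant-𝓡 a) (𝓡-* (image {degree = 2} {series = X} polynomial-X refl) (go as))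

      evaluate-coefficients : ∀ N {u} → IsPolynomial N u → evaluate (constants (applyUpTo u N)) t ≈ ι u
      evaluate-coefficients zero    pol = sym (trans (ι-cong (λ n → pol n z≤n)) ι-0)
      evaluate-coefficients (suc N) {u} pol = begin
        ⌈ constant (u 0) ⌉ + t * evaluate (constants (applyUpTo (tail u) N)) t
          ≈⟨ +-cong (constant≈ι (u 0)) (*-congˡ (evaluate-coefficients N {tail u} (λ n N≤n → pol (suc n) (s≤s N≤n)))) ⟩
        ι (const (u 0)) + t * ι (tail u) ≈⟨ +-congˡ (ι-* X (tail u)) ⟨
        ι (const (u 0)) + ι (X S.* tail u) ≈⟨ ι-+ _ _ ⟨
        ι (const (u 0) S.+ X S.* tail u) ≈⟨ ι-cong (head-tail u) ⟨
        ι u                                      ∎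

      atZ⁻¹-1 : ⌈ atZ⁻¹ (F.1# ∷ []) ⌉ ≈ 1#
      atZ⁻¹-1 = begin
        ⌈ atZ⁻¹ (F.1# ∷ []) ⌉ ≈⟨ atZ⁻¹≈evaluate (F.1# ∷ []) ⟩
        ⌈ constant F.1# ⌉ + t * 0# ≈⟨ +-congˡ (zeroʳ t) ⟩
        ⌈ constant F.1# ⌉ + 0# ≈⟨ +-identityʳ _ ⟩
        ⌈ constant F.1# ⌉                  ≡⟨ 1ᴷ-def ⟩
        1#                                 ∎

      ≉0⇒≉0L : ∀ {x} → ¬ (⌈ x ⌉ ≈ 0#) → ¬ (x L.≈ 0L)
      ≉0⇒≉0L x≉0 x≈0 = x≉0 (trans (⌈⌉-cong x≈0) (reflexive 0ᴷ-def))

      ≉0L⇒≉0 : ∀ {x} → ¬ (x L.≈ 0L) → ¬ (⌈ x ⌉ ≈ 0#)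
      ≉0L⇒≉0 x≉0 x≈0 = x≉0 (⌈⌉-injective (trans x≈0 (reflexive (≡.sym 0ᴷ-def))))

      𝓡⇒rational : ∀ {x} → 𝓡 x → IsRational ⌊ x ⌋
      𝓡⇒rational {x} (image {N} {u} pol e) = applyUpTo u N , F.1# ∷ [] ,
        ≉0⇒≉0L (λ e → 1≉0 (trans (sym atZ⁻¹-1) e)) , ⌈⌉-injective (begin
          ⌈ atZ⁻¹ (F.1# ∷ []) L.* ⌊ x ⌋ ⌉      ≡⟨ *ᴷ-def (atZ⁻¹ (F.1# ∷ [])) ⌊ x ⌋ ⟩
          ⌈ atZ⁻¹ (F.1# ∷ []) ⌉ * ⌈ ⌊ x ⌋ ⌉ ≈⟨ *-cong atZ⁻¹-1 (reflexive (⌈⌊⌋⌉ x)) ⟩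
          1# * x ≈⟨ *-identityˡ x ⟩
          x ≈⟨ e ⟩
          ι u ≈⟨ evaluate-coefficients N pol ⟨
          evaluate (constants (applyUpTo u N)) t ≈⟨ atZ⁻¹≈evaluate (applyUpTo u N) ⟨
          ⌈ atZ⁻¹ (applyUpTo u N) ⌉            ∎)

      -- A rational coefficient is only known not to be zero. It becomes regular after
      -- multiplication by the denominators, when it is a polynomial and `zero?` applies; hence the
      -- implication in `nonzero`.
      record Cleared (as : List 𝕃) (y : 𝕃) : Set (c ⊔ ℓ) where
        constructor cleared
        field
          {G}     : 𝕃
          {bs}    : List 𝕃
          𝓡G      : 𝓡 G
          regular : Regular laurentRing G
          𝓡bs     : All 𝓡 bs
          eq      : evaluate bs y ≈ G * evaluate as y
          nonzero : Any (λ a → ¬ (a ≈ 0#)) as → Any (Regular laurentRing) bs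

      evaluate-map : ∀ g bs y → evaluate (map (g *_) bs) y ≈ g * evaluate bs y
      evaluate-map g []       y = sym (zeroʳ g)
      evaluate-map g (b ∷ bs) y = trans (+-congˡ (*-congˡ (evaluate-map g bs y)))
        (solve 4 (λ g b y s → g :* b :+ y :* (g :* s) := g :* (b :+ y :* s)) refl g b y (evaluate bs y))

      evaluate-clear : ∀ {a as y f g G bs} → g * a ≈ f → evaluate bs y ≈ G * evaluate as y →
                       evaluate (G * f ∷ map (g *_) bs) y ≈ (g * G) * evaluate (a ∷ as) y
      evaluate-clear {a} {as} {y} {f} {g} {G} {bs} ga≈f eq = begin
        G * f + y * evaluate (map (g *_) bs) y ≈⟨ +-cong (*-congˡ (sym ga≈f)) (*-congˡ (evaluate-map g bs y)) ⟩
        G * (g * a) + y * (g * evaluate bs y) ≈⟨ +-congˡ (*-congˡ (*-congˡ eq)) ⟩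
        G * (g * a) + y * (g * (G * evaluate as y)) ≈⟨ solve 5 (λ G g a y s → G :* (g :* a) :+ y :* (g :* (G :* s)) := (g :* G) :* (a :+ y :* s)) refl G g a y (evaluate as y) ⟩
        (g * G) * (a + y * evaluate as y)            ∎

      nonzero-clear : ∀ {a f g G} → 𝓡 f → 𝓡 G → Regular laurentRing g → Regular laurentRing G → g * a ≈ f →
                      ¬ (a ≈ 0#) → Regular laurentRing (G * f)
      nonzero-clear {a} {f} {g} {G} 𝓡f 𝓡G g-regular G-regular ga≈f a≉0 = nonzero⇒regular {G * f} (𝓡-* 𝓡G 𝓡f)
        (λ Gf≈0 → a≉0 (g-regular a (trans ga≈f (G-regular f Gf≈0))))

      map-regular : ∀ {g bs} → Regular laurentRing g → Any (Regular laurentRing) bs → Any (Regular laurentRing) (map (g *_) bs)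
      map-regular {g} g-regular any = Any.map⁺ {P = Regular laurentRing} (Any.map (λ {b} reg → regular-* {g} {b} g-regular reg) any)

      -- The common denominator becomes g G: the new coefficient f / g turns into G f, and the
      -- coefficients cleared before acquire the factor g.
      clear-∷ : ∀ {a as y f g} → 𝓡 f → 𝓡 g → Regular laurentRing g → g * a ≈ f → Cleared as y → Cleared (a ∷ as) y
      clear-∷ {a} {as} {y} {f} {g} 𝓡f 𝓡g g-regular ga≈f (cleared {G} {bs} 𝓡G G-regular 𝓡bs eq nonzero) = cleared {G = g * G} {bs = G * f ∷ map (g *_) bs}
        (𝓡-* 𝓡g 𝓡G) (regular-* {g} {G} g-regular G-regular) (𝓡-* 𝓡G 𝓡f ∷ All.map⁺ {P = 𝓡} (All.map (λ {b} 𝓡b → 𝓡-* {g} {b} 𝓡g 𝓡b) 𝓡bs))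
        (evaluate-clear {a} {as} {y} {f} {g} {G} {bs} ga≈f eq) nonzero′
        where
        nonzero′ : Any (λ a → ¬ (a ≈ 0#)) (a ∷ as) → Any (Regular laurentRing) (G * f ∷ map (g *_) bs)
        nonzero′ (here a≉0)  = here (nonzero-clear {a} {f} {g} {G} 𝓡f 𝓡G g-regular G-regular ga≈f a≉0)
        nonzero′ (there any) = there (map-regular {g} {bs} g-regular (nonzero any))

      clear : ∀ as y → All IsRational as → Cleared (map ⌈_⌉ as) y
      clear []       y [] = cleared {G = 1#} {bs = []} 𝓡-1 regular-1 [] (sym (zeroʳ 1#)) λ ()
      clear (a ∷ as) y ((f , g , g≉0 , ga≈f) ∷ rats) =
        clear-∷ {⌈ a ⌉} {map ⌈_⌉ as} {y} {⌈ atZ⁻¹ f ⌉} {⌈ atZ⁻¹ g ⌉} (atZ⁻¹-𝓡 f) (atZ⁻¹-𝓡 g) g-regular (trans (reflexive (≡.sym (*ᴷ-def (atZ⁻¹ g) a))) (⌈⌉-cong ga≈f)) (clear as y rats)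
        where
        g-regular : Regular laurentRing ⌈ atZ⁻¹ g ⌉
        g-regular = nonzero⇒regular (atZ⁻¹-𝓡 g) (≉0L⇒≉0 g≉0)

    isAlgebraic⇒algebraic : ∀ {y} → IsAlgebraic y → Algebraic ⌈ y ⌉
    isAlgebraic⇒algebraic {y} (as , rats , any , eval≈0) = conclude (clear as ⌈ y ⌉ rats)
      where
      conclude : Cleared (map ⌈_⌉ as) ⌈ y ⌉ → Algebraic ⌈ y ⌉
      conclude (cleared {G} {bs} _ _ 𝓡bs eq nonzero) =
        relation⇒algebraic 𝓡bs (nonzero (Any.map⁺ (Any.map ≉0L⇒≉0 any))) (begin
          evaluate bs ⌈ y ⌉ ≈⟨ eq ⟩
          G * evaluate (map ⌈_⌉ as) ⌈ y ⌉ ≈⟨ *-congˡ (trans (sym (eval≈evaluate as y)) (trans (⌈⌉-cong eval≈0) (reflexive 0ᴷ-def))) ⟩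
          G * 0# ≈⟨ zeroʳ G ⟩
          0#                                  ∎)

    algebraic⇒isAlgebraic : ∀ {y} → Algebraic ⌈ y ⌉ → IsAlgebraic y
    algebraic⇒isAlgebraic {y} alg = conclude (algebraic⇒relation alg)
      where
      map-⌈⌊⌋⌉ : ∀ bs → map ⌈_⌉ (map ⌊_⌋ bs) ≡ bs
      map-⌈⌊⌋⌉ []       = ≡.refl
      map-⌈⌊⌋⌉ (b ∷ bs) = ≡.cong₂ _∷_ (⌈⌊⌋⌉ b) (map-⌈⌊⌋⌉ bs)
      conclude : (∃[ bs ] All 𝓡 bs × Any (Regular laurentRing) bs × evaluate bs ⌈ y ⌉ ≈ 0#) → IsAlgebraic y
      conclude (bs , 𝓡bs , any , eval≈0) = map ⌊_⌋ bs , All.map⁺ (All.map 𝓡⇒rational 𝓡bs) , Any.map⁺ (Any.map regular⇒≉0L any) ,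
        ⌈⌉-injective (begin
          ⌈ eval (map ⌊_⌋ bs) y ⌉ ≈⟨ eval≈evaluate (map ⌊_⌋ bs) y ⟩
          evaluate (map ⌈_⌉ (map ⌊_⌋ bs)) ⌈ y ⌉    ≡⟨ ≡.cong (λ bs → evaluate bs ⌈ y ⌉) (map-⌈⌊⌋⌉ bs) ⟩
          evaluate bs ⌈ y ⌉ ≈⟨ eval≈0 ⟩
          0#                                       ≡⟨ 0ᴷ-def ⟨
          ⌈ 0L ⌉                                   ∎)
        where
        regular⇒≉0L : ∀ {b} → Regular laurentRing b → ¬ (⌊ b ⌋ L.≈ 0L)
        regular⇒≉0L {b} reg = ≉0⇒≉0L (λ b≈0 → 1≉0 (reg 1# (trans (*-congʳ (trans (reflexive (≡.sym (⌈⌊⌋⌉ b))) b≈0)) (zeroˡ 1#))))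

  -- Integer parts and polynomials in z

  module IntegerPart where
    open L using (integerPart)
    open K hiding (zero)
    open KExp using (^-homo-*; ^-distrib-*; ^-assocʳ; ^-congˡ) renaming (_^_ to _^′_)
    open KMembership using (_∈_)
    open KSolver
    open KRegular
    open KReasoning

    private
      if-true : ∀ {b : Bool} {x y : F.Carrier} → b ≡ true → (if b then x else y) ≡ x
      if-true ≡.refl = ≡.refl

      if-false : ∀ {b : Bool} {x y : F.Carrier} → b ≡ false → (if b then x else y) ≡ y
      if-false ≡.refl = ≡.refl

      ≤⇒≤ᵇ≡true : ∀ {m n} → m ≤ n → (m ≤ᵇ n) ≡ true
      ≤⇒≤ᵇ≡true {m} {n} m≤n with m ≤ᵇ n in eq
      ... | true  = ≡.refl
      ... | false = contradiction (≡.subst Bool.T eq (ℕ.≤⇒≤ᵇ m≤n)) λ ()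

      >⇒≤ᵇ≡false : ∀ {m n} → n < m → (m ≤ᵇ n) ≡ false
      >⇒≤ᵇ≡false {m} {n} n<m with m ≤ᵇ n in eq
      ... | false = ≡.refl
      ... | true  = contradiction (ℕ.≤ᵇ⇒≤ m n (≡.subst Bool.T (≡.sym eq) _)) (ℕ.<⇒≱ n<m)

    coeff-integerPart-≤ : ∀ y {n} → n ℤ.≤ 0ℤ → L.coeff (integerPart y) n F.≈ L.coeff y n
    coeff-integerPart-≤ y {n} n≤0 with n ℤ.+ + L.bound y in eq
    ... | -[1+ _ ] = F.refl
    ... | + j      = F.reflexive (if-true (≤⇒≤ᵇ≡true (ℤ.drop‿+≤+
        (≡.subst₂ ℤ._≤_ eq (ℤ.+-identityˡ (+ L.bound y)) (ℤ.+-monoˡ-≤ (+ L.bound y) n≤0)))))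

    coeff-integerPart-> : ∀ y {n} → 0ℤ ℤ.< n → L.coeff (integerPart y) n F.≈ F.0#
    coeff-integerPart-> y {n} 0<n with n ℤ.+ + L.bound y in eq
    ... | -[1+ _ ] = F.refl
    ... | + j      = F.reflexive (if-false (>⇒≤ᵇ≡false (ℤ.drop‿+<+
        (≡.subst₂ ℤ._<_ (ℤ.+-identityˡ (+ L.bound y)) eq (ℤ.+-monoˡ-< (+ L.bound y) 0<n)))))

    integral⇒ι : ∀ {x} → (∀ n → n ℤ.< 0ℤ → coeff x n F.≈ F.0#) → x ≈ ι (λ j → coeff x (+ j))
    integral⇒ι {x} low = extensional eq
      where
      eq : ∀ n → coeff x n F.≈ coeff (ι (λ j → coeff x (+ j))) n
      eq (+ n)    = F.sym (coeff-ι (λ j → coeff x (+ j)) n)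
      eq -[1+ n ] = F.trans (low -[1+ n ] -<+) (F.sym (coeff-ι-negative (λ j → coeff x (+ j)) { -[1+ n ]} -<+))

    fractional⇒t*ι : ∀ {x} → (∀ n → n ℤ.≤ 0ℤ → coeff x n F.≈ F.0#) → x ≈ t * ι (λ j → coeff x (+ suc j))
    fractional⇒t*ι {x} low = trans (integral⇒ι (λ n n<0 → low n (ℤ.<⇒≤ n<0))) (trans (ι-cong eq) (ι-* X (λ j → coeff x (+ suc j))))
      where
      eq : (λ j → coeff x (+ j)) ≐ X S.* (λ j → coeff x (+ suc j))
      eq zero    = F.trans (low (+ 0) ℤ.≤-refl) (F.sym (X*-shift (λ j → coeff x (+ suc j)) 0))
      eq (suc n) = F.sym (X*-shift (λ j → coeff x (+ suc j)) (suc n))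

    open FiniteSum laurentRing public

    zSum : ℕ → (ℕ → 𝕃) → 𝕃
    zSum n h = sumTo n (λ j → h j * z ^′ j)

    zSum-cong : ∀ n {g h : ℕ → 𝕃} → (∀ j → j < n → g j ≈ h j) → zSum n g ≈ zSum n h
    zSum-cong n e = sumTo-cong n (λ j j<n → *-congʳ (e j j<n))

    zSum-+ : ∀ n (g h : ℕ → 𝕃) → zSum n (λ j → g j + h j) ≈ zSum n g + zSum n h
    zSum-+ n g h = trans (sumTo-cong n (λ j _ → distribʳ (z ^′ j) (g j) (h j))) (sumTo-+ n (λ j → g j * z ^′ j) (λ j → h j * z ^′ j))

    zSum-* : ∀ n d (h : ℕ → 𝕃) → zSum n (λ j → d * h j) ≈ d * zSum n h
    zSum-* n d h = trans (sumTo-cong n (λ j _ → *-assoc d (h j) (z ^′ j))) (sumTo-* n d (λ j → h j * z ^′ j))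

    coeff-monomial : ∀ a j n → coeff (ι (const a) * z ^′ j) n F.≈ coeff (ι (const a)) (n ℤ.+ + j)
    coeff-monomial a j n = F.trans (coeff-cong (*-comm (ι (const a)) (z ^′ j)) n) (coeff-z^* j (ι (const a)) n)

    coeff-0 : ∀ n → coeff 0# n F.≈ F.0#
    coeff-0 (+ n)    = F.trans (coeff-cong (sym ι-0) (+ n)) (coeff-ι S.0# n)
    coeff-0 -[1+ n ] = F.trans (coeff-cong (sym ι-0) -[1+ n ]) (coeff-ι-negative S.0# { -[1+ n ]} -<+)

    coeff-const : ∀ a n → ¬ (n ≡ 0ℤ) → coeff (ι (const a)) n F.≈ F.0#
    coeff-const a (+ zero)   n≢0 = contradiction ≡.refl n≢0
    coeff-const a (+ suc n)  n≢0 = coeff-ι (const a) (suc n)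
    coeff-const a -[1+ n ]   n≢0 = coeff-ι-negative (const a) { -[1+ n ]} -<+

    polynomial-zSum : ∀ D y → (∀ n → 0ℤ ℤ.< n → coeff y n F.≈ F.0#) →
                      (∀ n → n ℤ.+ + D ℤ.≤ 0ℤ → coeff y n F.≈ F.0#) →
                      y ≈ zSum D (λ j → ι (const (coeff y (ℤ.- + j))))
    polynomial-zSum D y high low = extensional λ n → F.sym (coefficient n)
      where
      S′ : ℕ → 𝕃
      S′ D = zSum D (λ j → ι (const (coeff y (ℤ.- + j))))
      n+j≡0 : ∀ {n j} → n ℤ.+ + j ≡ 0ℤ → n ≡ ℤ.- + j
      n+j≡0 {n} {j} e = ≡.trans (≡.sym (cancel n (+ j))) (≡.trans (≡.cong (ℤ._- + j) e) (ℤ.+-identityˡ _))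
        where
        cancel : ∀ i j → (i ℤ.+ j) ℤ.- j ≡ i
        cancel = solve-∀ᶻ
      outside : ∀ D n → (∀ j → j < D → ¬ (n ℤ.+ + j ≡ 0ℤ)) → coeff (S′ D) n F.≈ F.0#
      outside zero    n _  = coeff-0 n
      outside (suc D) n ne = F.trans (coeff-sum (S′ D) _ n) (F.trans
        (F.+-cong (outside D n (λ j j<D → ne j (ℕ.m≤n⇒m≤1+n j<D)))
                  (F.trans (coeff-monomial _ D n) (coeff-const _ (n ℤ.+ + D) (ne D ℕ.≤-refl)))) (F.+-identityˡ F.0#))
      inside : ∀ D j n → j < D → n ℤ.+ + j ≡ 0ℤ → coeff (S′ D) n F.≈ coeff y n
      inside (suc D) j n j<1+D e with ℕ.m≤n⇒m<n∨m≡n (ℕ.≤-pred j<1+D)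
      ... | inj₁ j<D    = F.trans (coeff-sum (S′ D) _ n) (F.trans (F.+-cong (inside D j n j<D e)
          (F.trans (coeff-monomial _ D n) (coeff-const _ (n ℤ.+ + D) λ e' →
            ℕ.<⇒≢ j<D (ℤ.+-injective (AbelianGroupProperties.∙-cancelˡ ℤ.+-0-abelianGroup n (+ j) (+ D) (≡.trans e (≡.sym e')))))))
          (F.+-identityʳ _))
      ... | inj₂ ≡.refl = F.trans (coeff-sum (S′ D) _ n) (F.trans (F.+-cong
          (outside D n (λ i i<D e' → ℕ.<⇒≢ i<D (ℤ.+-injective (AbelianGroupProperties.∙-cancelˡ ℤ.+-0-abelianGroup n (+ i) (+ D) (≡.trans e' (≡.sym e))))))
          (F.trans (coeff-monomial _ D n) (F.trans (F.reflexive (≡.cong (coeff (ι (const (coeff y (ℤ.- + D))))) e))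
            (F.trans (coeff-ι (const (coeff y (ℤ.- + D))) 0) (F.reflexive (≡.cong (coeff y) (≡.sym (n+j≡0 {n} {D} e))))))))
          (F.+-identityˡ _))
      coefficient : ∀ n → coeff (S′ D) n F.≈ coeff y n
      coefficient (+ suc n) = F.trans (outside D (+ suc n) (λ j _ ())) (F.sym (high (+ suc n) (ℤ.+<+ (s≤s z≤n))))
      coefficient (+ zero)  = origin D low
        where
        origin : ∀ D → (∀ n → n ℤ.+ + D ℤ.≤ 0ℤ → coeff y n F.≈ F.0#) → coeff (S′ D) (+ 0) F.≈ coeff y (+ 0)
        origin zero    low = F.trans (outside 0 (+ 0) (λ _ ())) (F.sym (low (+ 0) ℤ.≤-refl))
        origin (suc D) low = inside (suc D) 0 (+ 0) (s≤s z≤n) ≡.refl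
      coefficient -[1+ n ] with suc n ℕ.<? D
      ... | yes n<D = inside D (suc n) -[1+ n ] n<D (ℤ.n⊖n≡0 (suc n))
      ... | no  n≮D = F.trans (outside D -[1+ n ] (λ j j<D e → ℕ.<⇒≢ (ℕ.<-≤-trans j<D (ℕ.≮⇒≥ n≮D))
          (ℤ.+-injective (AbelianGroupProperties.∙-cancelˡ ℤ.+-0-abelianGroup -[1+ n ] (+ j) (+ suc n) (≡.trans e (≡.sym (ℤ.n⊖n≡0 (suc n))))))))
        (F.sym (low -[1+ n ] (≡.subst (-[1+ n ] ℤ.+ + D ℤ.≤_) (ℤ.n⊖n≡0 (suc n)) (ℤ.⊖-monoˡ-≤ (suc n) (ℕ.≮⇒≥ n≮D)))))

  open IntegerPart

  -- Linear systems that are triangular modulo X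

  module TriangularElimination where
    open K hiding (zero)
    open KExp using (^-homo-*; ^-distrib-*; ^-assocʳ; ^-congˡ) renaming (_^_ to _^′_)
    open KMembership using (_∈_)
    open KSolver
    open KRegular
    open KReasoning

    private
      *-vanishʳ : ∀ u v → v 0 F.≈ F.0# → (u S.* v) 0 F.≈ F.0#
      *-vanishʳ u v v0≈0 = F.trans (conv-zero u v) (F.trans (F.*-congˡ v0≈0) (F.zeroʳ (u 0)))

      -- Fraction-free elimination of the last unknown: row i times the pivot, minus m i n times row
      -- n. For j < n the entry m n j vanishes modulo X, so modulo X the matrix is only scaled by
      -- the pivot and stays triangular with nonzero diagonal.
      minor : ℕ → (ℕ → ℕ → Series) → ℕ → ℕ → Series
      minor n m i j = m n n S.* m i j S.+ S.- (m i n S.* m n j)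

      ι-minor : ∀ n m i j → ι (minor n m i j) ≈ ι (m n n) * ι (m i j) + (- ι (m i n)) * ι (m n j)
      ι-minor n m i j = begin
        ι (m n n S.* m i j S.+ S.- (m i n S.* m n j)) ≈⟨ ι-+ (m n n S.* m i j) (S.- (m i n S.* m n j)) ⟩
        ι (m n n S.* m i j) + ι (S.- (m i n S.* m n j)) ≈⟨ +-cong (ι-* (m n n) (m i j)) (trans (ι-neg (m i n S.* m n j)) (-‿cong (ι-* (m i n) (m n j)))) ⟩
        ι (m n n) * ι (m i j) - ι (m i n) * ι (m n j) ≈⟨ +-congˡ (solve 2 (λ x y → :- (x :* y) := (:- x) :* y) refl (ι (m i n)) (ι (m n j))) ⟩
        ι (m n n) * ι (m i j) + (- ι (m i n)) * ι (m n j)      ∎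

      minor-0 : ∀ n m i j → m n j 0 F.≈ F.0# → minor n m i j 0 F.≈ m n n 0 F.* m i j 0
      minor-0 n m i j mnj≈0 = F.trans (F.+-cong (conv-zero (m n n) (m i j))
          (F.trans (F.-‿cong (*-vanishʳ (m i n) (m n j) mnj≈0)) (AbelianGroupProperties.ε⁻¹≈ε F.+-abelianGroup)))
        (F.+-identityʳ _)

    unit-regular : ∀ {u} → ¬ (u 0 F.≈ F.0#) → Regular laurentRing (ι u)
    unit-regular {u} u0≉0 = let (v , uv≈1) = SF.unit {u} u0≉0 in
      regular-unit (trans (sym (ι-* u v)) (trans (ι-cong uv≈1) ι-1))

    -- The matrix m is upper triangular modulo X, with invertible diagonal.
    triangular-solution : ∀ {A} → IsRing A → ∀ n (m : ℕ → ℕ → Series) →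
      (∀ {i j} → i < n → j < n → Span A (ι (m i j))) →
      (∀ {i j} → j < i → i < n → m i j 0 F.≈ F.0#) →
      (∀ {i} → i < n → ¬ (m i i 0 F.≈ F.0#)) →
      (y : ℕ → 𝕃) → (∀ {i} → i < n → Span A (sumTo n (λ j → ι (m i j) * y j))) →
      ∀ {j} → j < n → Span A (y j)
    triangular-solution {A} ring (suc n) m m∈ lower diagonal y rows∈ = λ j<1+n → cases (ℕ.m≤n⇒m<n∨m≡n (ℕ.≤-pred j<1+n))
      where
      m′ : ℕ → ℕ → Series
      m′ = minor n m
      n<1+n : n < suc n
      n<1+n = ℕ.n<1+n n
      m<1+n : ∀ {i} → i < n → i < suc n
      m<1+n = ℕ.m<n⇒m<1+n
      partial : ℕ → 𝕃
      partial i = sumTo n (λ j → ι (m i j) * y j)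
      m′∈ : ∀ {i j} → i < n → j < n → Span A (ι (m′ i j))
      m′∈ {i} {j} i<n j<n = resp (sym (ι-minor n m i j))
        (add (IsRing.mul ring (m∈ n<1+n n<1+n) (m∈ (m<1+n i<n) (m<1+n j<n)))
             (IsRing.mul ring (span-negate (m∈ (m<1+n i<n) n<1+n)) (m∈ n<1+n (m<1+n j<n))))
      lower′ : ∀ {i j} → j < i → i < n → m′ i j 0 F.≈ F.0#
      lower′ {i} {j} j<i i<n = F.trans (minor-0 n m i j (lower (ℕ.<-trans j<i i<n) n<1+n))
        (F.trans (F.*-congˡ (lower j<i (m<1+n i<n))) (F.zeroʳ _))
      diagonal′ : ∀ {i} → i < n → ¬ (m′ i i 0 F.≈ F.0#)
      diagonal′ {i} i<n e = diagonal (m<1+n i<n) (𝔽.nonzero⇒regular (diagonal n<1+n) (m i i 0)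
        (F.trans (F.sym (minor-0 n m i i (lower i<n n<1+n))) e))
      rows′ : ∀ i → sumTo n (λ j → ι (m′ i j) * y j) ≈ ι (m n n) * sumTo (suc n) (λ j → ι (m i j) * y j) + (- ι (m i n)) * sumTo (suc n) (λ j → ι (m n j) * y j)
      rows′ i = begin
        sumTo n (λ j → ι (m′ i j) * y j)
          ≈⟨ sumTo-cong n (λ j _ → trans (*-congʳ (ι-minor n m i j)) (solve 5 (λ a b c d y → (a :* b :+ c :* d) :* y := a :* (b :* y) :+ c :* (d :* y)) refl (ι (m n n)) (ι (m i j)) (- ι (m i n)) (ι (m n j)) (y j))) ⟩
        sumTo n (λ j → ι (m n n) * (ι (m i j) * y j) + (- ι (m i n)) * (ι (m n j) * y j))
          ≈⟨ sumTo-+ n (λ j → ι (m n n) * (ι (m i j) * y j)) (λ j → (- ι (m i n)) * (ι (m n j) * y j)) ⟩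
        sumTo n (λ j → ι (m n n) * (ι (m i j) * y j)) + sumTo n (λ j → (- ι (m i n)) * (ι (m n j) * y j))
          ≈⟨ +-cong (sumTo-* n (ι (m n n)) (λ j → ι (m i j) * y j)) (sumTo-* n (- ι (m i n)) (λ j → ι (m n j) * y j)) ⟩
        ι (m n n) * partial i + (- ι (m i n)) * partial n
          ≈⟨ solve 5 (λ a b s r y → a :* s :+ (:- b) :* r := a :* (s :+ b :* y) :+ (:- b) :* (r :+ a :* y)) refl (ι (m n n)) (ι (m i n)) (partial i) (partial n) (y n) ⟩
        ι (m n n) * (partial i + ι (m i n) * y n) + (- ι (m i n)) * (partial n + ι (m n n) * y n) ∎
      below∈ : ∀ {j} → j < n → Span A (y j)
      below∈ = triangular-solution ring n m′ m′∈ lower′ diagonal′ y λ {i} i<n → resp (sym (rows′ i))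
        (add (IsRing.mul ring (m∈ n<1+n n<1+n) (rows∈ (m<1+n i<n)))
             (IsRing.mul ring (span-negate (m∈ (m<1+n i<n) n<1+n)) (rows∈ n<1+n)))
      partial∈ : ∀ l → l ≤ n → Span A (sumTo l (λ j → ι (m n j) * y j))
      partial∈ zero    _   = null
      partial∈ (suc l) l<n = add (partial∈ l (ℕ.<⇒≤ l<n)) (IsRing.mul ring (m∈ n<1+n (m<1+n l<n)) (below∈ l<n))
      last∈ : Span A (y n)
      last∈ = IsRing.divide ring (m∈ n<1+n n<1+n) (unit-regular {m n n} (diagonal n<1+n)) (resp
        (solve 2 (λ s d → (s :+ d) :- s := d) refl (partial n) (ι (m n n) * y n))
        (span-subtract (rows∈ n<1+n) (partial∈ n ℕ.≤-refl)))
      cases : ∀ {j} → j < n ⊎ j ≡ n → Span A (y j)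
      cases (inj₁ j<n)    = below∈ j<n
      cases (inj₂ ≡.refl) = last∈

  open TriangularElimination

  -- The β-expansion and its digit series, for β of degree e + 1

  module BetaExpansion (β₀ : LaurentSeries.Laurent F) (e : ℕ) (deg : LaurentSeries.HasDegree F β₀ (+ suc e)) where
    open L using (Laurent; integerPart; IsIntegral; T; expansion; IsAutomaticExpansion; laurentSetoid)
    open K hiding (zero)
    open KExp using (^-homo-*; ^-distrib-*; ^-assocʳ; ^-congˡ) renaming (_^_ to _^′_)
    open KMembership using (_∈_)
    open KSolver
    open KRegular
    open KReasoning

    β : 𝕃
    β = ⌈ β₀ ⌉

    b : Series
    b = rep (suc e) ⌊ β ⌋

    b0≉0 : ¬ (b 0 F.≈ F.0#)
    b0≉0 b0≈0 = proj₁ deg (F.trans (F.sym (coeff-⌈⌉ β₀ -[1+ e ])) b0≈0)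

    β≈ : β ≈ z ^′ suc e * ι b
    β≈ = normal-form (suc e) β (λ n n<0 → F.trans (coeff-⌈⌉ β₀ n) (proj₂ deg n (i+j<0⇒i<-j n (+ suc e) n<0)))

    b⁻¹ : Series
    b⁻¹ = proj₁ (SF.unit {b} b0≉0)

    w : 𝕃
    w = t ^′ suc e * ι b⁻¹

    z^*t^* : ∀ i j x → i ≤ j → z ^′ i * (t ^′ j * x) ≈ t ^′ (j ∸ i) * x
    z^*t^* i j x i≤j = begin
      z ^′ i * (t ^′ j * x)                        ≡⟨ ≡.cong (λ j → z ^′ i * (t ^′ j * x)) (ℕ.m+[n∸m]≡n i≤j) ⟨
      z ^′ i * (t ^′ (i ℕ.+ (j ∸ i)) * x) ≈⟨ *-congˡ (*-congʳ (^-homo-* t i (j ∸ i))) ⟩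
      z ^′ i * ((t ^′ i * t ^′ (j ∸ i)) * x) ≈⟨ solve 4 (λ z t s x → z :* ((t :* s) :* x) := (z :* t) :* (s :* x)) refl (z ^′ i) (t ^′ i) (t ^′ (j ∸ i)) x ⟩
      (z ^′ i * t ^′ i) * (t ^′ (j ∸ i) * x) ≈⟨ *-congʳ (z^*t^≈1 i) ⟩
      1# * (t ^′ (j ∸ i) * x) ≈⟨ *-identityˡ _ ⟩
      t ^′ (j ∸ i) * x                             ∎

    βw≈1 : β * w ≈ 1#
    βw≈1 = begin
      β * w ≈⟨ *-congʳ β≈ ⟩
      (z ^′ suc e * ι b) * (t ^′ suc e * ι b⁻¹) ≈⟨ solve 4 (λ z b t a → (z :* b) :* (t :* a) := (z :* t) :* (b :* a)) refl (z ^′ suc e) (ι b) (t ^′ suc e) (ι b⁻¹) ⟩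
      (z ^′ suc e * t ^′ suc e) * (ι b * ι b⁻¹) ≈⟨ *-cong (z^*t^≈1 (suc e)) (trans (sym (ι-* b b⁻¹)) (trans (ι-cong (proj₂ (SF.unit {b} b0≉0))) ι-1)) ⟩
      1# * 1# ≈⟨ *-identityˡ 1# ⟩
      1#                                                 ∎

    wβ*_ : ∀ x → w * (β * x) ≈ x
    wβ* x = trans (sym (*-assoc w β x)) (trans (*-congʳ (trans (*-comm w β) βw≈1)) (*-identityˡ x))

    w-regular : Regular laurentRing w
    w-regular = regular-unit (trans (*-comm w β) βw≈1)

    -- w = Xω, which is where the positive degree of β enters: series can be evaluated at w because
    -- it is divisible by X.
    ω : Series
    ω = X ^S e S.* b⁻¹

    open Substitution ω

    w≈ : w ≈ ι (X S.* ω)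
    w≈ = begin
      t ^′ suc e * ι b⁻¹ ≈⟨ *-congʳ (ι-^ X (suc e)) ⟨
      ι (X ^S suc e) * ι b⁻¹ ≈⟨ ι-* (X ^S suc e) b⁻¹ ⟨
      ι (X ^S suc e S.* b⁻¹) ≈⟨ ι-cong (S.*-assoc X (X ^S e) b⁻¹) ⟩
      ι (X S.* ω)                    ∎

    -- Evaluation of a power series at w = 1/β.
    φ : Series → 𝕃
    φ u = ι (σ u)

    φ-homomorphism : IsHomomorphism seriesRing laurentRing φ
    φ-homomorphism = ∘-homomorphism ι-homomorphism (record { φ-cong = σ-cong ; φ-1 = σ-const F.1# ; φ-+ = σ-+ ; φ-* = σ-* })

    φ-step : ∀ u → φ u ≈ ι (const (u 0)) + w * φ (tail u)
    φ-step u = begin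
      ι (σ u) ≈⟨ ι-cong (σ-step u) ⟩
      ι (const (u 0) S.+ X S.* (ω S.* σ (tail u))) ≈⟨ ι-+ (const (u 0)) (X S.* (ω S.* σ (tail u))) ⟩
      ι (const (u 0)) + ι (X S.* (ω S.* σ (tail u))) ≈⟨ +-congˡ (ι-cong (S.sym (S.*-assoc X ω (σ (tail u))))) ⟩
      ι (const (u 0)) + ι ((X S.* ω) S.* σ (tail u)) ≈⟨ +-congˡ (trans (ι-* (X S.* ω) (σ (tail u))) (*-congʳ (sym w≈))) ⟩
      ι (const (u 0)) + w * φ (tail u)                       ∎

    private
      module φ = IsHomomorphism φ-homomorphism

    φ-const : ∀ a → φ (const a) ≈ ι (const a)
    φ-const a = ι-cong (σ-const a)

    φX≈w : φ X ≈ w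
    φX≈w = begin
      φ X ≈⟨ φ-step X ⟩
      ι (const F.0#) + w * φ S.1# ≈⟨ +-cong (trans (ι-cong const-0) ι-0) (*-congˡ φ.φ-1) ⟩
      0# + w * 1# ≈⟨ trans (+-identityˡ _) (*-identityʳ w) ⟩
      w                                 ∎
      where
      const-0 : const F.0# ≐ S.0#
      const-0 zero    = F.refl
      const-0 (suc n) = F.refl

    φX-regular : Regular laurentRing (φ X)
    φX-regular = regular-resp (sym φX≈w) w-regular

    Integral : 𝕃 → Set (c ⊔ ℓ)
    Integral x = ∃[ u ] x ≈ ι u

    private
      integral-+ : ∀ {x y} → Integral x → Integral y → Integral (x + y)
      integral-+ (u , x≈) (v , y≈) = u S.+ v , trans (+-cong x≈ y≈) (sym (ι-+ u v))

      integral-* : ∀ {x y} → Integral x → Integral y → Integral (x * y)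
      integral-* (u , x≈) (v , y≈) = u S.* v , trans (*-cong x≈ y≈) (sym (ι-* u v))

      integral-neg : ∀ {x} → Integral x → Integral (- x)
      integral-neg (u , x≈) = S.- u , trans (-‿cong x≈) (sym (ι-neg u))

      integral-resp : ∀ {x y} → x ≈ y → Integral x → Integral y
      integral-resp e (u , x≈) = u , trans (sym e) x≈

      integral-t^ : ∀ n → Integral (t ^′ n)
      integral-t^ n = X ^S n , sym (ι-^ X n)

      integral-wz^ : ∀ {j} → j ≤ suc e → Integral (w * z ^′ j)
      integral-wz^ {j} j≤ = integral-resp (trans (sym (z^*t^* j (suc e) (ι b⁻¹) j≤)) (*-comm (z ^′ j) w))
        (integral-* (integral-t^ (suc e ∸ j)) (b⁻¹ , refl))

      integral-w-zSum : ∀ D h → D ≤ suc (suc e) → (∀ j → Integral (h j)) → Integral (w * zSum D h)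
      integral-w-zSum zero    h _      int = S.0# , trans (zeroʳ w) (sym ι-0)
      integral-w-zSum (suc D) h (s≤s D≤) int = integral-resp
        (solve 4 (λ w s a y → w :* s :+ a :* (w :* y) := w :* (s :+ a :* y)) refl w (zSum D h) (h D) (z ^′ D))
        (integral-+ (integral-w-zSum D h (ℕ.m≤n⇒m≤1+n D≤) int) (integral-* (int D) (integral-wz^ D≤)))

      -- E 0 is divisible by every power of w.
      w-divisible⇒0 : ∀ (E : ℕ → 𝕃) → (∀ n → Integral (E n)) → (∀ n → E n ≈ w * E (suc n)) → E 0 ≈ 0#
      w-divisible⇒0 E int step = trans (proj₂ (int 0)) (trans (ι-cong (Approximation.≈[]⇒≈ (λ N → go N 0))) ι-0)
        where
        u : ℕ → Series
        u n = proj₁ (int n)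
        u-step : ∀ n → u n S.≈ X S.* (ω S.* u (suc n))
        u-step n = S.trans (ι-injective (begin
          ι (u n) ≈⟨ proj₂ (int n) ⟨
          E n ≈⟨ step n ⟩
          w * E (suc n) ≈⟨ *-cong w≈ (proj₂ (int (suc n))) ⟩
          ι (X S.* ω) * ι (u (suc n)) ≈⟨ ι-* (X S.* ω) (u (suc n)) ⟨
          ι ((X S.* ω) S.* u (suc n))    ∎)) (S.*-assoc X ω (u (suc n)))
        open Approximation
        go : ∀ N n → u n ≈[ N ] S.0#
        go zero    n = λ _ ()
        go (suc N) n = ≈[]-trans (≈⇒≈[] (u-step n)) (≈[]-trans (X*-≈[] (*-≈[] ω (go N (suc n))))
          (≈⇒≈[] (S.trans (S.*-congˡ {X} (S.zeroʳ ω)) (S.zeroʳ X))))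

    -- z is the inverse of the coefficient t, so multiplication by z is an instance of `saturate`.
    z∈ : ∀ {B x} → Span B x → Span B (z * x)
    z∈ {B} {x} x∈ = saturate (image {degree = 2} {series = X} polynomial-X refl) t-regular (resp (begin
      x ≈⟨ *-identityˡ x ⟨
      1# * x ≈⟨ *-congʳ (trans (*-comm t z) z*t≈1) ⟨
      (t * z) * x ≈⟨ *-assoc t z x ⟩
      t * (z * x)  ∎) x∈)

    z^∈ : ∀ {B x} n → Span B x → Span B (z ^′ n * x)
    z^∈ zero    x∈ = resp (sym (*-identityˡ _)) x∈
    z^∈ (suc n) x∈ = resp (sym (*-assoc z (z ^′ n) _)) (z∈ (z^∈ n x∈))

    zSum∈ : ∀ {B} n {h : ℕ → 𝕃} → (∀ j → j < n → Span B (h j)) → Span B (zSum n h)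
    zSum∈ zero    h∈ = null
    zSum∈ (suc n) h∈ = add (zSum∈ n (λ j j<n → h∈ j (ℕ.m≤n⇒m≤1+n j<n))) (resp (*-comm _ _) (z^∈ n (h∈ n ℕ.≤-refl)))

    ring-of : ∀ {y} → Algebraic y → ∃[ A ] IsRing A × Span A y
    ring-of {y} alg = let (A , ring , ys∈) = ring-containing (y ∷ []) (alg ∷ []) in A , ring , All.head ys∈

    β-ring : Algebraic β → ∃[ B ] IsRing B × Span B β × Span B w
    β-ring alg = let (B , ring , β∈) = ring-of alg in
      B , ring , β∈ , IsRing.divide ring β∈ (regular-unit βw≈1) (resp (sym βw≈1) (IsRing.one ring))

    module _ (x : Laurent) where
      orbit : ℕ → 𝕃
      orbit n = ⌈ fold x (T β₀) n ⌉

      digits : ℕ → 𝕃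
      digits n = ⌈ expansion β₀ x n ⌉

      -- Digits are polynomials in z; for each power z^j their coefficients form a power series over
      -- 𝔽_q in the index n, to which Christol's theorem applies.
      digit : ℕ → Series
      digit j n = coeff (digits n) (ℤ.- + j)

      private
        coeff-βorbit : ∀ n m → L.coeff (β₀ L.* fold x (T β₀) n) m F.≈ coeff (β * orbit n) m
        coeff-βorbit n m = F.trans (F.sym (coeff-⌈⌉ (β₀ L.* fold x (T β₀) n) m)) (coeff-cong (reflexive (*ᴷ-def β₀ (fold x (T β₀) n))) m)

      coeff-digits-≤ : ∀ n {m} → m ℤ.≤ 0ℤ → coeff (digits n) m F.≈ coeff (β * orbit n) m
      coeff-digits-≤ n {m} m≤0 = F.trans (coeff-⌈⌉ (expansion β₀ x n) m)
        (F.trans (coeff-integerPart-≤ (β₀ L.* fold x (T β₀) n) m≤0) (coeff-βorbit n m))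

      coeff-digits-> : ∀ n {m} → 0ℤ ℤ.< m → coeff (digits n) m F.≈ F.0#
      coeff-digits-> n {m} 0<m = F.trans (coeff-⌈⌉ (expansion β₀ x n) m) (coeff-integerPart-> (β₀ L.* fold x (T β₀) n) 0<m)

      orbit-suc : ∀ n → orbit (suc n) ≈ β * orbit n - digits n
      orbit-suc n = trans (reflexive (+ᴷ-def (β₀ L.* fold x (T β₀) n) (L.- expansion β₀ x n)))
        (+-cong (reflexive (*ᴷ-def β₀ (fold x (T β₀) n))) (reflexive (-ᴷ-def (expansion β₀ x n))))

      orbit-step : ∀ n → orbit n ≈ w * (digits n + orbit (suc n))
      orbit-step n = begin
        orbit n ≈⟨ wβ* orbit n ⟨
        w * (β * orbit n) ≈⟨ *-congˡ (solve 2 (λ y a → y := a :+ (y :- a)) refl (β * orbit n) (digits n)) ⟩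
        w * (digits n + (β * orbit n - digits n)) ≈⟨ *-congˡ (+-congˡ (orbit-suc n)) ⟨
        w * (digits n + orbit (suc n))                      ∎

      orbit-fractional : ∀ n → ∃[ u ] orbit (suc n) ≈ t * ι u
      orbit-fractional n = _ , fractional⇒t*ι λ m m≤0 → F.trans (coeff-cong (orbit-suc n) m)
        (F.trans (coeff-sum (β * orbit n) (- digits n) m)
        (F.trans (F.+-congˡ (F.trans (coeff-minus (digits n) m) (F.-‿cong (coeff-digits-≤ n m≤0))))
          (F.-‿inverseʳ _)))

      expansion-polynomial : ∀ D n {u} → β * orbit n ≈ z ^′ D * ι u → digits n ≈ zSum (suc D) (λ j → ι (const (digit j n)))
      expansion-polynomial D n {u} eq = polynomial-zSum (suc D) (digits n)
        (λ m 0<m → coeff-digits-> n 0<m)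
        (λ m m≤ → F.trans (coeff-digits-≤ n (ℤ.≤-trans (ℤ.i≤i+j m (+ suc D)) m≤))
          (F.trans (coeff-cong eq m) (F.trans (coeff-z^* D (ι u) m)
            (coeff-ι-negative u (ℤ.<-≤-trans (ℤ.+-monoʳ-< m (ℤ.+<+ (ℕ.n<1+n D))) m≤)))))

      -- The iterates of T have negative degree, so the digits after the first have degree at most
      -- e; an initial integral x may produce a first digit of degree e + 1.
      expansion-fractional : ∀ n → digits (suc n) ≈ zSum (suc e) (λ j → ι (const (digit j (suc n))))
      expansion-fractional n = let (u , eq) = orbit-fractional n in expansion-polynomial e (suc n) (begin
        β * orbit (suc n) ≈⟨ *-cong β≈ eq ⟩
        (z ^′ suc e * ι b) * (t * ι u) ≈⟨ solve 5 (λ z y b t u → ((z :* y) :* b) :* (t :* u) := (z :* t) :* (y :* (b :* u))) refl z (z ^′ e) (ι b) t (ι u) ⟩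
        (z * t) * (z ^′ e * (ι b * ι u)) ≈⟨ *-cong z*t≈1 (*-congˡ (sym (ι-* b u))) ⟩
        1# * (z ^′ e * ι (b S.* u)) ≈⟨ *-identityˡ _ ⟩
        z ^′ e * ι (b S.* u)                   ∎)

      digit-top : ∀ n → digit (suc e) (suc n) F.≈ F.0#
      digit-top n = let (u , orbit≈) = orbit-fractional n in
        F.trans (coeff-digits-≤ (suc n) { -[1+ e ]} ℤ.-≤+)
        (F.trans (coeff-cong (begin
          β * orbit (suc n) ≈⟨ *-cong β≈ orbit≈ ⟩
          (z ^′ suc e * ι b) * (t * ι u) ≈⟨ trans (*-assoc _ _ _) (*-congˡ (solve 3 (λ b t u → b :* (t :* u) := t :* (b :* u)) refl (ι b) t (ι u))) ⟩
          z ^′ suc e * (t * (ι b * ι u)) ≈⟨ *-congˡ (trans (*-congˡ (sym (ι-* b u))) (sym (ι-* X (b S.* u)))) ⟩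
          z ^′ suc e * ι (X S.* (b S.* u))       ∎) -[1+ e ])
        (F.trans (coeff-z^* (suc e) (ι (X S.* (b S.* u))) -[1+ e ])
        (F.trans (F.reflexive (≡.cong (coeff (ι (X S.* (b S.* u)))) (ℤ.n⊖n≡0 (suc e))))
        (F.trans (coeff-ι (X S.* (b S.* u)) 0) (X*-shift (b S.* u) 0)))))

      module _ (x-integral : IsIntegral x) where
        orbit-integral : ∀ n → Integral (orbit n)
        orbit-integral zero    = _ , integral⇒ι (λ n n<0 → F.trans (coeff-⌈⌉ x n) (x-integral n n<0))
        orbit-integral (suc n) = let (u , eq) = orbit-fractional n in X S.* u , trans eq (sym (ι-* X u))

        expansion-integral : ∀ n → digits n ≈ zSum (suc (suc e)) (λ j → ι (const (digit j n)))
        expansion-integral n = let (u , eq) = orbit-integral n in expansion-polynomial (suc e) n (begin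
          β * orbit n ≈⟨ *-cong β≈ eq ⟩
          (z ^′ suc e * ι b) * ι u ≈⟨ *-assoc _ _ _ ⟩
          z ^′ suc e * (ι b * ι u) ≈⟨ *-congˡ (ι-* b u) ⟨
          z ^′ suc e * ι (b S.* u)      ∎)

        -- This is x = Σ a_n β^(-n) regrouped by powers of z. No infinite sum of digits is compared
        -- with x: the differences `orbit n - rest n` satisfy E n = w · E (n+1) and are integral, so
        -- the first is divisible by every power of w.
        digit-expansion : ⌈ x ⌉ ≈ w * zSum (suc (suc e)) (λ j → φ (digit j))
        digit-expansion = begin
          ⌈ x ⌉ ≈⟨ solve 2 (λ x y → x := (x :- y) :+ y) refl ⌈ x ⌉ (rest 0) ⟩
          (⌈ x ⌉ - rest 0) + rest 0 ≈⟨ +-congʳ (w-divisible⇒0 (λ n → orbit n - rest n) integral step) ⟩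
          0# + rest 0 ≈⟨ +-identityˡ _ ⟩
          rest 0             ∎
          where
          D = suc (suc e)
          later : ℕ → ℕ → Series
          later n j m = digit j (n ℕ.+ m)
          rest : ℕ → 𝕃
          rest n = w * zSum D (λ j → φ (later n j))
          integral : ∀ n → Integral (orbit n - rest n)
          -- Here D = e + 2 is the largest admissible number of terms: w z^j is integral only for j
          -- ≤ e + 1.
          integral n = integral-+ (orbit-integral n) (integral-neg (integral-w-zSum D _ ℕ.≤-refl (λ j → σ (later n j) , refl)))
          rest-step : ∀ n → rest n ≈ w * (digits n + rest (suc n))
          rest-step n = *-congˡ (begin
            zSum D (λ j → φ (later n j))
              ≈⟨ zSum-cong D (λ j _ → trans (φ-step (later n j)) (+-cong
                   (ι-cong (const-cong (F.reflexive (≡.cong (digit j) (ℕ.+-identityʳ n)))))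
                   (*-congˡ (φ.φ-cong (λ m → F.reflexive (≡.cong (digit j) (ℕ.+-suc n m))))))) ⟩
            zSum D (λ j → ι (const (digit j n)) + w * φ (later (suc n) j))
              ≈⟨ trans (zSum-+ D _ _) (+-congˡ (zSum-* D w _)) ⟩
            zSum D (λ j → ι (const (digit j n))) + rest (suc n)
              ≈⟨ +-congʳ (expansion-integral n) ⟨
            digits n + rest (suc n) ∎)
          step : ∀ n → orbit n - rest n ≈ w * (orbit (suc n) - rest (suc n))
          step n = begin
            orbit n - rest n ≈⟨ +-cong (orbit-step n) (-‿cong (rest-step n)) ⟩
            w * (digits n + orbit (suc n)) - w * (digits n + rest (suc n))
              ≈⟨ solve 4 (λ w a o r → w :* (a :+ o) :- w :* (a :+ r) := w :* (o :- r)) refl w (digits n) (orbit (suc n)) (rest (suc n)) ⟩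
            w * (orbit (suc n) - rest (suc n)) ∎

      digit-automatic : IsAutomaticExpansion p β₀ x → ∀ j → IsAutomatic F.setoid p (digit j)
      digit-automatic (κs , enumerates) j = κs , λ κ → Any.map (λ eq n → F.trans (coeff-⌈⌉ _ (ℤ.- + j)) (F.trans (eq n (ℤ.- + j)) (F.sym (coeff-⌈⌉ _ (ℤ.- + j))))) (enumerates κ)

    -- From automatic expansions to algebraic elements

    module AutomaticToAlgebraic where
      private
        coefficientRingʷ : IsCoefficientRing laurentRing (Image laurentRing φ)
        coefficientRingʷ = image-isCoefficientRing φ-homomorphism φX-regular

        module W = LinearAlgebra laurentRing (Image laurentRing φ) coefficientRingʷ
        module 𝓡ʷ = IsCoefficientRing coefficientRingʷ

        digit-algebraicʷ : ∀ {x} → IsAutomaticExpansion p β₀ x → ∀ j → W.Algebraic (φ (digit x j))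
        digit-algebraicʷ {x} auto j = AS.algebraic-image φ-homomorphism φX-regular {digit x j} (AS.automatic⇒algebraic (digit x j) (digit-automatic x auto j))

        -- Horner's rule as an induction principle for 𝔽_q[w].
        polynomial-closure : ∀ {r} {N : 𝕃 → Set r} → (∀ {x y} → x ≈ y → N x → N y) → N 0# → (∀ {x y} → N x → N y → N (x + y)) →
          (∀ a → N (ι (const a))) → (∀ {x} → N x → N (w * x)) → ∀ {x} → Image laurentRing φ x → N x
        polynomial-closure {N = N} N-resp N-null N-add N-const N-w (image {d} {u} pol eq) = N-resp (sym eq) (go d pol)
          where
          go : ∀ d {u} → IsPolynomial d u → N (φ u)
          go zero    pol     = N-resp (sym (trans (φ.φ-cong (λ n → pol n z≤n)) φ.φ-0)) N-null
          go (suc d) {u} pol = N-resp (sym (φ-step u)) (N-add (N-const (u 0)) (N-w (go d {tail u} (λ n d≤n → pol (suc n) (s≤s d≤n)))))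

        ι-const-𝓡 : ∀ a → Image laurentRing ι (ι (const a))
        ι-const-𝓡 a = image {degree = 1} {series = const a} (polynomial-const a) refl

      module _ {B : List 𝕃} (ring : IsRing B) (w∈ : Span B w) where
        private
          coefficientʷ∈ : ∀ {x} → Image laurentRing φ x → Span B x
          coefficientʷ∈ = polynomial-closure resp null add (λ a → IsRing.coefficient ring (ι-const-𝓡 a)) (IsRing.mul ring w∈)

          -- Transitivity of algebraicity: polynomials in w are elements of an algebra that contains
          -- w. A denominator is such an element too and not a coefficient over t, so it is kept as
          -- the factor g, to be removed in `adjoin`.
          change-coefficients : ∀ {vs y} → W.Span vs y → ∃[ g ] Span B g × Regular laurentRing g × Span (B ⊗ vs) (g * y)
          change-coefficients {vs} = W.span-elim {N = λ y → ∃[ g ] Span B g × Regular laurentRing g × Span (B ⊗ vs) (g * y)} (record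
            { resp     = λ { eq (g , g∈ , reg , y∈) → g , g∈ , reg , resp (*-congˡ eq) y∈ }
            ; null     = 1# , IsRing.one ring , regular-1 , resp (sym (zeroʳ 1#)) null
            ; add      = λ { {x} {y} (g , g∈ , reg , x∈) (g' , g'∈ , reg' , y∈) → g * g' , IsRing.mul ring g∈ g'∈ , regular-* reg reg' ,
                resp (solve 4 (λ g g' x y → g' :* (g :* x) :+ g :* (g' :* y) := (g :* g') :* (x :+ y)) refl g g' x y)
                     (add (left g'∈ x∈) (left g∈ y∈)) }
            ; scale    = λ { {d} {x} 𝓡d (g , g∈ , reg , x∈) → g , g∈ , reg ,
                resp (solve 3 (λ d g x → d :* (g :* x) := g :* (d :* x)) refl d g x) (left (coefficientʷ∈ 𝓡d) x∈) }
            ; saturate = λ { {h} {x} 𝓡h h-reg (g , g∈ , reg , x∈) → g * h , IsRing.mul ring g∈ (coefficientʷ∈ 𝓡h) , regular-* reg h-reg ,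
                resp (sym (*-assoc g h x)) x∈ }
            }) (λ v∈ → 1# , IsRing.one ring , regular-1 , ⊗-span (IsRing.one ring) (generator v∈))
            where
            left : ∀ {b x} → Span B b → Span (B ⊗ vs) x → Span (B ⊗ vs) (b * x)
            left {b} b∈ x∈ = resp (*-comm _ b) (⊗-elim (preimage-isSubspace (span-isSubspace _) b)
              (λ {u} {v} u∈ v∈ → resp (solve 3 (λ b u v → (b :* u) :* v := (u :* v) :* b) refl b u v)
                                   (⊗-span (IsRing.mul ring b∈ (generator u∈)) (generator v∈))) x∈)

        extensionʷ : ∀ {y} → W.Algebraic y → Extension B y
        extensionʷ {y} (n , y∈) =
          let (g , g∈ , reg , gy∈) = change-coefficients y∈
          in extension {B} {g} {y} {n} ring g∈ reg gy∈

      automatic⇒algebraic : Algebraic β → ∀ {x} → IsIntegral x → IsAutomaticExpansion p β₀ x → Algebraic ⌈ x ⌉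
      automatic⇒algebraic alg {x} int auto =
        let (B₀ , ring₀ , _ , w∈₀) = β-ring alg
            (B , ring , w∈ , digits∈) = adjoin-digits (suc (suc e)) ring₀ w∈₀
        in ring⇒algebraic ring (resp (sym (digit-expansion x int)) (IsRing.mul ring w∈ (zSum∈ (suc (suc e)) digits∈)))
        where
        adjoin-digits : ∀ n {B₀} → IsRing B₀ → Span B₀ w →
          ∃[ B ] IsRing B × Span B w × (∀ j → j < n → Span B (φ (digit x j)))
        adjoin-digits zero    {B₀} ring₀ w∈₀ = B₀ , ring₀ , w∈₀ , λ _ ()
        adjoin-digits (suc n) ring₀ w∈₀ =
          let (B , ring , w∈ , digits∈) = adjoin-digits n ring₀ w∈₀
              (E , ring' , sub , d∈)    = extensionʷ ring w∈ (digit-algebraicʷ auto n)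
          in E , ring' , sub w∈ , λ j j<1+n → extend-digits sub digits∈ d∈ (ℕ.m≤n⇒m<n∨m≡n (ℕ.≤-pred j<1+n))
          where
          extend-digits : ∀ {B E j} → (∀ {y} → Span B y → Span E y) → (∀ j → j < n → Span B (φ (digit x j))) →
            Span E (φ (digit x n)) → j < n ⊎ j ≡ n → Span E (φ (digit x j))
          extend-digits sub digits∈ d∈ (inj₁ j<n)    = sub (digits∈ _ j<n)
          extend-digits sub digits∈ d∈ (inj₂ ≡.refl) = d∈

      private
        record PolynomialIn-w (x : 𝕃) : Set (c ⊔ ℓ) where
          constructor polynomialIn-w
          field
            {bs} : List 𝕃
            𝓡bs  : All (Image laurentRing ι) bs
            eq   : x ≈ evaluate bs w

        sum : List 𝕃 → List 𝕃 → List 𝕃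
        sum []       bs       = bs
        sum (a ∷ as) []       = a ∷ as
        sum (a ∷ as) (b ∷ bs) = a + b ∷ sum as bs

        sum-𝓡 : ∀ {as bs} → All (Image laurentRing ι) as → All (Image laurentRing ι) bs → All (Image laurentRing ι) (sum as bs)
        sum-𝓡 []       bs       = bs
        sum-𝓡 (a ∷ as) []       = a ∷ as
        sum-𝓡 (a ∷ as) (b ∷ bs) = 𝓡-+ a b ∷ sum-𝓡 as bs

        evaluate-sum : ∀ as bs y → evaluate (sum as bs) y ≈ evaluate as y + evaluate bs y
        evaluate-sum []       bs       y = sym (+-identityˡ _)
        evaluate-sum (a ∷ as) []       y = sym (+-identityʳ _)
        evaluate-sum (a ∷ as) (b ∷ bs) y = trans (+-congˡ (*-congˡ (evaluate-sum as bs y)))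
          (solve 5 (λ a b y s t → (a :+ b) :+ y :* (s :+ t) := (a :+ y :* s) :+ (b :+ y :* t)) refl a b y (evaluate as y) (evaluate bs y))

        evaluate-map* : ∀ d bs y → evaluate (map (d *_) bs) y ≈ d * evaluate bs y
        evaluate-map* d []       y = sym (zeroʳ d)
        evaluate-map* d (b ∷ bs) y = trans (+-congˡ (*-congˡ (evaluate-map* d bs y)))
          (solve 4 (λ d b y s → d :* b :+ y :* (d :* s) := d :* (b :+ y :* s)) refl d b y (evaluate bs y))

        polynomialIn-w-resp : ∀ {x y} → x ≈ y → PolynomialIn-w x → PolynomialIn-w y
        polynomialIn-w-resp eq' (polynomialIn-w 𝓡bs eq) = polynomialIn-w 𝓡bs (trans (sym eq') eq)

        polynomialIn-w-null : PolynomialIn-w 0#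
        polynomialIn-w-null = polynomialIn-w [] refl

        polynomialIn-w-+ : ∀ {x y} → PolynomialIn-w x → PolynomialIn-w y → PolynomialIn-w (x + y)
        polynomialIn-w-+ (polynomialIn-w {as} 𝓡as eq) (polynomialIn-w {bs} 𝓡bs eq') =
          polynomialIn-w (sum-𝓡 𝓡as 𝓡bs) (trans (+-cong eq eq') (sym (evaluate-sum as bs w)))

        polynomialIn-w-scale : ∀ {d x} → Image laurentRing ι d → PolynomialIn-w x → PolynomialIn-w (d * x)
        polynomialIn-w-scale {d} 𝓡d (polynomialIn-w {bs} 𝓡bs eq) =
          polynomialIn-w (All.map⁺ (All.map (𝓡-* 𝓡d) 𝓡bs)) (trans (*-congˡ eq) (sym (evaluate-map* d bs w)))

        polynomialIn-w-w* : ∀ {x} → PolynomialIn-w x → PolynomialIn-w (w * x)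
        polynomialIn-w-w* (polynomialIn-w {bs} 𝓡bs eq) =
          polynomialIn-w (𝓡-0 ∷ 𝓡bs) (trans (*-congˡ eq) (sym (+-identityˡ _)))

        polynomialIn-w-𝓡ʷ : ∀ {g x} → PolynomialIn-w x → Image laurentRing φ g → PolynomialIn-w (g * x)
        polynomialIn-w-𝓡ʷ {x = x} x∈ = polynomial-closure {N = λ g → PolynomialIn-w (g * x)}
          (λ eq → polynomialIn-w-resp (*-congʳ eq)) (polynomialIn-w-resp (sym (zeroˡ x)) polynomialIn-w-null)
          (λ p r → polynomialIn-w-resp (sym (distribʳ x _ _)) (polynomialIn-w-+ p r))
          (λ a → polynomialIn-w-scale (ι-const-𝓡 a) x∈)
          (λ p → polynomialIn-w-resp (sym (*-assoc w _ x)) (polynomialIn-w-w* p))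

        -- Since t^n z^i = t^(n-i) for i ≤ n, one factor t^n turns a combination of 1, ..., z^n over
        -- 𝔽_q[w] into a polynomial in w with coefficients in 𝔽_q[t].
        combination-of-powers : ∀ {n y} → W.Span (W.powers z n) y →
          ∃[ g ] Image laurentRing φ g × Regular laurentRing g × PolynomialIn-w (t ^′ n * (g * y))
        combination-of-powers {n} = W.span-elim {N = λ y → ∃[ g ] Image laurentRing φ g × Regular laurentRing g × PolynomialIn-w (t ^′ n * (g * y))} (record
          { resp     = λ { eq (g , 𝓡g , reg , p) → g , 𝓡g , reg , polynomialIn-w-resp (*-congˡ (*-congˡ eq)) p }
          ; null     = 1# , 𝓡ʷ.𝓡-1 , regular-1 , polynomialIn-w-resp (sym (trans (*-congˡ (zeroʳ 1#)) (zeroʳ _))) polynomialIn-w-null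
          ; add      = λ { {x} {y} (g , 𝓡g , reg , p) (g' , 𝓡g' , reg' , p') → g * g' , 𝓡ʷ.𝓡-* 𝓡g 𝓡g' , regular-* reg reg' ,
              polynomialIn-w-resp (solve 5 (λ t g g' x y → g' :* (t :* (g :* x)) :+ g :* (t :* (g' :* y)) := t :* ((g :* g') :* (x :+ y))) refl (t ^′ n) g g' x y)
                (polynomialIn-w-+ (polynomialIn-w-𝓡ʷ p 𝓡g') (polynomialIn-w-𝓡ʷ p' 𝓡g)) }
          ; scale    = λ { {d} {x} 𝓡d (g , 𝓡g , reg , p) → g , 𝓡g , reg ,
              polynomialIn-w-resp (solve 4 (λ t d g x → d :* (t :* (g :* x)) := t :* (g :* (d :* x))) refl (t ^′ n) d g x) (polynomialIn-w-𝓡ʷ p 𝓡d) }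
          ; saturate = λ { {h} {x} 𝓡h h-reg (g , 𝓡g , reg , p) → g * h , 𝓡ʷ.𝓡-* 𝓡g 𝓡h , regular-* reg h-reg ,
              polynomialIn-w-resp (*-congˡ (sym (*-assoc g h x))) p }
          }) λ {v} v∈ → let (i , i≤n , v≈) = W.∈powers⇒^ z v∈ in 1# , 𝓡ʷ.𝓡-1 , regular-1 ,
            polynomialIn-w (t^-𝓡 (n ∸ i) ∷ []) (begin
              t ^′ n * (1# * v) ≈⟨ *-congˡ (trans (*-identityˡ v) v≈) ⟩
              t ^′ n * z ^′ i ≈⟨ solve 2 (λ t z → t :* z := z :* (t :* con (+ 1))) refl (t ^′ n) (z ^′ i) ⟩
              z ^′ i * (t ^′ n * 1#) ≈⟨ z^*t^* i n 1# i≤n ⟩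
              t ^′ (n ∸ i) * 1# ≈⟨ solve 2 (λ s w → s :* con (+ 1) := s :+ w :* con (+ 0)) refl (t ^′ (n ∸ i)) w ⟩
              t ^′ (n ∸ i) + w * 0#           ∎)

        constants : ℕ → Series → List 𝕃
        constants N u = applyUpTo (λ i → ι (const (u i))) N

        evaluate-constants : ∀ N {u} → IsPolynomial N u → evaluate (constants N u) w ≈ φ u
        evaluate-constants zero    pol     = sym (trans (φ.φ-cong (λ n → pol n z≤n)) φ.φ-0)
        evaluate-constants (suc N) {u} pol = trans (+-congˡ (*-congˡ (evaluate-constants N {tail u} (λ n N≤n → pol (suc n) (s≤s N≤n))))) (sym (φ-step u))

        tMultiples : List 𝕃 → List 𝕃
        tMultiples = map ((- t) *_)

        unit-constant-regular : ∀ {u} → ¬ (u 0 F.≈ F.0#) → Regular laurentRing (ι u)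
        unit-constant-regular {u} u0≉0 = let (v , uv≈1) = SF.unit {u} u0≉0 in
          regular-unit (trans (sym (ι-* u v)) (trans (ι-cong uv≈1) ι-1))

        -- The coefficient of index m is u m - t b for some polynomial b in t, or u m alone when the
        -- second list is too short. Its constant term u m is nonzero whatever b may be, so it is a
        -- unit among power series.
        sum-regular : ∀ N {u} m → m < N → ¬ (u m F.≈ F.0#) → ∀ {bs} → All (Image laurentRing ι) bs →
                      Any (Regular laurentRing) (sum (constants N u) (tMultiples bs))
        sum-regular (suc N) {u} zero    _         u0≉0 [] = here (unit-constant-regular {const (u 0)} u0≉0)
        sum-regular (suc N) {u} zero    _         u0≉0 {b ∷ _} (image {series = v} _ eq ∷ _) = here (regular-resp (begin
            ι (const (u 0) S.+ S.- (X S.* v)) ≈⟨ ι-+ (const (u 0)) (S.- (X S.* v)) ⟩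
            ι (const (u 0)) + ι (S.- (X S.* v)) ≈⟨ +-congˡ (trans (ι-neg (X S.* v)) (-‿cong (trans (ι-* X v) (*-congˡ (sym eq))))) ⟩
            ι (const (u 0)) - t * b ≈⟨ +-congˡ (solve 2 (λ t b → :- (t :* b) := (:- t) :* b) refl t b) ⟩
            ι (const (u 0)) + (- t) * b                 ∎)
          (unit-constant-regular {const (u 0) S.+ S.- (X S.* v)} λ sum≈0 → u0≉0 (F.trans (F.sym (F.trans
            (F.+-congˡ (F.trans (F.-‿cong (X*-shift v 0)) (AbelianGroupProperties.ε⁻¹≈ε F.+-abelianGroup))) (F.+-identityʳ (u 0)))) sum≈0)))
        sum-regular (suc N) (suc m) (s≤s m<N) um≉0 []             = there (constants-regular N m m<N um≉0)
          where
          constants-regular : ∀ N {u} m → m < N → ¬ (u m F.≈ F.0#) → Any (Regular laurentRing) (constants N u)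
          constants-regular (suc N) {u} zero    _         u0≉0 = here (unit-constant-regular {const (u 0)} u0≉0)
          constants-regular (suc N) (suc m) (s≤s m<N) um≉0 = there (constants-regular N m m<N um≉0)
        sum-regular (suc N) (suc m) (s≤s m<N) um≉0 (_ ∷ 𝓡bs)      = there (sum-regular N m m<N um≉0 𝓡bs)

      -- A relation for z over 𝔽_q[w] is, after division by a power of z, a relation for w
      -- over 𝔽_q[t]; it is nontrivial because the leading coefficient contributes its
      -- own, t-free, coefficients.
      z-algebraic⇒w-algebraic : W.Algebraic z → Algebraic w
      z-algebraic⇒w-algebraic (n , z∈) = conclude (combination-of-powers z∈)
        where
        conclude : (∃[ g ] Image laurentRing φ g × Regular laurentRing g × PolynomialIn-w (t ^′ n * (g * z ^′ suc n))) → Algebraic w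
        conclude (g , image {N} {u} pol g≈ , reg , polynomialIn-w {bs} 𝓡bs eq) = nontrivial (SF.polynomial-zero? pol)
          where
          relation : evaluate (sum (constants N u) (tMultiples bs)) w ≈ 0#
          -- At w the list `bs` has the value t^n g z^(n+1). A further factor t cancels all powers
          -- of z and leaves g, which is itself a polynomial in w.
          relation = begin
            evaluate (sum (constants N u) (tMultiples bs)) w ≈⟨ evaluate-sum (constants N u) (tMultiples bs) w ⟩
            evaluate (constants N u) w + evaluate (tMultiples bs) w ≈⟨ +-cong (trans (evaluate-constants N pol) (sym g≈)) (evaluate-map* (- t) bs w) ⟩
            g + (- t) * evaluate bs w ≈⟨ +-congˡ (*-congˡ (sym eq)) ⟩
            g + (- t) * (t ^′ n * (g * (z * z ^′ n))) ≈⟨ solve 5 (λ t s g z y → g :+ (:- t) :* (s :* (g :* (z :* y))) := g :- (z :* t) :* (g :* (y :* s))) refl t (t ^′ n) g z (z ^′ n) ⟩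
            g - (z * t) * (g * (z ^′ n * t ^′ n)) ≈⟨ +-congˡ (-‿cong (*-cong z*t≈1 (*-congˡ (z^*t^≈1 n)))) ⟩
            g - 1# * (g * 1#) ≈⟨ solve 1 (λ g → g :- con (+ 1) :* (g :* con (+ 1)) := con (+ 0)) refl g ⟩
            0#                                                              ∎
          nontrivial : u S.≈ S.0# ⊎ (∃[ m ] ¬ (u m F.≈ F.0#)) × (∃[ m ] ∃[ v ] u S.* v S.≈ Exp._^_ S.commutativeSemiring X m) → Algebraic w
          nontrivial (inj₁ u≈0) = contradiction (reg 1# (trans (*-congʳ (trans g≈ (trans (φ.φ-cong u≈0) φ.φ-0))) (zeroˡ 1#))) 1≉0
          nontrivial (inj₂ ((m , um≉0) , _)) = relation⇒algebraic {sum (constants N u) (tMultiples bs)}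
            (sum-𝓡 (All.applyUpTo⁺₂ _ N (λ i → ι-const-𝓡 (u i))) (All.map⁺ {P = Image laurentRing ι} (All.map (λ {b} 𝓡b → 𝓡-* { - t} {b} (𝓡-neg (image {degree = 2} {series = X} polynomial-X refl)) 𝓡b) 𝓡bs)))
            (sum-regular N m (ℕ.≰⇒> (λ N≤m → um≉0 (pol m N≤m))) um≉0 𝓡bs)
            relation

      1-integral : IsIntegral L.1L
      1-integral -[1+ n ] _ = F.refl
      1-integral (+ n) (+<+ ())

      -- The equation expresses w z^{e+1} through lower powers of z and the digit series.
      module _ (f : ℕ → Series) (f-algebraic : ∀ j → W.Algebraic (φ (f j))) {a : F.Carrier} (a≉0 : ¬ (a F.≈ F.0#))
               (top-digit : φ (f (suc e)) ≈ ι (const a)) (1≈ : 1# ≈ w * zSum (suc (suc e)) (λ j → φ (f j))) where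
        private
          extend-digits : ∀ {n} → (∃[ B ] W.IsRing B × (∀ j → j < n → W.Span B (φ (f j)))) → W.Algebraic (φ (f n)) →
            ∃[ B ] W.IsRing B × (∀ j → j < suc n → W.Span B (φ (f j)))
          extend-digits {n} (B , ring , digits∈) alg = conclude (W.algebraic-extension {B} {φ (f n)} ring alg)
            where
            conclude : W.Extension B (φ (f n)) → ∃[ B ] W.IsRing B × (∀ j → j < suc n → W.Span B (φ (f j)))
            conclude (E , ring' , sub , fn∈) = E , ring' , λ j j<1+n → cases (ℕ.m≤n⇒m<n∨m≡n (ℕ.≤-pred j<1+n))
              where
              cases : ∀ {j} → j < n ⊎ j ≡ n → W.Span E (φ (f j))
              cases {j} (inj₁ j<n)    = sub (digits∈ j j<n)
              cases {j} (inj₂ j≡n)    = ≡.subst (λ j → W.Span E (φ (f j))) (≡.sym j≡n) fn∈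
          ring-of-digits : ∀ n → ∃[ B ] W.IsRing B × (∀ j → j < n → W.Span B (φ (f j)))
          ring-of-digits zero    = _ , W.unitRing , λ _ ()
          ring-of-digits (suc n) = extend-digits (ring-of-digits n) (f-algebraic n)

          c-𝓡 : Image laurentRing φ (w * ι (const a))
          c-𝓡 = 𝓡ʷ.𝓡-* (image {degree = 2} {series = X} polynomial-X (sym φX≈w)) (image {degree = 1} {series = const a} (polynomial-const a) (sym (φ-const a)))
          top∈ : ∀ {B} → W.IsRing B → (∀ j → j < suc e → W.Span B (φ (f j))) → W.Span (B W.⊗ W.powers z e) ((w * ι (const a)) * z ^′ suc e)
          top∈ {B} ring digits∈ = W.resp (begin
              1# - w * zSum (suc e) (φ ∘ f) ≈⟨ +-congʳ 1≈ ⟩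
              w * (zSum (suc e) (φ ∘ f) + φ (f (suc e)) * z ^′ suc e) - w * zSum (suc e) (φ ∘ f)
                ≈⟨ solve 4 (λ w s d y → w :* (s :+ d :* y) :- w :* s := (w :* d) :* y) refl w (zSum (suc e) (φ ∘ f)) (φ (f (suc e))) (z ^′ suc e) ⟩
              (w * φ (f (suc e))) * z ^′ suc e ≈⟨ *-congʳ (*-congˡ top-digit) ⟩
              (w * ι (const a)) * z ^′ suc e     ∎)
            (W.span-subtract (W.resp (*-identityˡ 1#) (W.⊗-span (W.IsRing.one ring) (W.generator (W.^∈powers z {0} z≤n))))
              (W.scale (image {degree = 2} {series = X} polynomial-X (sym φX≈w)) (sum∈ (suc e) ℕ.≤-refl)))
            where
            sum∈ : ∀ n → n ≤ suc e → W.Span (B W.⊗ W.powers z e) (zSum n (φ ∘ f))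
            sum∈ zero    _        = W.null
            sum∈ (suc n) (s≤s n≤) = W.add (sum∈ n (ℕ.m≤n⇒m≤1+n n≤)) (W.⊗-span (digits∈ n (s≤s n≤)) (W.generator (W.^∈powers z n≤)))

          w-algebraic : (∃[ B ] W.IsRing B × (∀ j → j < suc e → W.Span B (φ (f j)))) → Algebraic w
          w-algebraic (B , ring , digits∈) = conclude (W.extension {B} {w * ι (const a)} {z} {e} ring (W.IsRing.coefficient ring c-𝓡)
              (regular-* w-regular (unit-constant-regular {const a} a≉0)) (top∈ ring digits∈))
            where
            conclude : W.Extension B z → Algebraic w
            conclude (E , ring' , _ , z∈E) = z-algebraic⇒w-algebraic (W.ring⇒algebraic ring' z∈E)

        digits-of-1⇒algebraic : Algebraic β
        digits-of-1⇒algebraic = conclude (ring-of (w-algebraic (ring-of-digits (suc e))))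
          where
          conclude : (∃[ A ] IsRing A × Span A w) → Algebraic β
          conclude (A , ring , w∈) = ring⇒algebraic ring (IsRing.divide ring w∈ w-regular (resp (sym (trans (*-comm w β) βw≈1)) (IsRing.one ring)))

      -- The first digit of 1 is [β], of degree e + 1, and the others have degree at most e.
      automatic-1⇒algebraic : ∀ {x} → ⌈ x ⌉ ≈ 1# → IsIntegral x → IsAutomaticExpansion p β₀ x → Algebraic β
      automatic-1⇒algebraic {x} x≈1 int auto = digits-of-1⇒algebraic (digit x) (digit-algebraicʷ auto) a≉0 top-digit
          (trans (sym x≈1) (digit-expansion x int))
        where
        a : F.Carrier
        a = digit x (suc e) 0
        a≈b0 : a F.≈ b 0
        a≈b0 = F.trans (coeff-digits-≤ x 0 { -[1+ e ]} ℤ.-≤+) (coeff-cong (trans (*-congˡ x≈1) (*-identityʳ β)) -[1+ e ])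
        a≉0 : ¬ (a F.≈ F.0#)
        a≉0 a≈0 = b0≉0 (F.trans (F.sym a≈b0) a≈0)
        top-digit : φ (digit x (suc e)) ≈ ι (const a)
        top-digit = trans (φ.φ-cong eq) (φ-const a)
          where
          eq : digit x (suc e) ≐ const a
          eq zero    = F.refl
          eq (suc n) = digit-top x n

    -- From algebraic elements to automatic expansions

    module AlgebraicToAutomatic where
      module FSum = FiniteSum F.commutativeRing
      module SSum = FiniteSum seriesRing

      private
        coeff-constant* : ∀ a y n → coeff (ι (const a) * y) n F.≈ a F.* coeff y n
        coeff-constant* a y n = F.trans (coeff-cong left n) (F.trans (coeff-z^* m (ι (const a S.* u)) n)
            (F.trans (eq (n ℤ.+ + m)) (F.*-congˡ (F.sym (F.trans (coeff-cong y≈ n) (coeff-z^* m (ι u) n))))))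
          where
          m : ℕ
          m = L.bound ⌊ y ⌋
          u : Series
          u = rep m ⌊ y ⌋
          y≈ : y ≈ z ^′ m * ι u
          y≈ = normal-form-≥ y ℕ.≤-refl
          left : ι (const a) * y ≈ z ^′ m * ι (const a S.* u)
          left = begin
            ι (const a) * y ≈⟨ *-congˡ y≈ ⟩
            ι (const a) * (z ^′ m * ι u) ≈⟨ solve 3 (λ a z u → a :* (z :* u) := z :* (a :* u)) refl (ι (const a)) (z ^′ m) (ι u) ⟩
            z ^′ m * (ι (const a) * ι u) ≈⟨ *-congˡ (ι-* (const a) u) ⟨
            z ^′ m * ι (const a S.* u)        ∎
          eq : ∀ i → coeff (ι (const a S.* u)) i F.≈ a F.* coeff (ι u) i
          eq (+ j)    = F.trans (coeff-ι (const a S.* u) j) (F.trans (const-*-coefficient a u j) (F.*-congˡ (F.sym (coeff-ι u j))))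
          eq -[1+ j ] = F.trans (coeff-ι-negative (const a S.* u) { -[1+ j ]} -<+)
            (F.sym (F.trans (F.*-congˡ (coeff-ι-negative u { -[1+ j ]} -<+)) (F.zeroʳ a)))

        ε-zSum : ∀ n y (g : ℕ → F.Carrier) → ε (y * zSum n (λ j → ι (const (g j)))) F.≈ FSum.sumTo n (λ j → g j F.* ε (y * z ^′ j))
        ε-zSum zero    y g = F.trans (coeff-cong (zeroʳ y) 0ℤ) (coeff-0 0ℤ)
        ε-zSum (suc n) y g = F.trans (coeff-cong (begin
            y * (zSum n (λ j → ι (const (g j))) + ι (const (g n)) * z ^′ n)
              ≈⟨ solve 4 (λ y s g z → y :* (s :+ g :* z) := y :* s :+ g :* (y :* z)) refl y (zSum n (λ j → ι (const (g j)))) (ι (const (g n))) (z ^′ n) ⟩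
            y * zSum n (λ j → ι (const (g j))) + ι (const (g n)) * (y * z ^′ n) ∎) 0ℤ)
          (F.trans (coeff-sum (y * zSum n (λ j → ι (const (g j)))) (ι (const (g n)) * (y * z ^′ n)) 0ℤ)
          (F.+-cong (ε-zSum n y g) (coeff-constant* (g n) (y * z ^′ n) 0ℤ)))

        ε-t^ : ∀ r u → ε (t ^′ suc r * ι u) F.≈ F.0#
        ε-t^ r u = F.trans (coeff-cong (trans (*-congʳ (sym (ι-^ X (suc r)))) (sym (ι-* (X ^S suc r) u))) 0ℤ)
          (F.trans (coeff-ι (X ^S suc r S.* u) 0) (SF.X^*-low (suc r) u 0 (s≤s z≤n)))

        wz^ : ∀ {i} u → i ≤ suc e → (w * z ^′ i) * ι u ≈ t ^′ (suc e ∸ i) * ι (b⁻¹ S.* u)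
        wz^ {i} u i≤ = begin
          (w * z ^′ i) * ι u ≈⟨ *-congʳ (*-comm w (z ^′ i)) ⟩
          (z ^′ i * (t ^′ suc e * ι b⁻¹)) * ι u ≈⟨ *-congʳ (z^*t^* i (suc e) (ι b⁻¹) i≤) ⟩
          (t ^′ (suc e ∸ i) * ι b⁻¹) * ι u ≈⟨ *-assoc _ _ _ ⟩
          t ^′ (suc e ∸ i) * (ι b⁻¹ * ι u) ≈⟨ *-congˡ (ι-* b⁻¹ u) ⟨
          t ^′ (suc e ∸ i) * ι (b⁻¹ S.* u)                  ∎

      -- w z^(j+1) has degree j - e, so its coefficient at z⁰ is zero for j < e and nonzero for j =
      -- e; this choice of multiplier makes the matrix of the `hankel (i + j)` anti-triangular
      -- modulo X.
      hankel : ℕ → Series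
      hankel j n = ε (β ^′ n * (w * z ^′ suc j))

      private
        hankel-start : ∀ {j} → j ≤ e → hankel j 0 F.≈ ε (t ^′ (e ∸ j) * ι b⁻¹)
        hankel-start {j} j≤e = coeff-cong (begin
          1# * (w * z ^′ suc j) ≈⟨ *-identityˡ _ ⟩
          w * z ^′ suc j ≈⟨ *-comm w (z ^′ suc j) ⟩
          z ^′ suc j * (t ^′ suc e * ι b⁻¹) ≈⟨ z^*t^* (suc j) (suc e) (ι b⁻¹) (s≤s j≤e) ⟩
          t ^′ (e ∸ j) * ι b⁻¹                ∎) 0ℤ

        hankel-low : ∀ {j} → j < e → hankel j 0 F.≈ F.0#
        hankel-low {j} j<e = F.trans (hankel-start (ℕ.<⇒≤ j<e))
          (F.trans (F.reflexive (≡.cong (λ r → ε (t ^′ r * ι b⁻¹)) (≡.sym (ℕ.suc-pred (e ∸ j) {{ℕ.>-nonZero (ℕ.m<n⇒0<n∸m j<e)}}))))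
            (ε-t^ (ℕ.pred (e ∸ j)) b⁻¹))

        hankel-middle : ¬ (hankel e 0 F.≈ F.0#)
        hankel-middle h≈0 = F.1≉0 (F.trans (F.sym (proj₂ (SF.unit {b} b0≉0) 0)) (F.trans (conv-zero b b⁻¹)
          (F.trans (F.*-congˡ (F.trans (F.sym start-b⁻¹) h≈0)) (F.zeroʳ (b 0)))))
          where
          start-b⁻¹ : hankel e 0 F.≈ b⁻¹ 0
          start-b⁻¹ = F.trans (hankel-start ℕ.≤-refl) (F.trans (coeff-cong (begin
            t ^′ (e ∸ e) * ι b⁻¹   ≡⟨ ≡.cong (λ r → t ^′ r * ι b⁻¹) (ℕ.n∸n≡0 e) ⟩
            1# * ι b⁻¹ ≈⟨ *-identityˡ _ ⟩
            ι b⁻¹                  ∎) 0ℤ) (coeff-ι b⁻¹ 0))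

      module _ (x : Laurent) where
        moment : ℕ → ℕ → Series
        moment i m n = ε (β ^′ n * ((w * z ^′ suc i) * orbit x (suc m)))

        private
          later : ℕ → ℕ → Series
          later m j n = digit x j (suc m ℕ.+ n)

          moment-zero : ∀ {i} m → i ≤ e → moment i m 0 F.≈ F.0#
          moment-zero {i} m i≤e = let (u , orbit≈) = orbit-fractional x m in F.trans (coeff-cong (begin
            1# * ((w * z ^′ suc i) * orbit x (suc m)) ≈⟨ *-identityˡ _ ⟩
            (w * z ^′ suc i) * orbit x (suc m) ≈⟨ *-congˡ orbit≈ ⟩
            (w * (z * z ^′ i)) * (t * ι u) ≈⟨ solve 5 (λ w z y t u → (w :* (z :* y)) :* (t :* u) := (z :* t) :* ((w :* y) :* u)) refl w z (z ^′ i) t (ι u) ⟩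
            (z * t) * ((w * z ^′ i) * ι u) ≈⟨ *-cong z*t≈1 (wz^ {i} u (ℕ.m≤n⇒m≤1+n i≤e)) ⟩
            1# * (t ^′ (suc e ∸ i) * ι (b⁻¹ S.* u)) ≈⟨ *-identityˡ _ ⟩
            t ^′ (suc e ∸ i) * ι (b⁻¹ S.* u)                 ≡⟨ ≡.cong (λ r → t ^′ r * ι (b⁻¹ S.* u)) (ℕ.+-∸-assoc 1 i≤e) ⟩
            t ^′ suc (e ∸ i) * ι (b⁻¹ S.* u)                 ∎) 0ℤ)
            (ε-t^ (e ∸ i) (b⁻¹ S.* u))

          -- One factor β cancels w and releases one digit of the orbit, leaving a moment of the
          -- next iterate with a smaller exponent. Repeating this yields a convolution, and
          -- `moment-zero` ends the recursion.
          moment-suc : ∀ i m n → moment i m (suc n) F.≈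
            FSum.sumTo (suc e) (λ j → digit x j (suc m) F.* hankel (i ℕ.+ j) n) F.+ moment i (suc m) n
          moment-suc i m n = F.trans (coeff-cong (begin
              (β * β ^′ n) * ((w * z ^′ suc i) * orbit x (suc m))
                ≈⟨ solve 5 (λ b q w y o → (b :* q) :* ((w :* y) :* o) := (b :* w) :* (q :* (y :* o))) refl β (β ^′ n) w (z ^′ suc i) (orbit x (suc m)) ⟩
              (β * w) * (β ^′ n * (z ^′ suc i * orbit x (suc m)))
                ≈⟨ trans (*-congʳ βw≈1) (*-identityˡ _) ⟩
              β ^′ n * (z ^′ suc i * orbit x (suc m))
                ≈⟨ *-congˡ (*-congˡ (trans (orbit-step x (suc m)) (*-congˡ (+-congʳ (expansion-fractional x m))))) ⟩
              β ^′ n * (z ^′ suc i * (w * (d + orbit x (suc (suc m)))))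
                ≈⟨ solve 5 (λ q y w d o → q :* (y :* (w :* (d :+ o))) := (q :* (w :* y)) :* d :+ q :* ((w :* y) :* o)) refl (β ^′ n) (z ^′ suc i) w d (orbit x (suc (suc m))) ⟩
              (β ^′ n * (w * z ^′ suc i)) * d + β ^′ n * ((w * z ^′ suc i) * orbit x (suc (suc m))) ∎) 0ℤ)
            (F.trans (coeff-sum ((β ^′ n * (w * z ^′ suc i)) * d) (β ^′ n * ((w * z ^′ suc i) * orbit x (suc (suc m)))) 0ℤ)
            (F.+-congʳ (F.trans (ε-zSum (suc e) (β ^′ n * (w * z ^′ suc i)) (λ j → digit x j (suc m)))
              (FSum.sumTo-cong (suc e) (λ j _ → F.*-congˡ (coeff-cong (begin
                (β ^′ n * (w * z ^′ suc i)) * z ^′ j ≈⟨ solve 4 (λ q w y v → (q :* (w :* y)) :* v := q :* (w :* (y :* v))) refl (β ^′ n) w (z ^′ suc i) (z ^′ j) ⟩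
                β ^′ n * (w * (z ^′ suc i * z ^′ j)) ≈⟨ *-congˡ (*-congˡ (^-homo-* z (suc i) j)) ⟨
                β ^′ n * (w * z ^′ suc (i ℕ.+ j))         ∎) 0ℤ))))))
            where
            d : 𝕃
            d = zSum (suc e) (λ j → ι (const (digit x j (suc m))))

          sum-coefficient : ∀ n (f : ℕ → Series) i → SSum.sumTo n f i F.≈ FSum.sumTo n (λ j → f j i)
          sum-coefficient zero    f i = F.refl
          sum-coefficient (suc n) f i = F.+-congʳ (sum-coefficient n f i)

          moment-convolution : ∀ {i} n m → i ≤ e → moment i m (suc n) F.≈ FSum.sumTo (suc e) (λ j → (later m j S.* hankel (i ℕ.+ j)) n)
          moment-convolution {i} zero    m i≤e = F.trans (moment-suc i m 0) (F.trans (F.+-congˡ (moment-zero (suc m) i≤e))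
            (F.trans (F.+-identityʳ _) (FSum.sumTo-cong (suc e) λ j _ → F.sym (F.trans (conv-zero (later m j) (hankel (i ℕ.+ j)))
              (F.*-congʳ (F.reflexive (≡.cong (digit x j) (ℕ.+-identityʳ (suc m)))))))))
          moment-convolution {i} (suc n) m i≤e = F.trans (moment-suc i m (suc n))
            (F.trans (F.+-congˡ (moment-convolution n (suc m) i≤e))
            (F.trans (F.sym (FSum.sumTo-+ (suc e) (λ j → digit x j (suc m) F.* hankel (i ℕ.+ j) (suc n)) (λ j → (later (suc m) j S.* hankel (i ℕ.+ j)) n)))
            (FSum.sumTo-cong (suc e) λ j _ → F.sym (F.trans (F.reflexive (conv-suc (later m j) (hankel (i ℕ.+ j)) n))
              (F.+-cong (F.*-congʳ (F.reflexive (≡.cong (digit x j) (ℕ.+-identityʳ (suc m)))))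
                (S.*-congʳ {hankel (i ℕ.+ j)} {tail (later m j)} {later (suc m) j} (λ l → F.reflexive (≡.cong (digit x j) (ℕ.+-suc (suc m) l))) n))))))

        -- The moments ε(βⁿ w z^{i+1} T(x)) are the convolution of the digit series with the
        -- Hankel matrix (hankel (i + j)), which is anti-triangular modulo X.
        moment-equation : ∀ {i} → i ≤ e → t * sumTo (suc e) (λ j → ι (hankel (i ℕ.+ j)) * ι (tail (digit x j))) ≈ ι (moment i 0)
        moment-equation {i} i≤e = begin
          t * sumTo (suc e) (λ j → ι (hankel (i ℕ.+ j)) * ι (tail (digit x j)))
            ≈⟨ *-congˡ (sumTo-cong (suc e) (λ j _ → trans (*-comm _ _) (sym (ι-* (tail (digit x j)) (hankel (i ℕ.+ j)))))) ⟩
          t * sumTo (suc e) (λ j → ι (tail (digit x j) S.* hankel (i ℕ.+ j)))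
            ≈⟨ *-congˡ (ι-sum (suc e) (λ j → tail (digit x j) S.* hankel (i ℕ.+ j))) ⟨
          t * ι (SSum.sumTo (suc e) (λ j → tail (digit x j) S.* hankel (i ℕ.+ j)))
            ≈⟨ ι-* X (SSum.sumTo (suc e) (λ j → tail (digit x j) S.* hankel (i ℕ.+ j))) ⟨
          ι (X S.* SSum.sumTo (suc e) (λ j → tail (digit x j) S.* hankel (i ℕ.+ j)))
            ≈⟨ ι-cong (S.trans (X*-shift _) eq) ⟩
          ι (moment i 0) ∎
          where
          eq : shift (SSum.sumTo (suc e) (λ j → tail (digit x j) S.* hankel (i ℕ.+ j))) ≐ moment i 0
          eq zero    = F.sym (moment-zero 0 i≤e)
          eq (suc n) = F.trans (sum-coefficient (suc e) (λ j → tail (digit x j) S.* hankel (i ℕ.+ j)) n) (F.sym (moment-convolution n 0 i≤e))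

      private
        -- Both halves of Christol's theorem in turn: the sequence is automatic because β and y are
        -- algebraic, and therefore its generating series in t is algebraic.
        automatic-coefficient : ∀ {A y} → IsRing A → Span A β → Span A y → Algebraic (ι (λ n → ε (β ^′ n * y)))
        automatic-coefficient {A} {y} ring β∈ y∈ = AS.algebraic-image ι-homomorphism t-regular {λ n → ε (β ^′ n * y)}
          (AS.automatic⇒algebraic (λ n → ε (β ^′ n * y))
            (coefficients-automatic {A} {β} {1} ring β∈ (λ _ → y) (λ _ → y∈) F.setoid (λ f → f Fin.zero) (λ f≈g → f≈g Fin.zero)))

        wz^∈ : ∀ {A} i → Span A w → Span A (w * z ^′ i)
        wz^∈ i w∈ = resp (*-comm (z ^′ i) w) (z^∈ i w∈)

        const∈ : ∀ {A} → IsRing A → ∀ a → Span A (ι (const a))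
        const∈ ring a = IsRing.coefficient ring (image {degree = 1} {series = const a} (polynomial-const a) refl)

        -- `zSum` indexes by natural numbers; the default 0 lies beyond the range over which it
        -- sums.
        finExtend : ∀ {l} → (Fin l → F.Carrier) → ℕ → F.Carrier
        finExtend {zero}  f j       = F.0#
        finExtend {suc l} f zero    = f Fin.zero
        finExtend {suc l} f (suc j) = finExtend (λ i → f (Fin.suc i)) j

        finExtend-cong : ∀ {l} {f g : Fin l → F.Carrier} → (∀ i → f i F.≈ g i) → ∀ j → finExtend f j F.≈ finExtend g j
        finExtend-cong {zero}  e j       = F.refl
        finExtend-cong {suc l} e zero    = e Fin.zero
        finExtend-cong {suc l} e (suc j) = finExtend-cong (λ i → e (Fin.suc i)) j

        finExtend-toℕ : ∀ {l} (g : ℕ → F.Carrier) j → j < l → finExtend {l} (λ i → g (toℕ i)) j F.≈ g j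
        finExtend-toℕ {suc l} g zero    _         = F.refl
        finExtend-toℕ {suc l} g (suc j) (s≤s j<l) = finExtend-toℕ {l} (λ j → g (suc j)) j j<l

      module _ {x : Laurent} (int : IsIntegral x) where
        private
          -- The generating series of the moments and of the Hankel entries need not lie in the
          -- algebra of β and x, so another algebra is built around them. The indices i + j of the
          -- Hankel entries reach 2e, which is below the bound.
          digits-in-ring : ∀ {A} → IsRing A → Span A β → Span A w → Span A ⌈ x ⌉ →
            ∃[ E ] IsRing E × (∀ {i} → i ≤ e → Span E (ι (moment x i 0))) × (∀ {j} → j < suc e ℕ.+ suc e → Span E (ι (hankel j)))
          digits-in-ring {A} ring β∈ w∈ x∈ = conclude (ring-containing (moments ++ hankels)
              (All.++⁺ (All.applyUpTo⁺₂ moment′ (suc e) (λ i → automatic-coefficient ring β∈ (IsRing.mul ring (wz^∈ (suc i) w∈) orbit∈)))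
                       (All.applyUpTo⁺₂ hankel′ (suc e ℕ.+ suc e) (λ j → automatic-coefficient ring β∈ (wz^∈ (suc j) w∈)))))
            where
            moment′ hankel′ : ℕ → 𝕃
            moment′ i = ι (moment x i 0)
            hankel′ j = ι (hankel j)
            moments hankels : List 𝕃
            moments = applyUpTo moment′ (suc e)
            hankels = applyUpTo hankel′ (suc e ℕ.+ suc e)
            orbit∈ : Span A (orbit x 1)
            orbit∈ = resp (sym (orbit-suc x 0)) (span-subtract (IsRing.mul ring β∈ x∈)
              (resp (sym (expansion-integral x int 0)) (zSum∈ (suc (suc e)) (λ j _ → const∈ ring (digit x j 0)))))
            conclude : (∃[ E ] IsRing E × All (Span E) (moments ++ hankels)) →
              ∃[ E ] IsRing E × (∀ {i} → i ≤ e → Span E (ι (moment x i 0))) × (∀ {j} → j < suc e ℕ.+ suc e → Span E (ι (hankel j)))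
            conclude (E , ring' , all) = E , ring' ,
              (λ {i} i≤e → All.applyUpTo⁻ moment′ (suc e) (All.++⁻ˡ moments all) (s≤s i≤e)) ,
              (λ {j} j< → All.applyUpTo⁻ hankel′ (suc e ℕ.+ suc e) (All.++⁻ʳ moments all) j<)

          module _ {A : List 𝕃} (ring : IsRing A) (moments∈ : ∀ {i} → i ≤ e → Span A (ι (moment x i 0)))
                   (hankels∈ : ∀ {j} → j < suc e ℕ.+ suc e → Span A (ι (hankel j))) where
            t-𝓡 : Image laurentRing ι t
            t-𝓡 = image {degree = 2} {series = X} polynomial-X refl

            tail∈ : ∀ {j} → j < suc e → Span A (ι (tail (digit x j)))
            -- Reversing the rows by i ↦ e - i makes the anti-triangular matrix triangular, with
            -- `hankel e` on the diagonal.
            tail∈ = triangular-solution ring (suc e) (λ i j → hankel (e ∸ i ℕ.+ j))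
              (λ {i} {j} _ j<1+e → hankels∈ (s≤s (ℕ.+-mono-≤ (ℕ.m∸n≤m e i) (ℕ.<⇒≤ j<1+e))))
              (λ {i} {j} j<i i<1+e → hankel-low (≡.subst (e ∸ i ℕ.+ j <_) (ℕ.m∸n+n≡m (ℕ.≤-pred i<1+e)) (ℕ.+-monoʳ-< (e ∸ i) j<i)))
              (λ {i} i<1+e h≈0 → hankel-middle (F.trans (F.reflexive (≡.cong (λ j → hankel j 0) (≡.sym (ℕ.m∸n+n≡m (ℕ.≤-pred i<1+e))))) h≈0))
              (λ j → ι (tail (digit x j)))
              -- The moment series start with a zero coefficient; saturation removes the resulting
              -- factor t.
              (λ {i} _ → saturate t-𝓡 t-regular (resp (sym (moment-equation x (ℕ.m∸n≤m e i))) (moments∈ (ℕ.m∸n≤m e i))))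

            digit∈ : ∀ j → j < suc (suc e) → Span A (ι (digit x j))
            digit∈ j j<2+e = resp (sym (begin
                ι (digit x j) ≈⟨ ι-cong (head-tail (digit x j)) ⟩
                ι (const (digit x j 0) S.+ X S.* tail (digit x j)) ≈⟨ ι-+ (const (digit x j 0)) (X S.* tail (digit x j)) ⟩
                ι (const (digit x j 0)) + ι (X S.* tail (digit x j)) ≈⟨ +-congˡ (ι-* X (tail (digit x j))) ⟩
                ι (const (digit x j 0)) + t * ι (tail (digit x j))     ∎))
              (add (const∈ ring (digit x j 0)) (scale t-𝓡 (cases (ℕ.m≤n⇒m<n∨m≡n (ℕ.≤-pred j<2+e)))))
              where
              cases : j < suc e ⊎ j ≡ suc e → Span A (ι (tail (digit x j)))
              cases (inj₁ j<1+e)  = tail∈ j<1+e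
              -- The coefficient of z^(e+1) occurs in the first digit only, so this tail is zero and
              -- needs no equation.
              cases (inj₂ ≡.refl) = resp (sym (trans (ι-cong (digit-top x)) ι-0)) null

            z∈A : Span A z
            z∈A = resp (*-identityʳ z) (z∈ (IsRing.one ring))

            assemble : (Fin (suc (suc e)) → F.Carrier) → Laurent
            assemble f = ⌊ zSum (suc (suc e)) (λ j → ι (const (finExtend f j))) ⌋

            assemble-cong : ∀ {f g} → (∀ i → f i F.≈ g i) → assemble f L.≈ assemble g
            assemble-cong f≈g = ≈ᴷ⇒≈ (zSum-cong (suc (suc e)) (λ j _ → ι-cong (const-cong (finExtend-cong f≈g j))))

            assemble-digits : ∀ n → assemble (λ i → ε (z ^′ n * ι (digit x (toℕ i)))) L.≈ expansion β₀ x n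
            assemble-digits n = ≡.subst (assemble (λ i → ε (z ^′ n * ι (digit x (toℕ i)))) L.≈_) (⌊⌈⌉⌋ (expansion β₀ x n)) (≈ᴷ⇒≈ (begin
              zSum (suc (suc e)) (λ j → ι (const (finExtend {suc (suc e)} (λ i → ε (z ^′ n * ι (digit x (toℕ i)))) j)))
                ≈⟨ zSum-cong (suc (suc e)) (λ j j<D → ι-cong (const-cong (F.trans (finExtend-toℕ {suc (suc e)} (λ j → ε (z ^′ n * ι (digit x j))) j j<D)
                     (F.trans (coeff-z^* n (ι (digit x j)) 0ℤ) (coeff-ι (digit x j) n))))) ⟩
              zSum (suc (suc e)) (λ j → ι (const (digit x j n)))
                ≈⟨ expansion-integral x int n ⟨
              digits x n ∎))

            -- Now z takes the place of β: ε(z^n ι(u)) recovers the coefficient u n. The e + 2 digit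
            -- series run in one tuple, and `assemble` makes each tuple of coefficients into a
            -- digit, so the sequence of digits itself is automatic.
            expansion-automatic : IsAutomaticExpansion p β₀ x
            expansion-automatic = automatic-cong laurentSetoid assemble-digits
              (coefficients-automatic {A} {z} {suc (suc e)} ring z∈A (λ i → ι (digit x (toℕ i))) (λ i → digit∈ (toℕ i) (Fin.toℕ<n i))
                laurentSetoid assemble assemble-cong)

        algebraic⇒automatic : Algebraic β → Algebraic ⌈ x ⌉ → IsAutomaticExpansion p β₀ x
        algebraic⇒automatic β-alg x-alg = conclude (ring-containing (β ∷ ⌈ x ⌉ ∷ []) (β-alg ∷ x-alg ∷ []))
          where
          conclude : (∃[ A ] IsRing A × All (Span A) (β ∷ ⌈ x ⌉ ∷ [])) → IsAutomaticExpansion p β₀ x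
          conclude (A , ring , β∈ ∷ x∈ ∷ []) =
            let w∈ = IsRing.divide ring β∈ (regular-unit βw≈1) (resp (sym βw≈1) (IsRing.one ring))
                (E , ring' , moments∈ , hankels∈) = digits-in-ring ring β∈ w∈ x∈
            in expansion-automatic ring' moments∈ hankels∈

theorem4p1 : ∀ {c ℓ} {p q k : ℕ} → Prime p → q ≡ p ^ k → (F : FiniteField c ℓ q) →
    let open LaurentSeries F in
    (β : Laurent) (d : ℤ) → HasDegree β d → 0ℤ ℤ.< d →
    (IsAlgebraic β ⇔ IsAutomaticExpansion p β 1L) ×
    (IsAutomaticExpansion p β 1L ⇔
    (∀ x → IsIntegral x → (IsAutomaticExpansion p β x ⇔ IsAlgebraic x)))
theorem4p1 pr q≡pᵏ F β (+ zero)  deg (+<+ ())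
theorem4p1 {k = k} pr q≡pᵏ F β (+ suc e) deg _ = mk⇔ i⇒ii ii⇒i , mk⇔ (λ ii → i⇒iii (ii⇒i ii)) iii⇒ii
  where
  open FormalSeries {k = k} pr q≡pᵏ F
  open L using (1L; IsAlgebraic; IsAutomaticExpansion; IsIntegral)
  open LaurentRing using (⌈_⌉; 1ᴷ-def)
  open LaurentLinearAlgebra using (Algebraic; ring⇒algebraic; unitRing; module IsRing)
  open AlgebraicLaurent using (isAlgebraic⇒algebraic; algebraic⇒isAlgebraic)
  module B = BetaExpansion β e deg
  open B.AutomaticToAlgebraic using (1-integral; automatic⇒algebraic; automatic-1⇒algebraic)
  open B.AlgebraicToAutomatic using (algebraic⇒automatic)
  1-algebraic : Algebraic ⌈ 1L ⌉
  1-algebraic = ≡.subst Algebraic (≡.sym 1ᴷ-def) (ring⇒algebraic unitRing (IsRing.one unitRing))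
  i⇒ii : IsAlgebraic β → IsAutomaticExpansion _ β 1L
  i⇒ii i = algebraic⇒automatic 1-integral (isAlgebraic⇒algebraic i) 1-algebraic
  ii⇒i : IsAutomaticExpansion _ β 1L → IsAlgebraic β
  ii⇒i ii = algebraic⇒isAlgebraic (automatic-1⇒algebraic (K.reflexive 1ᴷ-def) 1-integral ii)
  i⇒iii : IsAlgebraic β → ∀ x → IsIntegral x → IsAutomaticExpansion _ β x ⇔ IsAlgebraic x
  i⇒iii i x int = mk⇔
    (λ auto → algebraic⇒isAlgebraic (automatic⇒algebraic (isAlgebraic⇒algebraic i) int auto))
    (λ alg → algebraic⇒automatic int (isAlgebraic⇒algebraic i) (isAlgebraic⇒algebraic alg))
  iii⇒ii : (∀ x → IsIntegral x → IsAutomaticExpansion _ β x ⇔ IsAlgebraic x) → IsAutomaticExpansion _ β 1L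
  iii⇒ii iii = Equivalence.from (iii 1L 1-integral) (algebraic⇒isAlgebraic 1-algebraic)
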